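{- Let $L \in \{\mathsf{ND}, \mathsf{ND4}\}$. There exists a $\Sigma_1$ provability predicate $\mathrm{Pr}_T(x)$ of $T$ satisfying the following properties: 1. (Arithmetical soundness) For any modal formula $A$ and any arithmetical interpretation $f$ based on $\mathrm{Pr}_T(x)$, if $L \vdash A$, then $\mathsf{PA} \vdash f(A)$; 2. (Uniform arithmetical completeness) There exists an arithmetical interpretation $f$ based on $\mathrm{Pr}_T(x)$ such that for any modal formula $A$, $L \vdash A$ if and only if $T \vdash f(A)$.
   Context: $T$ is a primitive recursively axiomatized consistent extension of Peano Arithmetic $\mathsf{PA}$ in the language of first-order arithmetic. A formula $\mathrm{Pr}_T(x)$ is a provability predicate of $T$ if for every formula $\varphi$, $T \vdash \varphi$ iff $\mathsf{PA} \vdash \mathrm{Pr}_T(\ulcorner \varphi \urcorner)$, where $\ulcorner \varphi \urcorner$ is the numeral of the Gödel number of $\varphi$. An arithmetical interpretation $f$ based on $\mathrm{Pr}_T(x)$ maps modal formulas to arithmetical sentences with $f(\bot) \equiv 0=1$, $f$ commuting with $\neg, \land, \lor, \to$, and $f(\Box A) \equiv \mathrm{Pr}_T(\ulcorner f(A) \urcorner)$. $\mathsf{N}$ is classical propositional modal logic with the necessitation rule $A / \Box A$ (no other modal axioms); $\mathsf{ND} = \mathsf{N} + \neg(\Box A \land \Box \neg A)$; $\mathsf{ND4} = \mathsf{ND} + (\Box A \to \Box\Box A)$. -}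

module Defs where

open import Data.Nat using (ℕ; zero; suc; _+_; _*_; _^_; _<_)
open import Data.Fin using (Fin)
open import Data.Vec using (Vec; []; _∷_; lookup)
open import Data.Bool using (Bool; true; false; not; _∧_; _∨_)
open import Data.Product using (Σ; _×_; _,_)
open import Data.Unit using (⊤)
open import Data.Empty using (⊥)
open import Relation.Binary.PropositionalEquality using (_≡_)
open import Relation.Nullary using (¬_)

-- 1. The language of first-order arithmetic (0, S, +, ×, =),
--    de Bruijn-indexed variables.

infixl 7 _*'_
infixl 6 _+'_
data Term : Set where
  var  : ℕ → Term
  zer  : Term
  suc' : Term → Term
  _+'_ : Term → Term → Term
  _*'_ : Term → Term → Term

infix  4 _≐_
infixr 3 _⇒_
infixr 4 _∨'_
infixr 5 _∧'_
data Formula : Set where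
  _≐_  : Term → Term → Formula
  ¬'_  : Formula → Formula
  _∧'_ : Formula → Formula → Formula
  _∨'_ : Formula → Formula → Formula
  _⇒_  : Formula → Formula → Formula
  ∀'   : Formula → Formula
  ∃'   : Formula → Formula

renT : (ℕ → ℕ) → Term → Term
renT ρ (var n)  = var (ρ n)
renT ρ zer      = zer
renT ρ (suc' t) = suc' (renT ρ t)
renT ρ (s +' t) = renT ρ s +' renT ρ t
renT ρ (s *' t) = renT ρ s *' renT ρ t

shiftT : Term → Term
shiftT = renT suc

liftR : (ℕ → ℕ) → ℕ → ℕ
liftR ρ zero    = zero
liftR ρ (suc n) = suc (ρ n)

renF : (ℕ → ℕ) → Formula → Formula
renF ρ (s ≐ t)  = renT ρ s ≐ renT ρ t
renF ρ (¬' φ)   = ¬' renF ρ φ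
renF ρ (φ ∧' ψ) = renF ρ φ ∧' renF ρ ψ
renF ρ (φ ∨' ψ) = renF ρ φ ∨' renF ρ ψ
renF ρ (φ ⇒ ψ)  = renF ρ φ ⇒ renF ρ ψ
renF ρ (∀' φ)   = ∀' (renF (liftR ρ) φ)
renF ρ (∃' φ)   = ∃' (renF (liftR ρ) φ)

shiftF : Formula → Formula
shiftF = renF suc

subT : (ℕ → Term) → Term → Term
subT σ (var n)  = σ n
subT σ zer      = zer
subT σ (suc' t) = suc' (subT σ t)
subT σ (s +' t) = subT σ s +' subT σ t
subT σ (s *' t) = subT σ s *' subT σ t

liftS : (ℕ → Term) → ℕ → Term
liftS σ zero    = var zero
liftS σ (suc n) = shiftT (σ n)

subF : (ℕ → Term) → Formula → Formula
subF σ (s ≐ t)  = subT σ s ≐ subT σ t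
subF σ (¬' φ)   = ¬' subF σ φ
subF σ (φ ∧' ψ) = subF σ φ ∧' subF σ ψ
subF σ (φ ∨' ψ) = subF σ φ ∨' subF σ ψ
subF σ (φ ⇒ ψ)  = subF σ φ ⇒ subF σ ψ
subF σ (∀' φ)   = ∀' (subF (liftS σ) φ)
subF σ (∃' φ)   = ∃' (subF (liftS σ) φ)

single : Term → ℕ → Term
single t zero    = t
single t (suc n) = var n

_[_] : Formula → Term → Formula
φ [ t ] = subF (single t) φ

ClosedT : ℕ → Term → Set
ClosedT n (var k)  = k < n
ClosedT n zer      = ⊤
ClosedT n (suc' t) = ClosedT n t
ClosedT n (s +' t) = ClosedT n s × ClosedT n t
ClosedT n (s *' t) = ClosedT n s × ClosedT n t

ClosedF : ℕ → Formula → Set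
ClosedF n (s ≐ t)  = ClosedT n s × ClosedT n t
ClosedF n (¬' φ)   = ClosedF n φ
ClosedF n (φ ∧' ψ) = ClosedF n φ × ClosedF n ψ
ClosedF n (φ ∨' ψ) = ClosedF n φ × ClosedF n ψ
ClosedF n (φ ⇒ ψ)  = ClosedF n φ × ClosedF n ψ
ClosedF n (∀' φ)   = ClosedF (suc n) φ
ClosedF n (∃' φ)   = ClosedF (suc n) φ

Sentence : Formula → Set
Sentence = ClosedF 0

falsum : Formula
falsum = zer ≐ suc' zer

-- 2. Classical first-order logic with equality (Hilbert style).
--    A theory is a set of axioms; open axioms are read as their
--    universal closures (generalisation rule is unrestricted).

Theory : Set₁
Theory = Formula → Set

evalP : (Formula → Bool) → Formula → Bool
evalP V (s ≐ t)  = V (s ≐ t)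
evalP V (¬' φ)   = not (evalP V φ)
evalP V (φ ∧' ψ) = evalP V φ ∧ evalP V ψ
evalP V (φ ∨' ψ) = evalP V φ ∨ evalP V ψ
evalP V (φ ⇒ ψ)  = not (evalP V φ) ∨ evalP V ψ
evalP V (∀' φ)   = V (∀' φ)
evalP V (∃' φ)   = V (∃' φ)

Tautology : Formula → Set
Tautology φ = ∀ (V : Formula → Bool) → evalP V φ ≡ true

infix 2 _⊢_
data _⊢_ (Γ : Theory) : Formula → Set where
  ax     : ∀ {φ} → Γ φ → Γ ⊢ φ
  taut   : ∀ {φ} → Tautology φ → Γ ⊢ φ
  mp     : ∀ {φ ψ} → Γ ⊢ φ ⇒ ψ → Γ ⊢ φ → Γ ⊢ ψ
  gen    : ∀ {φ} → Γ ⊢ φ → Γ ⊢ ∀' φ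
  ∀-inst : ∀ φ t → Γ ⊢ ∀' φ ⇒ φ [ t ]
  ∀-dist : ∀ φ ψ → Γ ⊢ ∀' (shiftF ψ ⇒ φ) ⇒ (ψ ⇒ ∀' φ)
  ∃-intr : ∀ φ t → Γ ⊢ φ [ t ] ⇒ ∃' φ
  ∃-elim : ∀ φ ψ → Γ ⊢ ∀' (φ ⇒ shiftF ψ) ⇒ (∃' φ ⇒ ψ)
  eq-refl  : ∀ t → Γ ⊢ t ≐ t
  eq-subst : ∀ φ s t → Γ ⊢ s ≐ t ⇒ (φ [ s ] ⇒ φ [ t ])

private
  x y : Term
  x = var 0
  y = var 1

succSub : ℕ → Term
succSub zero    = suc' (var zero)
succSub (suc n) = var (suc n)

data PA : Theory where
  pa1 : PA (¬' (suc' x ≐ zer))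
  pa2 : PA (suc' x ≐ suc' y ⇒ x ≐ y)
  pa3 : PA (x +' zer ≐ x)
  pa4 : PA (x +' suc' y ≐ suc' (x +' y))
  pa5 : PA (x *' zer ≐ zer)
  pa6 : PA (x *' suc' y ≐ (x *' y) +' x)
  ind : ∀ φ → PA ((φ [ zer ] ∧' ∀' (φ ⇒ subF succSub φ)) ⇒ ∀' φ)

pair : ℕ → ℕ → ℕ
pair a b = 2 ^ a * suc (2 * b)

codeT : Term → ℕ
codeT (var n)  = pair 0 n
codeT zer      = pair 1 0
codeT (suc' t) = pair 2 (codeT t)
codeT (s +' t) = pair 3 (pair (codeT s) (codeT t))
codeT (s *' t) = pair 4 (pair (codeT s) (codeT t))

code : Formula → ℕ
code (s ≐ t)  = pair 0 (pair (codeT s) (codeT t))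
code (¬' φ)   = pair 1 (code φ)
code (φ ∧' ψ) = pair 2 (pair (code φ) (code ψ))
code (φ ∨' ψ) = pair 3 (pair (code φ) (code ψ))
code (φ ⇒ ψ)  = pair 4 (pair (code φ) (code ψ))
code (∀' φ)   = pair 5 (code φ)
code (∃' φ)   = pair 6 (code φ)

num : ℕ → Term
num zero    = zer
num (suc n) = suc' (num n)

⌜_⌝ : Formula → Term
⌜ φ ⌝ = num (code φ)

_⟨_⟩ : Formula → Formula → Formula
Pr ⟨ φ ⟩ = Pr [ ⌜ φ ⌝ ]

le : Term → Term → Formula
le a b = ∃' (var 0 +' shiftT a ≐ shiftT b)

data Δ0 : Formula → Set where
  atom : ∀ s t → Δ0 (s ≐ t)
  neg  : ∀ {φ} → Δ0 φ → Δ0 (¬' φ)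
  conj : ∀ {φ ψ} → Δ0 φ → Δ0 ψ → Δ0 (φ ∧' ψ)
  disj : ∀ {φ ψ} → Δ0 φ → Δ0 ψ → Δ0 (φ ∨' ψ)
  impl : ∀ {φ ψ} → Δ0 φ → Δ0 ψ → Δ0 (φ ⇒ ψ)
  ball : ∀ {φ} t → Δ0 φ → Δ0 (∀' (le (var 0) (shiftT t) ⇒ φ))
  bex  : ∀ {φ} t → Δ0 φ → Δ0 (∃' (le (var 0) (shiftT t) ∧' φ))

data Σ1 : Formula → Set where
  δ0  : ∀ {φ} → Δ0 φ → Σ1 φ
  ex  : ∀ {φ} → Σ1 φ → Σ1 (∃' φ)

data PR : ℕ → Set where
  Z    : ∀ {n} → PR n
  S    : PR 1
  P    : ∀ {n} → Fin n → PR n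
  comp : ∀ {m n} → PR m → Vec (PR n) m → PR n
  rec  : ∀ {n} → PR n → PR (suc (suc n)) → PR (suc n)

mutual
  evalPR : ∀ {n} → PR n → Vec ℕ n → ℕ
  evalPR Z xs = 0
  evalPR S (a ∷ []) = suc a
  evalPR (P i) xs = lookup xs i
  evalPR (comp f gs) xs = evalPR f (evalPRs gs xs)
  evalPR (rec g h) (zero ∷ xs) = evalPR g xs
  evalPR (rec g h) (suc k ∷ xs) = evalPR h (k ∷ evalPR (rec g h) (k ∷ xs) ∷ xs)

  evalPRs : ∀ {m n} → Vec (PR n) m → Vec ℕ n → Vec ℕ m
  evalPRs [] xs = []
  evalPRs (g ∷ gs) xs = evalPR g xs ∷ evalPRs gs xs

PrimRecAxiomatized : Theory → Set
PrimRecAxiomatized T =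
  Σ (PR 1) λ χ → ∀ φ → (T φ → evalPR χ (code φ ∷ []) ≡ 1)
                     × (evalPR χ (code φ ∷ []) ≡ 1 → T φ)

Extends : Theory → Theory → Set
Extends T U = ∀ φ → U ⊢ φ → T ⊢ φ

Consistent : Theory → Set
Consistent T = ¬ (T ⊢ falsum)

IsProvPred : Theory → Formula → Set
IsProvPred T Pr =
  ClosedF 1 Pr × (∀ φ → (T ⊢ φ → PA ⊢ Pr ⟨ φ ⟩) × (PA ⊢ Pr ⟨ φ ⟩ → T ⊢ φ))

infixr 3 _m⇒_
infixr 4 _m∨_
infixr 5 _m∧_
data MForm : Set where
  mvar : ℕ → MForm
  m⊥   : MForm
  m¬   : MForm → MForm
  _m∧_ : MForm → MForm → MForm
  _m∨_ : MForm → MForm → MForm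
  _m⇒_ : MForm → MForm → MForm
  □    : MForm → MForm

evalM : (MForm → Bool) → MForm → Bool
evalM V (mvar p)  = V (mvar p)
evalM V m⊥        = false
evalM V (m¬ A)    = not (evalM V A)
evalM V (A m∧ B)  = evalM V A ∧ evalM V B
evalM V (A m∨ B)  = evalM V A ∨ evalM V B
evalM V (A m⇒ B)  = not (evalM V A) ∨ evalM V B
evalM V (□ A)     = V (□ A)

MTautology : MForm → Set
MTautology A = ∀ (V : MForm → Bool) → evalM V A ≡ true

data Logic : Set where
  ND ND4 : Logic

infix 2 _⊢ₘ_
data _⊢ₘ_ : Logic → MForm → Set where
  taut : ∀ {L A} → MTautology A → L ⊢ₘ A
  mp   : ∀ {L A B} → L ⊢ₘ A m⇒ B → L ⊢ₘ A → L ⊢ₘ B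
  nec  : ∀ {L A} → L ⊢ₘ A → L ⊢ₘ □ A
  axD  : ∀ {L} A → L ⊢ₘ m¬ (□ A m∧ □ (m¬ A))
  ax4  : ∀ A → ND4 ⊢ₘ □ A m⇒ □ (□ A)

record Realization : Set where
  field
    val    : ℕ → Formula
    closed : ∀ p → Sentence (val p)
open Realization public

interp : Formula → Realization → MForm → Formula
interp Pr f (mvar p) = val f p
interp Pr f m⊥       = falsum
interp Pr f (m¬ A)   = ¬' interp Pr f A
interp Pr f (A m∧ B) = interp Pr f A ∧' interp Pr f B
interp Pr f (A m∨ B) = interp Pr f A ∨' interp Pr f B
interp Pr f (A m⇒ B) = interp Pr f A ⇒ interp Pr f B
interp Pr f (□ A)    = Pr ⟨ interp Pr f A ⟩

{-# OPTIONS --safe #-}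
module Submission where

-- A number x is provable, Pr(x), when it belongs to the set of some stage b.  This
-- set consists of the theorems of T proved by stage b, unless at some stage w ≤ b
-- T has proved ¬ Pr(c) although a "world" u, a finite list of numbers to be made
-- provable or unprovable, makes c provable and is compatible with the theorems
-- proved before stage w.  After the first such jump the set consists of those
-- earlier theorems and of the numbers that u makes provable, closed under
-- x ↦ ⌜Pr(x)⌝ in the case of ND4.
--
-- The stage b must also pass bounded checks saying that the sets increase, contain
-- no formula with its negation, are closed under x ↦ ⌜Pr(x)⌝ and agree with the
-- chosen world.  Hence PA proves D and 4 by instantiating the checks, and all it
-- needs to know about syntax and computations are single decidable facts.
--
-- No jump ever occurs: PA would prove Pr(c) while T proves ¬ Pr(c).  So the checks
-- are true at all stages and Pr is a provability predicate.  Moreover, if T proves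
-- f(A), then for each valuation falsifying A it refutes the sentence saying that
-- the world coding this valuation has been chosen.  As there is no jump to this
-- world, it is incompatible with the theorems of T, and by induction on the modal
-- depth of A this means that the logic itself refutes the valuation.

open import Defs
open import Data.Nat using (ℕ; zero; suc; _<_; s≤s; z≤n; _≤_; _≤′_; ≤′-refl; ≤′-step; _⊔_; _!; NonZero; compare; less; equal; greater)
open import Data.Fin using (Fin; zero; suc; toℕ; #_)
open import Data.Vec using (Vec; []; _∷_; lookup)
open import Data.Bool using (Bool; true; false; not; _∧_; _∨_; T; if_then_else_)
open import Data.Product using (Σ; _×_; _,_; proj₁; proj₂; ∃; ∃₂)
open import Data.Unit using (⊤; tt)
open import Data.Empty using (⊥; ⊥-elim)
open import Function using (_∘_; id)
open import Relation.Binary.PropositionalEquality using (_≡_; refl; sym; trans; cong; cong₂; subst; _≢_)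
open import Relation.Nullary using (¬_; Dec; yes; no)
open import Data.List using (List; []; _∷_; _++_; map; upTo; cartesianProductWith)
open import Data.Sum using (_⊎_; inj₁; inj₂; [_,_]′)
open import Relation.Nullary.Decidable using (¬?; _×-dec_; _⊎-dec_; _→-dec_; map′; decidable-stable)
open import Data.Nat.Divisibility using (_∣_; divides; ∣-trans; m∣m*n; ∣m+n∣m⇒∣n; ∣1⇒≡1; ∣n⇒∣m*n; m≤n⇒m!∣n!)
open import Data.Nat.Coprimality using (Coprime; coprime-divisor)
open import Data.Nat.ListAction using (product)
open import Data.List.Membership.Propositional using (_∈_)
open import Data.List.Membership.Propositional.Properties using (∈-++⁺ˡ; ∈-++⁺ʳ; ∈-++⁻; ∈-map⁺; ∈-map⁻; ∈-upTo⁺; ∈-upTo⁻; ∈-cartesianProductWith⁺; ∈-cartesianProductWith⁻; ∈-lookup)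
open import Data.List.Relation.Unary.Any using (here; there)
open import Data.List.Relation.Unary.All using (All; []; _∷_)
open import Relation.Binary using (tri<; tri≈; tri>)
open import Data.Maybe using (Maybe; just; nothing; maybe′)
import Data.Nat as N
import Data.Nat.Properties as NP
import Data.Nat.Induction as NI
import Data.List.Relation.Unary.All as All
import Data.List.Relation.Unary.All.Properties as AllP
import Data.Maybe as Maybe
import Data.List as List
import Data.Sum as Sum

-- Substitution calculus

-- The predicate has to speak about its own instances, because jumps look for refutations of Pr(c)
-- and the sets of ND4 contain boxes. No fixed-point lemma is used: `Ψ` has a free variable for a
-- matrix number, `Pr` fills it with the number of `Ψ`, and the number `box e u` of an instance is
-- computed from that number and u. A world 2s also makes the number `junk s` provable, which is the
-- number of no formula. So `PrN (junk s)` is a sentence of the same kind as all boxes, and the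
-- argument about refuted boxes applies to the choice of a world as well. A theorem counts at a
-- stage only after the iterated boxes of all numbers up to it have been computed; otherwise a stage
-- could meet a refuted box without recognising it. The metatheory is constructive. The step from PA
-- proving Pr(φ) to T proving φ cannot appeal to classical truth in the standard model and goes
-- through Friedman's translation. Completeness picks no countermodel: it branches on the values of
-- the prime parts of A, and every branch ends in a derivation.

subT-ext : ∀ {σ τ} → (∀ i → σ i ≡ τ i) → ∀ t → subT σ t ≡ subT τ t
subT-ext h (var n)  = h n
subT-ext h zer      = refl
subT-ext h (suc' t) = cong suc' (subT-ext h t)
subT-ext h (s +' t) = cong₂ _+'_ (subT-ext h s) (subT-ext h t)
subT-ext h (s *' t) = cong₂ _*'_ (subT-ext h s) (subT-ext h t)

subT-var : ∀ t → subT var t ≡ t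
subT-var (var n)  = refl
subT-var zer      = refl
subT-var (suc' t) = cong suc' (subT-var t)
subT-var (s +' t) = cong₂ _+'_ (subT-var s) (subT-var t)
subT-var (s *' t) = cong₂ _*'_ (subT-var s) (subT-var t)

subT-subT : ∀ τ σ t → subT τ (subT σ t) ≡ subT (λ i → subT τ (σ i)) t
subT-subT τ σ (var n)  = refl
subT-subT τ σ zer      = refl
subT-subT τ σ (suc' t) = cong suc' (subT-subT τ σ t)
subT-subT τ σ (s +' t) = cong₂ _+'_ (subT-subT τ σ s) (subT-subT τ σ t)
subT-subT τ σ (s *' t) = cong₂ _*'_ (subT-subT τ σ s) (subT-subT τ σ t)

renT-subT : ∀ ρ t → renT ρ t ≡ subT (var ∘ ρ) t
renT-subT ρ (var n)  = refl
renT-subT ρ zer      = refl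
renT-subT ρ (suc' t) = cong suc' (renT-subT ρ t)
renT-subT ρ (s +' t) = cong₂ _+'_ (renT-subT ρ s) (renT-subT ρ t)
renT-subT ρ (s *' t) = cong₂ _*'_ (renT-subT ρ s) (renT-subT ρ t)

subT-shiftT : ∀ σ t → subT σ (shiftT t) ≡ subT (σ ∘ suc) t
subT-shiftT σ t = trans (cong (subT σ) (renT-subT suc t)) (subT-subT σ (var ∘ suc) t)

subT-liftS-shiftT : ∀ σ t → subT (liftS σ) (shiftT t) ≡ shiftT (subT σ t)
subT-liftS-shiftT σ t = trans (subT-shiftT (liftS σ) t)
  (trans (subT-ext (λ i → renT-subT suc (σ i)) t)
  (trans (sym (subT-subT (var ∘ suc) σ t)) (sym (renT-subT suc (subT σ t)))))

liftS-ext : ∀ {σ τ} → (∀ i → σ i ≡ τ i) → ∀ i → liftS σ i ≡ liftS τ i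
liftS-ext h zero    = refl
liftS-ext h (suc i) = cong shiftT (h i)

subF-ext : ∀ {σ τ} → (∀ i → σ i ≡ τ i) → ∀ φ → subF σ φ ≡ subF τ φ
subF-ext h (s ≐ t)  = cong₂ _≐_ (subT-ext h s) (subT-ext h t)
subF-ext h (¬' φ)   = cong ¬'_ (subF-ext h φ)
subF-ext h (φ ∧' ψ) = cong₂ _∧'_ (subF-ext h φ) (subF-ext h ψ)
subF-ext h (φ ∨' ψ) = cong₂ _∨'_ (subF-ext h φ) (subF-ext h ψ)
subF-ext h (φ ⇒ ψ)  = cong₂ _⇒_ (subF-ext h φ) (subF-ext h ψ)
subF-ext h (∀' φ)   = cong ∀' (subF-ext (liftS-ext h) φ)
subF-ext h (∃' φ)   = cong ∃' (subF-ext (liftS-ext h) φ)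

liftS-comp : ∀ τ σ i → subT (liftS τ) (liftS σ i) ≡ liftS (λ j → subT τ (σ j)) i
liftS-comp τ σ zero    = refl
liftS-comp τ σ (suc i) = subT-liftS-shiftT τ (σ i)

subF-subF : ∀ τ σ φ → subF τ (subF σ φ) ≡ subF (λ i → subT τ (σ i)) φ
subF-subF τ σ (s ≐ t)  = cong₂ _≐_ (subT-subT τ σ s) (subT-subT τ σ t)
subF-subF τ σ (¬' φ)   = cong ¬'_ (subF-subF τ σ φ)
subF-subF τ σ (φ ∧' ψ) = cong₂ _∧'_ (subF-subF τ σ φ) (subF-subF τ σ ψ)
subF-subF τ σ (φ ∨' ψ) = cong₂ _∨'_ (subF-subF τ σ φ) (subF-subF τ σ ψ)
subF-subF τ σ (φ ⇒ ψ)  = cong₂ _⇒_ (subF-subF τ σ φ) (subF-subF τ σ ψ)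
subF-subF τ σ (∀' φ)   = cong ∀' (trans (subF-subF (liftS τ) (liftS σ) φ) (subF-ext (liftS-comp τ σ) φ))
subF-subF τ σ (∃' φ)   = cong ∃' (trans (subF-subF (liftS τ) (liftS σ) φ) (subF-ext (liftS-comp τ σ) φ))

liftS-liftR : ∀ ρ i → var (liftR ρ i) ≡ liftS (var ∘ ρ) i
liftS-liftR ρ zero    = refl
liftS-liftR ρ (suc i) = refl

renF-subF : ∀ ρ φ → renF ρ φ ≡ subF (var ∘ ρ) φ
renF-subF ρ (s ≐ t)  = cong₂ _≐_ (renT-subT ρ s) (renT-subT ρ t)
renF-subF ρ (¬' φ)   = cong ¬'_ (renF-subF ρ φ)
renF-subF ρ (φ ∧' ψ) = cong₂ _∧'_ (renF-subF ρ φ) (renF-subF ρ ψ)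
renF-subF ρ (φ ∨' ψ) = cong₂ _∨'_ (renF-subF ρ φ) (renF-subF ρ ψ)
renF-subF ρ (φ ⇒ ψ)  = cong₂ _⇒_ (renF-subF ρ φ) (renF-subF ρ ψ)
renF-subF ρ (∀' φ)   = cong ∀' (trans (renF-subF (liftR ρ) φ) (subF-ext (liftS-liftR ρ) φ))
renF-subF ρ (∃' φ)   = cong ∃' (trans (renF-subF (liftR ρ) φ) (subF-ext (liftS-liftR ρ) φ))

infixr 5 _∷ₛ_
_∷ₛ_ : ∀ {A : Set} → A → (ℕ → A) → ℕ → A
(t ∷ₛ σ) zero    = t
(t ∷ₛ σ) (suc i) = σ i

single-liftS : ∀ t σ i → subT (single t) (liftS σ i) ≡ (t ∷ₛ σ) i
single-liftS t σ zero    = refl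
single-liftS t σ (suc i) = trans (subT-shiftT (single t) (σ i)) (subT-var (σ i))

-- Lets every formula be kept as an instance `subF σ φ` of a fixed formula: instantiating a
-- quantifier extends the environment σ, and substitutions do not pile up.
subF-single : ∀ t σ φ → subF (liftS σ) φ [ t ] ≡ subF (t ∷ₛ σ) φ
subF-single t σ φ = trans (subF-subF (single t) (liftS σ) φ) (subF-ext (single-liftS t σ) φ)

shiftF-subF : ∀ σ φ → shiftF (subF σ φ) ≡ subF (shiftT ∘ σ) φ
shiftF-subF σ φ = trans (renF-subF suc (subF σ φ))
  (trans (subF-subF (var ∘ suc) σ φ) (subF-ext (λ i → sym (renT-subT suc (σ i))) φ))

liftS-var : ∀ i → liftS var i ≡ var i
liftS-var zero    = refl
liftS-var (suc i) = refl

subF-var : ∀ φ → subF var φ ≡ φ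
subF-var (s ≐ t)  = cong₂ _≐_ (subT-var s) (subT-var t)
subF-var (¬' φ)   = cong ¬'_ (subF-var φ)
subF-var (φ ∧' ψ) = cong₂ _∧'_ (subF-var φ) (subF-var ψ)
subF-var (φ ∨' ψ) = cong₂ _∨'_ (subF-var φ) (subF-var ψ)
subF-var (φ ⇒ ψ)  = cong₂ _⇒_ (subF-var φ) (subF-var ψ)
subF-var (∀' φ)   = cong ∀' (trans (subF-ext liftS-var φ) (subF-var φ))
subF-var (∃' φ)   = cong ∃' (trans (subF-ext liftS-var φ) (subF-var φ))

subT-closed : ∀ {n σ} → (∀ i → i < n → σ i ≡ var i) → ∀ t → ClosedT n t → subT σ t ≡ t
subT-closed h (var k)  c = h k c
subT-closed h zer      c = refl
subT-closed h (suc' t) c = cong suc' (subT-closed h t c)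
subT-closed h (s +' t) (c , d) = cong₂ _+'_ (subT-closed h s c) (subT-closed h t d)
subT-closed h (s *' t) (c , d) = cong₂ _*'_ (subT-closed h s c) (subT-closed h t d)

liftS-closed : ∀ {n σ} → (∀ i → i < n → σ i ≡ var i) → ∀ i → i < suc n → liftS σ i ≡ var i
liftS-closed h zero    p       = refl
liftS-closed h (suc i) (s≤s p) = cong shiftT (h i p)

subF-closed : ∀ {n σ} → (∀ i → i < n → σ i ≡ var i) → ∀ φ → ClosedF n φ → subF σ φ ≡ φ
subF-closed h (s ≐ t)  (c , d) = cong₂ _≐_ (subT-closed h s c) (subT-closed h t d)
subF-closed h (¬' φ)   c       = cong ¬'_ (subF-closed h φ c)
subF-closed h (φ ∧' ψ) (c , d) = cong₂ _∧'_ (subF-closed h φ c) (subF-closed h ψ d)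
subF-closed h (φ ∨' ψ) (c , d) = cong₂ _∨'_ (subF-closed h φ c) (subF-closed h ψ d)
subF-closed h (φ ⇒ ψ)  (c , d) = cong₂ _⇒_ (subF-closed h φ c) (subF-closed h ψ d)
subF-closed h (∀' φ)   c       = cong ∀' (subF-closed (liftS-closed h) φ c)
subF-closed h (∃' φ)   c       = cong ∃' (subF-closed (liftS-closed h) φ c)

shiftF-sentence : ∀ φ → Sentence φ → shiftF φ ≡ φ
shiftF-sentence φ c = trans (renF-subF suc φ) (subF-closed (λ i ()) φ c)

ClosedT-shift : ∀ {n} t → ClosedT n t → ClosedT (suc n) (shiftT t)
ClosedT-shift (var k)  c = s≤s c
ClosedT-shift zer      c = tt
ClosedT-shift (suc' t) c = ClosedT-shift t c
ClosedT-shift (s +' t) (c , d) = ClosedT-shift s c , ClosedT-shift t d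
ClosedT-shift (s *' t) (c , d) = ClosedT-shift s c , ClosedT-shift t d

ClosedT-subT : ∀ {n σ} → (∀ i → ClosedT n (σ i)) → ∀ t → ClosedT n (subT σ t)
ClosedT-subT h (var k)  = h k
ClosedT-subT h zer      = tt
ClosedT-subT h (suc' t) = ClosedT-subT h t
ClosedT-subT h (s +' t) = ClosedT-subT h s , ClosedT-subT h t
ClosedT-subT h (s *' t) = ClosedT-subT h s , ClosedT-subT h t

ClosedT-liftS : ∀ {n σ} → (∀ i → ClosedT n (σ i)) → ∀ i → ClosedT (suc n) (liftS σ i)
ClosedT-liftS h zero = s≤s z≤n
ClosedT-liftS {n} {σ} h (suc i) = ClosedT-shift {n} (σ i) (h i)

ClosedF-subF : ∀ {n σ} → (∀ i → ClosedT n (σ i)) → ∀ φ → ClosedF n (subF σ φ)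
ClosedF-subF h (s ≐ t)  = ClosedT-subT h s , ClosedT-subT h t
ClosedF-subF h (¬' φ)   = ClosedF-subF h φ
ClosedF-subF h (φ ∧' ψ) = ClosedF-subF h φ , ClosedF-subF h ψ
ClosedF-subF h (φ ∨' ψ) = ClosedF-subF h φ , ClosedF-subF h ψ
ClosedF-subF h (φ ⇒ ψ)  = ClosedF-subF h φ , ClosedF-subF h ψ
ClosedF-subF h (∀' φ)   = ClosedF-subF (ClosedT-liftS h) φ
ClosedF-subF h (∃' φ)   = ClosedF-subF (ClosedT-liftS h) φ

subT-num : ∀ σ n → subT σ (num n) ≡ num n
subT-num σ zero    = refl
subT-num σ (suc n) = cong suc' (subT-num σ n)

shiftT-num : ∀ n → shiftT (num n) ≡ num n
shiftT-num n = trans (renT-subT suc (num n)) (subT-num _ n)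

ClosedT-num : ∀ {m} n → ClosedT m (num n)
ClosedT-num zero    = tt
ClosedT-num (suc n) = ClosedT-num n

-- Propositional reasoning by truth tables

infix  6 ¬ₚ_
infixr 5 _∧ₚ_
infixr 4 _∨ₚ_
infixr 3 _⇒ₚ_
data Prop (n : ℕ) : Set where
  at              : Fin n → Prop n
  ¬ₚ_             : Prop n → Prop n
  _∧ₚ_ _∨ₚ_ _⇒ₚ_ : Prop n → Prop n → Prop n

pattern A₀ = at zero
pattern A₁ = at (suc zero)
pattern A₂ = at (suc (suc zero))

instP : ∀ {n} → Prop n → Vec Formula n → Formula
instP (at i)    ρ = lookup ρ i
instP (¬ₚ p)    ρ = ¬' instP p ρ
instP (p ∧ₚ q) ρ = instP p ρ ∧' instP q ρ
instP (p ∨ₚ q) ρ = instP p ρ ∨' instP q ρ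
instP (p ⇒ₚ q) ρ = instP p ρ ⇒ instP q ρ

boolP : ∀ {n} → Prop n → Vec Bool n → Bool
boolP (at i)    ρ = lookup ρ i
boolP (¬ₚ p)    ρ = not (boolP p ρ)
boolP (p ∧ₚ q) ρ = boolP p ρ ∧ boolP q ρ
boolP (p ∨ₚ q) ρ = boolP p ρ ∨ boolP q ρ
boolP (p ⇒ₚ q) ρ = not (boolP p ρ) ∨ boolP q ρ

validB : ∀ n → (Vec Bool n → Bool) → Bool
validB zero    f = f []
validB (suc n) f = validB n (λ v → f (true ∷ v)) ∧ validB n (λ v → f (false ∷ v))

∧-true : ∀ {a b} → T (a ∧ b) → T a × T b
∧-true {true} {true} _ = tt , tt

validB-sound : ∀ n f → T (validB n f) → ∀ v → f v ≡ true
validB-sound zero f h [] with f []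
... | true = refl
validB-sound (suc n) f h (true  ∷ v) = validB-sound n _ (proj₁ (∧-true h)) v
validB-sound (suc n) f h (false ∷ v) = validB-sound n _ (proj₂ (∧-true {validB n (λ v → f (true ∷ v))} h)) v

mapV : ∀ {n} → (Formula → Bool) → Vec Formula n → Vec Bool n
mapV V []       = []
mapV V (φ ∷ φs) = evalP V φ ∷ mapV V φs

lookup-mapV : ∀ {n} V (ρ : Vec Formula n) i → evalP V (lookup ρ i) ≡ lookup (mapV V ρ) i
lookup-mapV V (φ ∷ ρ) zero    = refl
lookup-mapV V (φ ∷ ρ) (suc i) = lookup-mapV V ρ i

evalP-instP : ∀ {n} V (p : Prop n) ρ → evalP V (instP p ρ) ≡ boolP p (mapV V ρ)
evalP-instP V (at i)    ρ = lookup-mapV V ρ i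
evalP-instP V (¬ₚ p)    ρ = cong not (evalP-instP V p ρ)
evalP-instP V (p ∧ₚ q) ρ = cong₂ _∧_ (evalP-instP V p ρ) (evalP-instP V q ρ)
evalP-instP V (p ∨ₚ q) ρ = cong₂ _∨_ (evalP-instP V p ρ) (evalP-instP V q ρ)
evalP-instP V (p ⇒ₚ q) ρ = cong₂ (λ a b → not a ∨ b) (evalP-instP V p ρ) (evalP-instP V q ρ)

instP-taut : ∀ {n} (p : Prop n) ρ → {T (validB n (boolP p))} → Tautology (instP p ρ)
instP-taut {n} p ρ {h} V = trans (evalP-instP V p ρ) (validB-sound n (boolP p) h (mapV V ρ))

-- Proof by reflection: for a valid `p` the implicit argument computes to the unit type and is
-- filled in by eta, so the truth table is checked by evaluation.
prop : ∀ {Γ n} (p : Prop n) ρ → {T (validB n (boolP p))} → Γ ⊢ instP p ρ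
prop p ρ {h} = taut (instP-taut p ρ {h})

module _ {Γ : Theory} where
  mp₂ : ∀ {φ ψ χ} → Γ ⊢ φ ⇒ ψ ⇒ χ → Γ ⊢ φ → Γ ⊢ ψ → Γ ⊢ χ
  mp₂ d e f = mp (mp d e) f

  ⇒-trans : ∀ {φ ψ χ} → Γ ⊢ φ ⇒ ψ → Γ ⊢ ψ ⇒ χ → Γ ⊢ φ ⇒ χ
  ⇒-trans {φ} {ψ} {χ} = mp₂ (prop ((A₀ ⇒ₚ A₁) ⇒ₚ (A₁ ⇒ₚ A₂) ⇒ₚ A₀ ⇒ₚ A₂) (φ ∷ ψ ∷ χ ∷ []))

  ⇒-const : ∀ {φ ψ} → Γ ⊢ ψ → Γ ⊢ φ ⇒ ψ
  ⇒-const {φ} {ψ} = mp (prop (A₁ ⇒ₚ A₀ ⇒ₚ A₁) (φ ∷ ψ ∷ []))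

  ⇒-refl : ∀ {φ} → Γ ⊢ φ ⇒ φ
  ⇒-refl {φ} = prop (A₀ ⇒ₚ A₀) (φ ∷ [])

  ⇒-app : ∀ {η φ ψ} → Γ ⊢ η ⇒ φ ⇒ ψ → Γ ⊢ η ⇒ φ → Γ ⊢ η ⇒ ψ
  ⇒-app {η} {φ} {ψ} = mp₂ (prop ((A₀ ⇒ₚ A₁ ⇒ₚ A₂) ⇒ₚ (A₀ ⇒ₚ A₁) ⇒ₚ A₀ ⇒ₚ A₂) (η ∷ φ ∷ ψ ∷ []))

  ⇒-swap : ∀ {η φ ψ} → Γ ⊢ η ⇒ φ ⇒ ψ → Γ ⊢ φ ⇒ η ⇒ ψ
  ⇒-swap {η} {φ} {ψ} = mp (prop ((A₀ ⇒ₚ A₁ ⇒ₚ A₂) ⇒ₚ A₁ ⇒ₚ A₀ ⇒ₚ A₂) (η ∷ φ ∷ ψ ∷ []))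

  ∧-intro : ∀ {η φ ψ} → Γ ⊢ η ⇒ φ → Γ ⊢ η ⇒ ψ → Γ ⊢ η ⇒ φ ∧' ψ
  ∧-intro {η} {φ} {ψ} = mp₂ (prop ((A₀ ⇒ₚ A₁) ⇒ₚ (A₀ ⇒ₚ A₂) ⇒ₚ A₀ ⇒ₚ A₁ ∧ₚ A₂) (η ∷ φ ∷ ψ ∷ []))

  ∧-fst : ∀ {η φ ψ} → Γ ⊢ η ⇒ φ ∧' ψ → Γ ⊢ η ⇒ φ
  ∧-fst {η} {φ} {ψ} = mp (prop ((A₀ ⇒ₚ A₁ ∧ₚ A₂) ⇒ₚ A₀ ⇒ₚ A₁) (η ∷ φ ∷ ψ ∷ []))

  ∧-snd : ∀ {η φ ψ} → Γ ⊢ η ⇒ φ ∧' ψ → Γ ⊢ η ⇒ ψ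
  ∧-snd {η} {φ} {ψ} = mp (prop ((A₀ ⇒ₚ A₁ ∧ₚ A₂) ⇒ₚ A₀ ⇒ₚ A₂) (η ∷ φ ∷ ψ ∷ []))

  ∧-pair : ∀ {φ ψ} → Γ ⊢ φ → Γ ⊢ ψ → Γ ⊢ φ ∧' ψ
  ∧-pair {φ} {ψ} = mp₂ (prop (A₀ ⇒ₚ A₁ ⇒ₚ A₀ ∧ₚ A₁) (φ ∷ ψ ∷ []))

  ∧-curry : ∀ {φ ψ χ} → Γ ⊢ φ ∧' ψ ⇒ χ → Γ ⊢ φ ⇒ ψ ⇒ χ
  ∧-curry {φ} {ψ} {χ} = mp (prop ((A₀ ∧ₚ A₁ ⇒ₚ A₂) ⇒ₚ A₀ ⇒ₚ A₁ ⇒ₚ A₂) (φ ∷ ψ ∷ χ ∷ []))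

  ∨-elim : ∀ {φ ψ χ} → Γ ⊢ φ ⇒ χ → Γ ⊢ ψ ⇒ χ → Γ ⊢ φ ∨' ψ ⇒ χ
  ∨-elim {φ} {ψ} {χ} = mp₂ (prop ((A₀ ⇒ₚ A₂) ⇒ₚ (A₁ ⇒ₚ A₂) ⇒ₚ A₀ ∨ₚ A₁ ⇒ₚ A₂) (φ ∷ ψ ∷ χ ∷ []))

  ∨-inl : ∀ {φ ψ} → Γ ⊢ φ ⇒ φ ∨' ψ
  ∨-inl {φ} {ψ} = prop (A₀ ⇒ₚ A₀ ∨ₚ A₁) (φ ∷ ψ ∷ [])

  ∨-inr : ∀ {φ ψ} → Γ ⊢ ψ ⇒ φ ∨' ψ
  ∨-inr {φ} {ψ} = prop (A₁ ⇒ₚ A₀ ∨ₚ A₁) (φ ∷ ψ ∷ [])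

  contrapose : ∀ {φ ψ} → Γ ⊢ φ ⇒ ψ → Γ ⊢ ¬' ψ ⇒ ¬' φ
  contrapose {φ} {ψ} = mp (prop ((A₀ ⇒ₚ A₁) ⇒ₚ ¬ₚ A₁ ⇒ₚ ¬ₚ A₀) (φ ∷ ψ ∷ []))

  explode : ∀ {φ ψ} → Γ ⊢ ¬' φ → Γ ⊢ φ ⇒ ψ
  explode {φ} {ψ} = mp (prop (¬ₚ A₀ ⇒ₚ A₀ ⇒ₚ A₁) (φ ∷ ψ ∷ []))

  ≡⇒ : ∀ {φ ψ} → φ ≡ ψ → Γ ⊢ φ ⇒ ψ
  ≡⇒ refl = ⇒-refl

  conv : ∀ {φ ψ} → φ ≡ ψ → Γ ⊢ φ → Γ ⊢ ψ
  conv refl d = d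

-- Quantifier and equality rules for substitution instances

  ∀-at : ∀ σ φ t → Γ ⊢ subF σ (∀' φ) ⇒ subF (t ∷ₛ σ) φ
  ∀-at σ φ t = ⇒-trans (∀-inst (subF (liftS σ) φ) t) (≡⇒ (subF-single t σ φ))

  ∃-at : ∀ σ φ t → Γ ⊢ subF (t ∷ₛ σ) φ ⇒ subF σ (∃' φ)
  ∃-at σ φ t = ⇒-trans (≡⇒ (sym (subF-single t σ φ))) (∃-intr (subF (liftS σ) φ) t)

  ∃-rule : ∀ {φ ψ} → Γ ⊢ φ ⇒ shiftF ψ → Γ ⊢ ∃' φ ⇒ ψ
  ∃-rule {φ} {ψ} d = mp (∃-elim φ ψ) (gen d)

  subst-rule : ∀ {φ} → Γ ⊢ φ → ∀ t → Γ ⊢ φ [ t ]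
  subst-rule {φ} d t = mp (∀-inst φ t) (gen d)

  ≐-subst : ∀ σ φ s t → Γ ⊢ s ≐ t ⇒ subF (s ∷ₛ σ) φ ⇒ subF (t ∷ₛ σ) φ
  ≐-subst σ φ s t = ⇒-trans (eq-subst (subF (liftS σ) φ) s t)
    (≡⇒ (cong₂ _⇒_ (subF-single s σ φ) (subF-single t σ φ)))

  ≐-sym : ∀ {s t} → Γ ⊢ s ≐ t ⇒ t ≐ s
  ≐-sym {s} {t} = ⇒-app (≐-subst (λ _ → s) (var 0 ≐ var 1) s t) (⇒-const (eq-refl s))

  ≐-trans : ∀ {s t u} → Γ ⊢ s ≐ t ⇒ t ≐ u ⇒ s ≐ u
  ≐-trans {s} {t} {u} = ⇒-swap (≐-subst (λ _ → s) (var 1 ≐ var 0) t u)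

  ≐-cong : ∀ σ r {s t} → Γ ⊢ s ≐ t ⇒ subT (s ∷ₛ σ) r ≐ subT (t ∷ₛ σ) r
  ≐-cong σ r {s} {t} = ⇒-app (⇒-trans (≐-subst ((subT (s ∷ₛ σ) r) ∷ₛ σ) (var 1 ≐ ren r) s t)
      (≡⇒ (cong₂ (λ a b → subT (s ∷ₛ σ) r ≐ a ⇒ subT (s ∷ₛ σ) r ≐ b) (lem s) (lem t)))) (⇒-const (eq-refl _))
    where
    -- The left-hand side must stay fixed while s is replaced by t. It is stored as variable 1, and
    -- the remaining variables of r move up by one to make room.
    up : ℕ → Term
    up zero    = var zero
    up (suc i) = var (suc (suc i))
    ren : Term → Term
    ren = subT up
    lem : ∀ q → subT (q ∷ₛ (subT (s ∷ₛ σ) r) ∷ₛ σ) (ren r) ≡ subT (q ∷ₛ σ) r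
    lem q = trans (subT-subT _ up r) (subT-ext (λ { zero → refl ; (suc i) → refl }) r)

-- Peano arithmetic

inst₂ : ∀ {Γ φ} → Γ ⊢ ∀' φ → ∀ s t → Γ ⊢ subF (s ∷ₛ t ∷ₛ var) φ
inst₂ {φ = φ} d s t = mp (∀-at (t ∷ₛ var) φ s)
  (mp (∀-at var (∀' φ) t) (conv (sym (subF-var (∀' (∀' φ)))) (gen d)))

≐-trans-under : ∀ {Γ η s t u} → Γ ⊢ η ⇒ s ≐ t → Γ ⊢ η ⇒ t ≐ u → Γ ⊢ η ⇒ s ≐ u
≐-trans-under d e = ⇒-app (⇒-app (⇒-const ≐-trans) d) e

≐-sym-under : ∀ {Γ η s t} → Γ ⊢ η ⇒ s ≐ t → Γ ⊢ η ⇒ t ≐ s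
≐-sym-under d = ⇒-trans d ≐-sym

≐-suc-under : ∀ {Γ η s t} → Γ ⊢ η ⇒ s ≐ t → Γ ⊢ η ⇒ suc' s ≐ suc' t
≐-suc-under d = ⇒-trans d (≐-cong var (suc' (var 0)))

≐-+ˡ-under : ∀ {Γ η s t} r → Γ ⊢ η ⇒ s ≐ t → Γ ⊢ η ⇒ s +' r ≐ t +' r
≐-+ˡ-under r d = ⇒-trans d (≐-cong (r ∷ₛ var) (var 0 +' var 1))

≐-+ʳ-under : ∀ {Γ η s t} r → Γ ⊢ η ⇒ s ≐ t → Γ ⊢ η ⇒ r +' s ≐ r +' t
≐-+ʳ-under r d = ⇒-trans d (≐-cong (r ∷ₛ var) (var 1 +' var 0))

≐-*ʳ-under : ∀ {Γ η s t} r → Γ ⊢ η ⇒ s ≐ t → Γ ⊢ η ⇒ r *' s ≐ r *' t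
≐-*ʳ-under r d = ⇒-trans d (≐-cong (r ∷ₛ var) (var 1 *' var 0))

≐-*ˡ-under : ∀ {Γ η s t} r → Γ ⊢ η ⇒ s ≐ t → Γ ⊢ η ⇒ s *' r ≐ t *' r
≐-*ˡ-under r d = ⇒-trans d (≐-cong (r ∷ₛ var) (var 0 *' var 1))

suc≢0 : ∀ t → PA ⊢ ¬' (suc' t ≐ zer)
suc≢0 t = subst-rule (ax pa1) t

suc-inj : ∀ s t → PA ⊢ suc' s ≐ suc' t ⇒ s ≐ t
suc-inj s t = inst₂ (gen (ax pa2)) s t

+-zer : ∀ t → PA ⊢ t +' zer ≐ t
+-zer t = subst-rule (ax pa3) t

+-suc' : ∀ s t → PA ⊢ s +' suc' t ≐ suc' (s +' t)
+-suc' s t = inst₂ (gen (ax pa4)) s t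

*-zer : ∀ t → PA ⊢ t *' zer ≐ zer
*-zer t = subst-rule (ax pa5) t

*-suc' : ∀ s t → PA ⊢ s *' suc' t ≐ (s *' t) +' s
*-suc' s t = inst₂ (gen (ax pa6)) s t

induction : ∀ φ → PA ⊢ φ [ zer ] → PA ⊢ φ ⇒ subF succSub φ → PA ⊢ ∀' φ
induction φ z s = mp (ax (ind φ)) (∧-pair z (gen s))

zer-+ : ∀ t → PA ⊢ zer +' t ≐ t
zer-+ t = mp (∀-inst _ t) (induction (zer +' var 0 ≐ var 0) (+-zer zer)
  (≐-trans-under (⇒-const (+-suc' zer (var 0))) (≐-suc-under ⇒-refl)))

suc-+ : ∀ s t → PA ⊢ suc' s +' t ≐ suc' (s +' t)
suc-+ s t = inst₂ (induction (suc' (var 1) +' var 0 ≐ suc' (var 1 +' var 0))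
  (mp (≐-trans-under (⇒-const (+-zer (suc' (var 0)))) (≐-sym-under (≐-suc-under ⇒-refl))) (+-zer (var 0)))
  (≐-trans-under (⇒-const (+-suc' (suc' (var 1)) (var 0)))
    (≐-suc-under (≐-trans-under ⇒-refl (≐-sym-under (⇒-const (+-suc' (var 1) (var 0)))))))) t s

-- The goal is a parameter, so the predecessor appears as a fresh variable and no existential
-- quantifier remains. The induction behind it never uses its hypothesis.
zero-or-suc : ∀ {χ} t → PA ⊢ t ≐ zer ⇒ χ → PA ⊢ shiftT t ≐ suc' (var 0) ⇒ shiftF χ → PA ⊢ χ
zero-or-suc t d e = mp (∨-elim d (∃-rule e)) (mp (∀-inst _ t) (induction ((var 0 ≐ zer) ∨' ∃' (var 1 ≐ suc' (var 0)))
  (mp ∨-inl (eq-refl zer))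
  (⇒-const (mp (⇒-trans (∃-intr (suc' (var 1) ≐ suc' (var 0)) (var 0)) ∨-inr) (eq-refl (suc' (var 0)))))))

le-intro : ∀ {Γ η} r a b → Γ ⊢ η ⇒ r +' a ≐ b → Γ ⊢ η ⇒ le a b
le-intro r a b d = ⇒-trans d (⇒-trans (≡⇒ (cong₂ (λ u v → r +' u ≐ v) (sym (lem a)) (sym (lem b))))
                     (∃-intr (var 0 +' shiftT a ≐ shiftT b) r))
  where
  lem : ∀ t → subT (single r) (shiftT t) ≡ t
  lem t = trans (subT-shiftT (single r) t) (subT-var t)

-- Serves to compare two arbitrary, possibly nonstandard stages. The other order facts used later
-- have a numeral on one side.
le-lin : ∀ s t → PA ⊢ le s t ∨' le t s
le-lin s t = 
  (inst₂ (induction (le (var 0) (var 1) ∨' le (var 1) (var 0)) base (∨-elim (∃-rule up) down)) s t)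
  where
  base : PA ⊢ le zer (var 0) ∨' le (var 0) zer
  base = mp (⇒-trans (le-intro (var 0) zer (var 0) ⇒-refl) ∨-inl) (+-zer (var 0))
  goal : Formula
  goal = le (suc' (var 1)) (var 2) ∨' le (var 2) (suc' (var 1))
  up : PA ⊢ var 0 +' var 1 ≐ var 2 ⇒ goal
  up = zero-or-suc (var 0)
    -- If the difference is 0 the numbers agree, and after the induction step the left one is larger
    -- by exactly 1.
    (⇒-swap (∧-curry (⇒-trans (le-intro (suc' zer) (var 2) (suc' (var 1))
       (≐-trans-under (⇒-const (suc-+ zer (var 2))) (≐-suc-under
         (≐-trans-under (⇒-const (zer-+ (var 2))) (≐-trans-under (≐-sym-under z+x≐y)
           (≐-trans-under (≐-+ˡ-under (var 1) z≐0) (⇒-const (zer-+ (var 1)))))))))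
       ∨-inr)))
    (∧-curry (⇒-trans (le-intro (var 0) (suc' (var 2)) (var 3)
       (≐-trans-under (⇒-const (+-suc' (var 0) (var 2))) (≐-trans-under (≐-sym-under (⇒-const (suc-+ (var 0) (var 2))))
         (≐-trans-under (≐-+ˡ-under (var 2) (≐-sym-under (∧-fst ⇒-refl))) (∧-snd ⇒-refl)))))
       ∨-inl))
    where
    z+x≐y : PA ⊢ (var 0 +' var 1 ≐ var 2) ∧' (var 0 ≐ zer) ⇒ var 0 +' var 1 ≐ var 2
    z+x≐y = ∧-fst ⇒-refl
    z≐0 : PA ⊢ (var 0 +' var 1 ≐ var 2) ∧' (var 0 ≐ zer) ⇒ var 0 ≐ zer
    z≐0 = ∧-snd ⇒-refl
  down : PA ⊢ le (var 1) (var 0) ⇒ le (suc' (var 0)) (var 1) ∨' le (var 1) (suc' (var 0))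
  down = ∃-rule (⇒-trans (le-intro (suc' (var 0)) (var 2) (suc' (var 1))
    (≐-trans-under (⇒-const (suc-+ (var 0) (var 2))) (≐-suc-under ⇒-refl))) ∨-inr)

le-zero : ∀ t → PA ⊢ le zer t
le-zero t = mp (le-intro t zer t ⇒-refl) (+-zer t)

shiftF-le : ∀ a b → shiftF (le a b) ≡ le (shiftT a) (shiftT b)
shiftF-le a b = cong ∃' (cong₂ (λ u v → var 0 +' u ≐ v) (ren a) (ren b))
  where
  ren : ∀ r → renT (liftR suc) (shiftT r) ≡ shiftT (shiftT r)
  ren r = trans (trans (renT-subT (liftR suc) (shiftT r)) (subT-shiftT (var ∘ liftR suc) r))
            (sym (trans (renT-subT suc (shiftT r)) (subT-shiftT (var ∘ suc) r)))

le-down : ∀ n t → PA ⊢ le (num (suc n)) t ⇒ le (num n) t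
le-down n t = ∃-rule (⇒-trans (le-intro (suc' (var 0)) (shiftT (num n)) (shiftT t)
   (≐-trans-under (⇒-const (suc-+ (var 0) (shiftT (num n)))) (≐-trans-under (≐-sym-under (⇒-const (+-suc' (var 0) (shiftT (num n))))) ⇒-refl)))
   (≡⇒ (sym (shiftF-le (num n) t))))

le-num-mono : ∀ {m n} t → m ≤ n → PA ⊢ le (num n) t ⇒ le (num m) t
le-num-mono t p = go (NP.≤⇒≤′ p)
  where
  go : ∀ {m n} → m ≤′ n → PA ⊢ le (num n) t ⇒ le (num m) t
  go ≤′-refl           = ⇒-refl
  go (≤′-step {n} p) = ⇒-trans (le-down n t) (go p)

le-split : ∀ n t → PA ⊢ le (num n) t ⇒ le (num (suc n)) t ∨' (t ≐ num n)
le-split n t = ∃-rule (⇒-trans body (≡⇒ (cong (_∨' (shiftT t ≐ shiftT (num n))) (sym (shiftF-le (num (suc n)) t)))))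
  where
  n' t' n'' t'' : Term
  n' = shiftT (num n)
  t' = shiftT t
  n'' = shiftT n'
  t'' = shiftT t'
  body : PA ⊢ var 0 +' n' ≐ t' ⇒ le (suc' n') t' ∨' (t' ≐ n')
  body = zero-or-suc (var 0)
    (∧-curry (⇒-trans
      (≐-trans-under (≐-sym-under (∧-snd {φ = var 0 ≐ zer} ⇒-refl))
        (≐-trans-under (≐-+ˡ-under n' (∧-fst ⇒-refl)) (⇒-const (zer-+ n'))))
      ∨-inr))
    (∧-curry (⇒-trans (⇒-trans (le-intro (var 0) (suc' n'') t''
      (≐-trans-under (⇒-const (+-suc' (var 0) n'')) (≐-trans-under (≐-sym-under (⇒-const (suc-+ (var 0) n'')))
        (≐-trans-under (≐-+ˡ-under n'' (≐-sym-under (∧-fst ⇒-refl))) (∧-snd ⇒-refl)))))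
      (≡⇒ (sym (shiftF-le (suc' n') t')))) ∨-inl))

-- An arbitrary number is a numeral below n or at least n. Thus a property of all stages follows
-- from finitely many decided cases and one argument in which the stage may be assumed large.
below-cases : ∀ σ φ n → (∀ k → k < n → PA ⊢ subF (num k ∷ₛ σ) φ) →
              PA ⊢ le (num n) (var 0) ⇒ subF (var 0 ∷ₛ σ) φ → PA ⊢ subF (var 0 ∷ₛ σ) φ
below-cases σ φ zero    h d = mp d (le-zero (var 0))
below-cases σ φ (suc n) h d = below-cases σ φ n (λ k p → h k (NP.m≤n⇒m≤1+n p))
  (⇒-trans (le-split n (var 0)) (∨-elim d
    (⇒-app (⇒-trans ≐-sym (≐-subst σ φ (num n) (var 0))) (⇒-const (h n NP.≤-refl)))))

le-num-cases : ∀ n t → PA ⊢ le t (num (suc n)) ⇒ (t ≐ num (suc n)) ∨' le t (num n)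
le-num-cases n t = ∃-rule (zero-or-suc (var 0)
    (∧-curry (⇒-trans
      (≐-trans-under (≐-sym-under (≐-trans-under (≐-+ˡ-under t' (∧-fst ⇒-refl)) (⇒-const (zer-+ t')))) (∧-snd ⇒-refl))
      ∨-inl))
    (∧-curry (⇒-trans (⇒-trans (⇒-trans (le-intro (var 0) t'' (shiftT n')
      (⇒-trans (≐-trans-under (≐-sym-under (⇒-const (suc-+ (var 0) t'')))
         (≐-trans-under (≐-+ˡ-under t'' (≐-sym-under (∧-fst ⇒-refl))) (∧-snd ⇒-refl)))
       (suc-inj (var 0 +' t'') (shiftT n'))))
      (≡⇒ (sym (shiftF-le t' n')))) (≡⇒ (cong shiftF (sym (shiftF-le t (num n)))))) ∨-inr)))
  where
  n' t' t'' : Term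
  n' = shiftT (num n)
  t' = shiftT t
  t'' = shiftT t'

le-zero-eq : ∀ t → PA ⊢ le t zer ⇒ t ≐ zer
le-zero-eq t = ∃-rule (zero-or-suc (var 0)
    (∧-curry (≐-trans-under (≐-sym-under (≐-trans-under (≐-+ˡ-under t' (∧-fst ⇒-refl)) (⇒-const (zer-+ t')))) (∧-snd ⇒-refl)))
    (∧-curry (⇒-trans (≐-trans-under (≐-sym-under (⇒-const (suc-+ (var 0) t'')))
         (≐-trans-under (≐-+ˡ-under t'' (≐-sym-under (∧-fst ⇒-refl))) (∧-snd ⇒-refl)))
      (explode (suc≢0 (var 0 +' t''))))))
  where
  t' t'' : Term
  t' = shiftT t
  t'' = shiftT t'

-- A number bounded by a numeral is one of finitely many numerals; this is what lets PA decide
-- bounded quantifiers.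
bounded-cases : ∀ σ φ t n → (∀ k → k ≤ n → PA ⊢ subF (num k ∷ₛ σ) φ) → PA ⊢ le t (num n) ⇒ subF (t ∷ₛ σ) φ
bounded-cases σ φ t n h = cases n h
  where
  at-num : ∀ k → PA ⊢ subF (num k ∷ₛ σ) φ → PA ⊢ t ≐ num k ⇒ subF (t ∷ₛ σ) φ
  at-num k d = ⇒-app (⇒-trans ≐-sym (≐-subst σ φ (num k) t)) (⇒-const d)
  cases : ∀ n → (∀ k → k ≤ n → PA ⊢ subF (num k ∷ₛ σ) φ) → PA ⊢ le t (num n) ⇒ subF (t ∷ₛ σ) φ
  cases zero    h = ⇒-trans (le-zero-eq t) (at-num 0 (h 0 z≤n))
  cases (suc n) h = ⇒-trans (le-num-cases n t) (∨-elim (at-num (suc n) (h (suc n) NP.≤-refl))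
                      (cases n (λ k p → h k (NP.m≤n⇒m≤1+n p))))

num-+ : ∀ m n → PA ⊢ num m +' num n ≐ num (m N.+ n)
num-+ m zero    = conv (cong (λ k → num m +' zer ≐ num k) (sym (NP.+-identityʳ m))) (+-zer (num m))
num-+ m (suc n) = conv (cong (λ k → num m +' num (suc n) ≐ num k) (sym (NP.+-suc m n)))
  (mp (≐-trans-under (⇒-const (+-suc' (num m) (num n))) (≐-suc-under ⇒-refl)) (num-+ m n))

num-* : ∀ m n → PA ⊢ num m *' num n ≐ num (m N.* n)
num-* m zero    = conv (cong (λ k → num m *' zer ≐ num k) (sym (NP.*-zeroʳ m))) (*-zer (num m))
num-* m (suc n) = conv (cong (λ k → num m *' num (suc n) ≐ num k) (trans (NP.+-comm (m N.* n) m) (sym (NP.*-suc m n))))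
  (mp (≐-trans-under (⇒-const (*-suc' (num m) (num n)))
        (≐-trans-under (≐-+ˡ-under (num m) ⇒-refl) (⇒-const (num-+ (m N.* n) m)))) (num-* m n))

num-≢ : ∀ m n → m ≢ n → PA ⊢ ¬' (num m ≐ num n)
num-≢ zero    zero    h = ⊥-elim (h refl)
num-≢ zero    (suc n) h = mp (contrapose ≐-sym) (suc≢0 (num n))
num-≢ (suc m) zero    h = suc≢0 (num m)
num-≢ (suc m) (suc n) h = mp (contrapose (suc-inj (num m) (num n))) (num-≢ m n (h ∘ cong suc))

num-≤ : ∀ {m n} → m ≤ n → PA ⊢ le (num m) (num n)
num-≤ {m} {n} p = mp (le-num-mono (num n) p) (mp (le-intro zer (num n) (num n) (⇒-refl)) (num-+ 0 n))

not-falsum : PA ⊢ ¬' falsum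
not-falsum = num-≢ 0 1 (λ ())

-- Bounded formulas and their decision in Peano arithmetic

evalT : (ℕ → ℕ) → Term → ℕ
evalT ρ (var n)  = ρ n
evalT ρ zer      = 0
evalT ρ (suc' t) = suc (evalT ρ t)
evalT ρ (s +' t) = evalT ρ s N.+ evalT ρ t
evalT ρ (s *' t) = evalT ρ s N.* evalT ρ t

infix  5 _≐ᵇ_
infix  5 ¬ᵇ_
infixr 4 _∧ᵇ_
infixr 3 _∨ᵇ_
infixr 2 _⇒ᵇ_
-- Bounds of quantifiers are variables, and `call` is an explicit substitution that renumbers the
-- arguments of a formula defined elsewhere. So each formula is written with its own numbering of
-- variables. Variables that are not passed read as 0.
data BF : Set where
  _≐ᵇ_            : Term → Term → BF
  ¬ᵇ_             : BF → BF
  _∧ᵇ_ _∨ᵇ_ _⇒ᵇ_ : BF → BF → BF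
  ∀≤ ∃≤           : ℕ → BF → BF
  call            : BF → List ℕ → BF

args : List ℕ → ℕ → Term
args []       = λ _ → zer
args (i ∷ is) = var i ∷ₛ args is

vals : (ℕ → ℕ) → List ℕ → ℕ → ℕ
vals ρ []       = λ _ → 0
vals ρ (i ∷ is) = ρ i ∷ₛ vals ρ is

formula : BF → Formula
formula (s ≐ᵇ t)  = s ≐ t
formula (¬ᵇ φ)    = ¬' formula φ
formula (φ ∧ᵇ ψ) = formula φ ∧' formula ψ
formula (φ ∨ᵇ ψ) = formula φ ∨' formula ψ
formula (φ ⇒ᵇ ψ) = formula φ ⇒ formula ψ
formula (∀≤ i φ)  = ∀' (le (var 0) (var (suc i)) ⇒ formula φ)
formula (∃≤ i φ)  = ∃' (le (var 0) (var (suc i)) ∧' formula φ)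
formula (call φ is) = subF (args is) (formula φ)

⟦_⟧ : BF → (ℕ → ℕ) → Set
⟦ s ≐ᵇ t ⟧ ρ  = evalT ρ s ≡ evalT ρ t
⟦ ¬ᵇ φ ⟧ ρ    = ¬ ⟦ φ ⟧ ρ
⟦ φ ∧ᵇ ψ ⟧ ρ = ⟦ φ ⟧ ρ × ⟦ ψ ⟧ ρ
⟦ φ ∨ᵇ ψ ⟧ ρ = ⟦ φ ⟧ ρ ⊎ ⟦ ψ ⟧ ρ
⟦ φ ⇒ᵇ ψ ⟧ ρ = ⟦ φ ⟧ ρ → ⟦ ψ ⟧ ρ
⟦ ∀≤ i φ ⟧ ρ  = ∀ x → x ≤ ρ i → ⟦ φ ⟧ (x ∷ₛ ρ)
⟦ ∃≤ i φ ⟧ ρ  = ∃ λ x → x ≤ ρ i × ⟦ φ ⟧ (x ∷ₛ ρ)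
⟦ call φ is ⟧ ρ = ⟦ φ ⟧ (vals ρ is)

⟦_⟧? : ∀ φ ρ → Dec (⟦ φ ⟧ ρ)
⟦ s ≐ᵇ t ⟧? ρ  = evalT ρ s NP.≟ evalT ρ t
⟦ ¬ᵇ φ ⟧? ρ    = ¬? (⟦ φ ⟧? ρ)
⟦ φ ∧ᵇ ψ ⟧? ρ = ⟦ φ ⟧? ρ ×-dec ⟦ ψ ⟧? ρ
⟦ φ ∨ᵇ ψ ⟧? ρ = ⟦ φ ⟧? ρ ⊎-dec ⟦ ψ ⟧? ρ
⟦ φ ⇒ᵇ ψ ⟧? ρ = ⟦ φ ⟧? ρ →-dec ⟦ ψ ⟧? ρ
⟦ ∀≤ i φ ⟧? ρ  = map′ (λ h x p → h (s≤s p)) (λ h {x} p → h x (NP.≤-pred p))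
                   (NP.allUpTo? (λ x → ⟦ φ ⟧? (x ∷ₛ ρ)) (suc (ρ i)))
⟦ ∃≤ i φ ⟧? ρ  = map′ (λ { (x , p , h) → x , NP.≤-pred p , h }) (λ { (x , p , h) → x , s≤s p , h })
                   (NP.anyUpTo? (λ x → ⟦ φ ⟧? (x ∷ₛ ρ)) (suc (ρ i)))
⟦ call φ is ⟧? ρ = ⟦ φ ⟧? (vals ρ is)

evalT-args : ∀ ρ is i → evalT ρ (args is i) ≡ vals ρ is i
evalT-args ρ []       i       = refl
evalT-args ρ (j ∷ is) zero    = refl
evalT-args ρ (j ∷ is) (suc i) = evalT-args ρ is i

num-args : ∀ ρ is i → subT (num ∘ ρ) (args is i) ≡ num (vals ρ is i)
num-args ρ []       i       = refl
num-args ρ (j ∷ is) zero    = refl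
num-args ρ (j ∷ is) (suc i) = num-args ρ is i

subF-num-args : ∀ ρ is φ → subF (num ∘ ρ) (subF (args is) φ) ≡ subF (num ∘ vals ρ is) φ
subF-num-args ρ is φ = trans (subF-subF _ _ φ) (subF-ext (num-args ρ is) φ)

num-evalT : ∀ ρ t → PA ⊢ subT (num ∘ ρ) t ≐ num (evalT ρ t)
num-evalT ρ (var n)  = eq-refl _
num-evalT ρ zer      = eq-refl _
num-evalT ρ (suc' t) = mp (≐-suc-under ⇒-refl) (num-evalT ρ t)
num-evalT ρ (s +' t) = mp₂ (⇒-trans (≐-+ˡ-under _ ⇒-refl) ≐-trans) (num-evalT ρ s)
  (mp (≐-trans-under (≐-+ʳ-under _ ⇒-refl) (⇒-const (num-+ (evalT ρ s) (evalT ρ t)))) (num-evalT ρ t))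
num-evalT ρ (s *' t) = mp₂ (⇒-trans (≐-*ˡ-under _ ⇒-refl) ≐-trans) (num-evalT ρ s)
  (mp (≐-trans-under (≐-*ʳ-under _ ⇒-refl) (⇒-const (num-* (evalT ρ s) (evalT ρ t)))) (num-evalT ρ t))

num-∷ₛ : ∀ x ρ i → num ((x ∷ₛ ρ) i) ≡ (num x ∷ₛ (num ∘ ρ)) i
num-∷ₛ x ρ zero    = refl
num-∷ₛ x ρ (suc i) = refl

liftS-num : ∀ ρ i → (var 0 ∷ₛ (num ∘ ρ)) i ≡ liftS (num ∘ ρ) i
liftS-num ρ zero    = refl
liftS-num ρ (suc i) = sym (shiftT-num (ρ i))

-- Δ₀-completeness, the only way in which facts about syntax and computations enter PA. The two
-- halves are mutual because of negation and implication; which one applies is decided by `⟦_⟧?`.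
prove  : ∀ φ ρ → ⟦ φ ⟧ ρ → PA ⊢ subF (num ∘ ρ) (formula φ)
refute : ∀ φ ρ → ¬ ⟦ φ ⟧ ρ → PA ⊢ ¬' subF (num ∘ ρ) (formula φ)

bounded-∀ : ∀ φ ρ i → (∀ x → x ≤ ρ i → PA ⊢ subF (num x ∷ₛ (num ∘ ρ)) φ) →
            PA ⊢ le (var 0) (shiftT (num (ρ i))) ⇒ subF (liftS (num ∘ ρ)) φ
bounded-∀ φ ρ i h = conv
  (cong₂ (λ a b → le (var 0) a ⇒ b) (sym (shiftT-num (ρ i))) (subF-ext (liftS-num ρ) φ))
  (bounded-cases (num ∘ ρ) φ (var 0) (ρ i) h)

prove (s ≐ᵇ t) ρ d = mp₂ ≐-trans (num-evalT ρ s)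
  (conv (cong (λ k → num k ≐ subT (num ∘ ρ) t) (sym d)) (mp ≐-sym (num-evalT ρ t)))
prove (¬ᵇ φ)    ρ d = refute φ ρ d
prove (φ ∧ᵇ ψ) ρ (d , e) = ∧-pair (prove φ ρ d) (prove ψ ρ e)
prove (φ ∨ᵇ ψ) ρ (inj₁ d) = mp ∨-inl (prove φ ρ d)
prove (φ ∨ᵇ ψ) ρ (inj₂ d) = mp ∨-inr (prove ψ ρ d)
prove (φ ⇒ᵇ ψ) ρ d with ⟦ φ ⟧? ρ
... | yes a = ⇒-const (prove ψ ρ (d a))
... | no ¬a = explode (refute φ ρ ¬a)
prove (∀≤ i φ)  ρ d = gen (bounded-∀ (formula φ) ρ i
  (λ x p → conv (subF-ext (num-∷ₛ x ρ) (formula φ)) (prove φ (x ∷ₛ ρ) (d x p))))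
prove (∃≤ i φ)  ρ (x , p , d) = mp (∃-at (num ∘ ρ) (le (var 0) (var (suc i)) ∧' formula φ) (num x))
  (∧-pair (conv (cong₂ (λ a b → ∃' (var 0 +' a ≐ b)) refl refl) (num-≤ p))
          (conv (subF-ext (num-∷ₛ x ρ) (formula φ)) (prove φ (x ∷ₛ ρ) d)))
prove (call φ is) ρ d = conv (sym (subF-num-args ρ is (formula φ))) (prove φ (vals ρ is) d)

refute (s ≐ᵇ t) ρ d = mp (contrapose (≐-trans-under (⇒-const (mp ≐-sym (num-evalT ρ s)))
  (≐-trans-under ⇒-refl (⇒-const (num-evalT ρ t))))) (num-≢ _ _ d)
refute (¬ᵇ φ)    ρ d = mp (prop (A₀ ⇒ₚ ¬ₚ ¬ₚ A₀) (_ ∷ [])) (prove φ ρ (decidable-stable (⟦ φ ⟧? ρ) d))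
refute (φ ∧ᵇ ψ) ρ d with ⟦ φ ⟧? ρ
... | yes a = mp (contrapose (∧-snd ⇒-refl)) (refute ψ ρ (λ b → d (a , b)))
... | no ¬a = mp (contrapose (∧-fst ⇒-refl)) (refute φ ρ ¬a)
refute (φ ∨ᵇ ψ) ρ d = mp₂ (prop (¬ₚ A₀ ⇒ₚ ¬ₚ A₁ ⇒ₚ ¬ₚ (A₀ ∨ₚ A₁)) (_ ∷ _ ∷ []))
  (refute φ ρ (d ∘ inj₁)) (refute ψ ρ (d ∘ inj₂))
refute (φ ⇒ᵇ ψ) ρ d with ⟦ φ ⟧? ρ
... | yes a = mp₂ (prop (A₀ ⇒ₚ ¬ₚ A₁ ⇒ₚ ¬ₚ (A₀ ⇒ₚ A₁)) (_ ∷ _ ∷ [])) (prove φ ρ a) (refute ψ ρ (λ b → d (λ _ → b)))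
... | no ¬a = ⊥-elim (d (⊥-elim ∘ ¬a))
refute (∀≤ i φ)  ρ d with NP.anyUpTo? (λ x → ¬? (⟦ φ ⟧? (x ∷ₛ ρ))) (suc (ρ i))
... | yes (x , p , ¬h) = mp (contrapose (⇒-app (∀-at (num ∘ ρ) (le (var 0) (var (suc i)) ⇒ formula φ) (num x))
        (⇒-const (num-≤ (NP.≤-pred p)))))
        (conv (cong ¬'_ (subF-ext (num-∷ₛ x ρ) (formula φ))) (refute φ (x ∷ₛ ρ) ¬h))
... | no ¬e = ⊥-elim (d (λ x p → decidable-stable (⟦ φ ⟧? (x ∷ₛ ρ)) (λ ¬h → ¬e (x , s≤s p , ¬h))))
refute (∃≤ i φ)  ρ d = mp (contrapose (∃-rule (⇒-trans ⇒-refl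
    (mp (prop ((A₀ ⇒ₚ ¬ₚ A₁) ⇒ₚ A₀ ∧ₚ A₁ ⇒ₚ A₂) (_ ∷ _ ∷ falsum ∷ []))
      (bounded-∀ (¬' formula φ) ρ i
        (λ x p → conv (cong ¬'_ (subF-ext (num-∷ₛ x ρ) (formula φ))) (refute φ (x ∷ₛ ρ) (λ h → d (x , p , h)))))))))
  not-falsum
refute (call φ is) ρ d = conv (cong ¬'_ (sym (subF-num-args ρ is (formula φ)))) (refute φ (vals ρ is) d)

Δ0-formula : ∀ σ φ → Δ0 (subF σ (formula φ))
Δ0-formula σ (s ≐ᵇ t)  = atom _ _
Δ0-formula σ (¬ᵇ φ)    = neg (Δ0-formula σ φ)
Δ0-formula σ (φ ∧ᵇ ψ) = conj (Δ0-formula σ φ) (Δ0-formula σ ψ)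
Δ0-formula σ (φ ∨ᵇ ψ) = disj (Δ0-formula σ φ) (Δ0-formula σ ψ)
Δ0-formula σ (φ ⇒ᵇ ψ) = impl (Δ0-formula σ φ) (Δ0-formula σ ψ)
Δ0-formula σ (∀≤ i φ)  = ball (σ i) (Δ0-formula (liftS σ) φ)
Δ0-formula σ (∃≤ i φ)  = bex (σ i) (Δ0-formula (liftS σ) φ)
Δ0-formula σ (call φ is) = subst Δ0 (sym (subF-subF σ (args is) (formula φ))) (Δ0-formula _ φ)

-- Gödel numbers

m≤2*m : ∀ m → m ≤ 2 N.* m
m≤2*m m = NP.m≤m+n m (m N.+ 0)

-- pair is made opaque, because on literals it unfolds to huge unary numbers.
opaque
  node : ℕ → ℕ → ℕ
  node = pair

  node≡pair : ∀ a b → node a b ≡ pair a b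
  node≡pair a b = refl

  node-suc : ∀ a b → node (suc a) b ≡ 2 N.* node a b
  node-suc a b = NP.*-assoc 2 (2 N.^ a) (suc (2 N.* b))

  node-zero : ∀ b → node 0 b ≡ suc (2 N.* b)
  node-zero b = NP.*-identityˡ (suc (2 N.* b))

  node-inj : ∀ a a' {b b'} → node a b ≡ node a' b' → a ≡ a' × b ≡ b'
  node-inj zero zero {b} {b'} e = refl , NP.*-cancelˡ-≡ b b' 2
    (NP.suc-injective (trans (sym (node-zero b)) (trans e (node-zero b'))))
  node-inj zero (suc a') {b} {b'} e = ⊥-elim (NP.even≢odd (node a' b') b
    (sym (trans (sym (node-zero b)) (trans e (node-suc a' b')))))
  node-inj (suc a) zero {b} {b'} e = ⊥-elim (NP.even≢odd (node a b) b'
    (trans (sym (node-suc a b)) (trans e (node-zero b'))))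
  node-inj (suc a) (suc a') {b} {b'} e with node-inj a a' (NP.*-cancelˡ-≡ (node a b) (node a' b') 2
    (trans (sym (node-suc a b)) (trans e (node-suc a' b'))))
  ... | p , q = cong suc p , q

  node-pos : ∀ a b → 0 < node a b
  node-pos a b = NP.*-mono-≤ (NP.m^n>0 2 a) (s≤s z≤n)

  node-mono : ∀ a b → a N.+ b < node a b
  node-mono zero    b = subst (b <_) (sym (node-zero b)) (s≤s (m≤2*m b))
  node-mono (suc a) b = subst (suc (a N.+ b) <_) (sym (node-suc a b))
    (NP.≤-trans (s≤s (node-mono a b))
      (subst (suc (node a b) ≤_) (sym (cong (node a b N.+_) (NP.+-identityʳ (node a b))))
        (NP.+-monoˡ-≤ (node a b) (node-pos a b))))

gnT : Term → ℕ
gnT (var n)  = node 0 n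
gnT zer      = node 1 0
gnT (suc' t) = node 2 (gnT t)
gnT (s +' t) = node 3 (node (gnT s) (gnT t))
gnT (s *' t) = node 4 (node (gnT s) (gnT t))

gn : Formula → ℕ
gn (s ≐ t)  = node 0 (node (gnT s) (gnT t))
gn (¬' φ)   = node 1 (gn φ)
gn (φ ∧' ψ) = node 2 (node (gn φ) (gn ψ))
gn (φ ∨' ψ) = node 3 (node (gn φ) (gn ψ))
gn (φ ⇒ ψ)  = node 4 (node (gn φ) (gn ψ))
gn (∀' φ)   = node 5 (gn φ)
gn (∃' φ)   = node 6 (gn φ)

node-cong : ∀ {a b} a' b' → a ≡ a' → b ≡ b' → node a b ≡ pair a' b'
node-cong a' b' refl refl = node≡pair a' b'

gnT≡codeT : ∀ t → gnT t ≡ codeT t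
gnT≡codeT (var n)  = node≡pair 0 n
gnT≡codeT zer      = node≡pair 1 0
gnT≡codeT (suc' t) = node-cong 2 (codeT t) refl (gnT≡codeT t)
gnT≡codeT (s +' t) = node-cong 3 (pair (codeT s) (codeT t)) refl (node-cong (codeT s) (codeT t) (gnT≡codeT s) (gnT≡codeT t))
gnT≡codeT (s *' t) = node-cong 4 (pair (codeT s) (codeT t)) refl (node-cong (codeT s) (codeT t) (gnT≡codeT s) (gnT≡codeT t))

gn≡code : ∀ φ → gn φ ≡ code φ
gn≡code (s ≐ t)  = node-cong 0 (pair (codeT s) (codeT t)) refl (node-cong (codeT s) (codeT t) (gnT≡codeT s) (gnT≡codeT t))
gn≡code (¬' φ)   = node-cong 1 (code φ) refl (gn≡code φ)
gn≡code (φ ∧' ψ) = node-cong 2 (pair (code φ) (code ψ)) refl (node-cong (code φ) (code ψ) (gn≡code φ) (gn≡code ψ))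
gn≡code (φ ∨' ψ) = node-cong 3 (pair (code φ) (code ψ)) refl (node-cong (code φ) (code ψ) (gn≡code φ) (gn≡code ψ))
gn≡code (φ ⇒ ψ)  = node-cong 4 (pair (code φ) (code ψ)) refl (node-cong (code φ) (code ψ) (gn≡code φ) (gn≡code ψ))
gn≡code (∀' φ)   = node-cong 5 (code φ) refl (gn≡code φ)
gn≡code (∃' φ)   = node-cong 6 (code φ) refl (gn≡code φ)

node-<ˡ : ∀ a b → a < node a b
node-<ˡ a b = NP.≤-<-trans (NP.m≤m+n a b) (node-mono a b)

node-<ʳ : ∀ a b → b < node a b
node-<ʳ a b = NP.≤-<-trans (NP.m≤n+m b a) (node-mono a b)

tagT bodyT : Term → ℕ
tagT (var n)  = 0
tagT zer      = 1
tagT (suc' t) = 2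
tagT (s +' t) = 3
tagT (s *' t) = 4
bodyT (var n)  = n
bodyT zer      = 0
bodyT (suc' t) = gnT t
bodyT (s +' t) = node (gnT s) (gnT t)
bodyT (s *' t) = node (gnT s) (gnT t)

gnT-node : ∀ t → gnT t ≡ node (tagT t) (bodyT t)
gnT-node (var n)  = refl
gnT-node zer      = refl
gnT-node (suc' t) = refl
gnT-node (s +' t) = refl
gnT-node (s *' t) = refl

gnT-inv : ∀ {k b} t → node k b ≡ gnT t → k ≡ tagT t × b ≡ bodyT t
gnT-inv {k} t e = node-inj k (tagT t) (trans e (gnT-node t))

tagF bodyF : Formula → ℕ
tagF (s ≐ t)  = 0
tagF (¬' φ)   = 1
tagF (φ ∧' ψ) = 2
tagF (φ ∨' ψ) = 3
tagF (φ ⇒ ψ)  = 4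
tagF (∀' φ)   = 5
tagF (∃' φ)   = 6
bodyF (s ≐ t)  = node (gnT s) (gnT t)
bodyF (¬' φ)   = gn φ
bodyF (φ ∧' ψ) = node (gn φ) (gn ψ)
bodyF (φ ∨' ψ) = node (gn φ) (gn ψ)
bodyF (φ ⇒ ψ)  = node (gn φ) (gn ψ)
bodyF (∀' φ)   = gn φ
bodyF (∃' φ)   = gn φ

gn-node : ∀ φ → gn φ ≡ node (tagF φ) (bodyF φ)
gn-node (s ≐ t)  = refl
gn-node (¬' φ)   = refl
gn-node (φ ∧' ψ) = refl
gn-node (φ ∨' ψ) = refl
gn-node (φ ⇒ ψ)  = refl
gn-node (∀' φ)   = refl
gn-node (∃' φ)   = refl

gn-inv : ∀ {k b} φ → node k b ≡ gn φ → k ≡ tagF φ × b ≡ bodyF φ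
gn-inv {k} φ e = node-inj k (tagF φ) (trans e (gn-node φ))

view-¬ : ∀ χ {a} → node 1 a ≡ gn χ → ∃ λ φ → χ ≡ ¬' φ × a ≡ gn φ
view-¬ χ {a} e with gn-inv {1} {a} χ e
view-¬ (¬' φ) e | refl , q = φ , refl , q

view-⇒ : ∀ χ {a b} → node 4 (node a b) ≡ gn χ → ∃ λ φ → ∃ λ ψ → χ ≡ (φ ⇒ ψ) × a ≡ gn φ × b ≡ gn ψ
view-⇒ χ {a} {b} e with gn-inv {4} {node a b} χ e
view-⇒ (φ ⇒ ψ) {a} e | refl , q = φ , ψ , refl , node-inj a _ q

gnT-inj : ∀ s t → gnT s ≡ gnT t → s ≡ t
gnT-inj s t e with gnT-inv {tagT s} {bodyT s} t (trans (sym (gnT-node s)) e)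
gnT-inj (var n)  (var m)   e | refl , q = cong var q
gnT-inj zer      zer       e | refl , q = refl
gnT-inj (suc' s) (suc' t)  e | refl , q = cong suc' (gnT-inj s t q)
gnT-inj (s +' t) (s' +' t') e | refl , q with node-inj (gnT s) (gnT s') q
... | p , r = cong₂ _+'_ (gnT-inj s s' p) (gnT-inj t t' r)
gnT-inj (s *' t) (s' *' t') e | refl , q with node-inj (gnT s) (gnT s') q
... | p , r = cong₂ _*'_ (gnT-inj s s' p) (gnT-inj t t' r)

gn-inj : ∀ φ ψ → gn φ ≡ gn ψ → φ ≡ ψ
gn-inj φ ψ e with gn-inv {tagF φ} {bodyF φ} ψ (trans (sym (gn-node φ)) e)
gn-inj (s ≐ t) (s' ≐ t') e | refl , q with node-inj (gnT s) (gnT s') q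
... | p , r = cong₂ _≐_ (gnT-inj s s' p) (gnT-inj t t' r)
gn-inj (¬' φ) (¬' ψ) e | refl , q = cong ¬'_ (gn-inj φ ψ q)
gn-inj (φ ∧' χ) (ψ ∧' ξ) e | refl , q with node-inj (gn φ) (gn ψ) q
... | p , r = cong₂ _∧'_ (gn-inj φ ψ p) (gn-inj χ ξ r)
gn-inj (φ ∨' χ) (ψ ∨' ξ) e | refl , q with node-inj (gn φ) (gn ψ) q
... | p , r = cong₂ _∨'_ (gn-inj φ ψ p) (gn-inj χ ξ r)
gn-inj (φ ⇒ χ) (ψ ⇒ ξ) e | refl , q with node-inj (gn φ) (gn ψ) q
... | p , r = cong₂ _⇒_ (gn-inj φ ψ p) (gn-inj χ ξ r)
gn-inj (∀' φ) (∀' ψ) e | refl , q = cong ∀' (gn-inj φ ψ q)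
gn-inj (∃' φ) (∃' ψ) e | refl , q = cong ∃' (gn-inj φ ψ q)

evalT-subT : ∀ {ρ ρ'} σ → (∀ i → evalT ρ (σ i) ≡ ρ' i) → ∀ t → evalT ρ (subT σ t) ≡ evalT ρ' t
evalT-subT σ h (var n)  = h n
evalT-subT σ h zer      = refl
evalT-subT σ h (suc' t) = cong suc (evalT-subT σ h t)
evalT-subT σ h (s +' t) = cong₂ N._+_ (evalT-subT σ h s) (evalT-subT σ h t)
evalT-subT σ h (s *' t) = cong₂ N._*_ (evalT-subT σ h s) (evalT-subT σ h t)

evalT-shiftT : ∀ x ρ t → evalT (x ∷ₛ ρ) (shiftT t) ≡ evalT ρ t
evalT-shiftT x ρ t = trans (cong (evalT (x ∷ₛ ρ)) (renT-subT suc t)) (evalT-subT (var ∘ suc) (λ i → refl) t)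

evalT-num : ∀ ρ n → evalT ρ (num n) ≡ n
evalT-num ρ zero    = refl
evalT-num ρ (suc n) = cong suc (evalT-num ρ n)

update : (ℕ → Bool) → ℕ → Bool → ℕ → Bool
update v n b m with m NP.≟ n
... | yes _ = b
... | no  _ = v m

-- Friedman's translation: the double negation interpretation with falsity
-- replaced by R validates PA, and Σ₁ sentences hold in it only if R does or
-- if they have a witness.

module Friedman (R : Set) where

  holds : Formula → (ℕ → ℕ) → Set
  holds (s ≐ t)  ρ = (evalT ρ s ≡ evalT ρ t → R) → R
  holds (¬' φ)   ρ = holds φ ρ → R
  holds (φ ∧' ψ) ρ = holds φ ρ × holds ψ ρ
  holds (φ ∨' ψ) ρ = (holds φ ρ → R) × (holds ψ ρ → R) → R
  holds (φ ⇒ ψ)  ρ = holds φ ρ → holds ψ ρ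
  holds (∀' φ)   ρ = ∀ x → holds φ (x ∷ₛ ρ)
  holds (∃' φ)   ρ = (∀ x → holds φ (x ∷ₛ ρ) → R) → R

  stable : ∀ φ {ρ} → ((holds φ ρ → R) → R) → holds φ ρ
  stable (s ≐ t)  h k = h (λ a → a k)
  stable (¬' φ)   h a = h (λ k → k a)
  stable (φ ∧' ψ) h = stable φ (λ k → h (k ∘ proj₁)) , stable ψ (λ k → h (k ∘ proj₂))
  stable (φ ∨' ψ) h k = h (λ a → a k)
  stable (φ ⇒ ψ)  h a = stable ψ (λ k → h (λ f → k (f a)))
  stable (∀' φ)   h x = stable φ (λ k → h (λ f → k (f x)))
  stable (∃' φ)   h k = h (λ a → a k)

  from-R : ∀ φ {ρ} → R → holds φ ρ
  from-R φ r = stable φ (λ _ → r)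

  liftS-env : ∀ {σ ρ ρ'} → (∀ i → evalT ρ (σ i) ≡ ρ' i) → ∀ x i → evalT (x ∷ₛ ρ) (liftS σ i) ≡ (x ∷ₛ ρ') i
  liftS-env h x zero    = refl
  liftS-env {σ} {ρ} h x (suc i) = trans (evalT-shiftT x ρ (σ i)) (h i)

  sub-to   : ∀ φ {σ ρ ρ'} → (∀ i → evalT ρ (σ i) ≡ ρ' i) → holds (subF σ φ) ρ → holds φ ρ'
  sub-from : ∀ φ {σ ρ ρ'} → (∀ i → evalT ρ (σ i) ≡ ρ' i) → holds φ ρ' → holds (subF σ φ) ρ
  sub-to (s ≐ t)  {σ} h a k = a (λ e → k (trans (sym (evalT-subT σ h s)) (trans e (evalT-subT σ h t))))
  sub-to (¬' φ)   h a = a ∘ sub-from φ h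
  sub-to (φ ∧' ψ) h (a , b) = sub-to φ h a , sub-to ψ h b
  sub-to (φ ∨' ψ) h a (k , l) = a (k ∘ sub-to φ h , l ∘ sub-to ψ h)
  sub-to (φ ⇒ ψ)  h a = sub-to ψ h ∘ a ∘ sub-from φ h
  sub-to (∀' φ)   h a x = sub-to φ (liftS-env h x) (a x)
  sub-to (∃' φ)   h a k = a (λ x → k x ∘ sub-to φ (liftS-env h x))
  sub-from (s ≐ t)  {σ} h a k = a (λ e → k (trans (evalT-subT σ h s) (trans e (sym (evalT-subT σ h t)))))
  sub-from (¬' φ)   h a = a ∘ sub-to φ h
  sub-from (φ ∧' ψ) h (a , b) = sub-from φ h a , sub-from ψ h b
  sub-from (φ ∨' ψ) h a (k , l) = a (k ∘ sub-from φ h , l ∘ sub-from ψ h)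
  sub-from (φ ⇒ ψ)  h a = sub-from ψ h ∘ a ∘ sub-to φ h
  sub-from (∀' φ)   h a x = sub-from φ (liftS-env h x) (a x)
  sub-from (∃' φ)   h a k = a (λ x → k x ∘ sub-from φ (liftS-env h x))

  single-env : ∀ t ρ i → evalT ρ (single t i) ≡ (evalT ρ t ∷ₛ ρ) i
  single-env t ρ zero    = refl
  single-env t ρ (suc i) = refl

  shift-to : ∀ φ {x ρ} → holds (shiftF φ) (x ∷ₛ ρ) → holds φ ρ
  shift-to φ {x} {ρ} = sub-to φ (λ i → refl) ∘ subst (λ ψ → holds ψ (x ∷ₛ ρ)) (renF-subF suc φ)

  shift-from : ∀ φ {x ρ} → holds φ ρ → holds (shiftF φ) (x ∷ₛ ρ)
  shift-from φ {x} {ρ} = subst (λ ψ → holds ψ (x ∷ₛ ρ)) (sym (renF-subF suc φ)) ∘ sub-from φ (λ i → refl)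

  -- Tautologies are defined by Boolean valuations, but the translation of a prime formula has no
  -- decidable truth value. A valuation agreeing with it is therefore only available while the goal
  -- is R.
  Agrees : (ℕ → ℕ) → (Formula → Bool) → Formula → Set
  Agrees ρ V φ = if V φ then holds φ ρ else (holds φ ρ → R)

  AgreesP : (ℕ → ℕ) → (Formula → Bool) → Formula → Set
  AgreesP ρ V (¬' φ)   = AgreesP ρ V φ
  AgreesP ρ V (φ ∧' ψ) = AgreesP ρ V φ × AgreesP ρ V ψ
  AgreesP ρ V (φ ∨' ψ) = AgreesP ρ V φ × AgreesP ρ V ψ
  AgreesP ρ V (φ ⇒ ψ)  = AgreesP ρ V φ × AgreesP ρ V ψ
  AgreesP ρ V φ        = Agrees ρ V φ

  evalP-agrees : ∀ φ {ρ V} → AgreesP ρ V φ → if evalP V φ then holds φ ρ else (holds φ ρ → R)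
  evalP-agrees (s ≐ t)  a = a
  evalP-agrees (∀' φ)   a = a
  evalP-agrees (∃' φ)   a = a
  evalP-agrees (¬' φ)   {ρ} {V} a with evalP V φ | evalP-agrees φ a
  ... | true  | h = λ k → k h
  ... | false | h = h
  evalP-agrees (φ ∧' ψ) {ρ} {V} (a , b) with evalP V φ | evalP-agrees φ a | evalP V ψ | evalP-agrees ψ b
  ... | true  | h | true  | h' = h , h'
  ... | true  | h | false | h' = h' ∘ proj₂
  ... | false | h | _     | _  = h ∘ proj₁
  evalP-agrees (φ ∨' ψ) {ρ} {V} (a , b) with evalP V φ | evalP-agrees φ a | evalP V ψ | evalP-agrees ψ b
  ... | true  | h | _     | _  = λ k → proj₁ k h
  ... | false | h | true  | h' = λ k → proj₂ k h'
  ... | false | h | false | h' = λ k → k (h , h')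
  evalP-agrees (φ ⇒ ψ)  {ρ} {V} (a , b) with evalP V φ | evalP-agrees φ a | evalP V ψ | evalP-agrees ψ b
  ... | true  | h | true  | h' = λ _ → h'
  ... | true  | h | false | h' = λ k → h' (k h)
  ... | false | h | _     | _  = λ k → from-R ψ (h k)

  -- Valuations are tables on Gödel numbers, where equality is decidable; injectivity of `gn`
  -- ensures that an update changes a single formula.
  coded : (ℕ → Bool) → Formula → Bool
  coded v φ = v (gn φ)

  update-hit : ∀ {ρ} v φ b → (if b then holds φ ρ else (holds φ ρ → R)) → Agrees ρ (coded (update v (gn φ) b)) φ
  update-hit v φ b h with gn φ NP.≟ gn φ
  ... | yes _ = h
  ... | no ¬e = ⊥-elim (¬e refl)

  update-keeps : ∀ {ρ} v χ b → (if b then holds χ ρ else (holds χ ρ → R)) →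
                 ∀ φ → Agrees ρ (coded v) φ → Agrees ρ (coded (update v (gn χ) b)) φ
  update-keeps v χ b h φ a with gn φ NP.≟ gn χ
  ... | no _  = a
  ... | yes e with gn-inj φ χ e
  ...   | refl = h

  update-keepsP : ∀ {ρ} v χ b → (if b then holds χ ρ else (holds χ ρ → R)) →
                  ∀ φ → AgreesP ρ (coded v) φ → AgreesP ρ (coded (update v (gn χ) b)) φ
  update-keepsP v χ b h (s ≐ t)  a = update-keeps v χ b h (s ≐ t) a
  update-keepsP v χ b h (∀' φ)   a = update-keeps v χ b h (∀' φ) a
  update-keepsP v χ b h (∃' φ)   a = update-keeps v χ b h (∃' φ) a
  update-keepsP v χ b h (¬' φ)   a = update-keepsP v χ b h φ a
  update-keepsP v χ b h (φ ∧' ψ) (a , a') = update-keepsP v χ b h φ a , update-keepsP v χ b h ψ a'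
  update-keepsP v χ b h (φ ∨' ψ) (a , a') = update-keepsP v χ b h φ a , update-keepsP v χ b h ψ a'
  update-keepsP v χ b h (φ ⇒ ψ)  (a , a') = update-keepsP v χ b h φ a , update-keepsP v χ b h ψ a'

  -- The last component preserves the agreement reached before, so the subformulas can be treated
  -- one after the other.
  Extension : (ℕ → ℕ) → (ℕ → Bool) → Formula → Set
  Extension ρ v φ = ∃ λ v' → AgreesP ρ (coded v') φ × (∀ ψ → AgreesP ρ (coded v) ψ → AgreesP ρ (coded v') ψ)

  -- Excluded middle relative to R: the value false is tried first, and whoever presents a proof of
  -- φ against it makes the continuation run again with the value true.
  decide-prime : ∀ ρ v φ → (∀ V → Agrees ρ V φ → AgreesP ρ V φ) → (Extension ρ v φ → R) → R
  decide-prime ρ v φ up k = k (update v (gn φ) false , up _ (update-hit v φ false no') , update-keepsP v φ false no')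
    where
    no' : holds φ ρ → R
    no' h = k (update v (gn φ) true , up _ (update-hit v φ true h) , update-keepsP v φ true h)

  decide : ∀ ρ v φ → (Extension ρ v φ → R) → R
  decide₂ : ∀ ρ v φ ψ → ((∃ λ v' → (AgreesP ρ (coded v') φ × AgreesP ρ (coded v') ψ)
             × (∀ χ → AgreesP ρ (coded v) χ → AgreesP ρ (coded v') χ)) → R) → R
  decide ρ v (s ≐ t)  = decide-prime ρ v (s ≐ t) (λ V → id)
  decide ρ v (∀' φ)   = decide-prime ρ v (∀' φ) (λ V → id)
  decide ρ v (∃' φ)   = decide-prime ρ v (∃' φ) (λ V → id)
  decide ρ v (¬' φ)   = decide ρ v φ
  decide ρ v (φ ∧' ψ) = decide₂ ρ v φ ψ
  decide ρ v (φ ∨' ψ) = decide₂ ρ v φ ψ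
  decide ρ v (φ ⇒ ψ)  = decide₂ ρ v φ ψ
  decide₂ ρ v φ ψ k = decide ρ v φ λ { (v₁ , a₁ , e₁) → decide ρ v₁ ψ λ { (v₂ , a₂ , e₂) →
    k (v₂ , (e₂ φ a₁ , a₂) , (λ χ → e₂ χ ∘ e₁ χ)) } }

  tautology-holds : ∀ φ ρ → Tautology φ → holds φ ρ
  tautology-holds φ ρ t = stable φ λ k → decide ρ (λ _ → false) φ λ { (v , a , _) →
    k (subst (λ b → if b then holds φ ρ else (holds φ ρ → R)) (t (coded v)) (evalP-agrees φ a)) }

  PA-holds : ∀ {φ} → PA φ → ∀ ρ → holds φ ρ
  PA-holds pa1 ρ a = a (λ ())
  PA-holds pa2 ρ a k = a (k ∘ NP.suc-injective)
  PA-holds pa3 ρ k = k (NP.+-identityʳ _)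
  PA-holds pa4 ρ k = k (NP.+-suc _ _)
  PA-holds pa5 ρ k = k (NP.*-zeroʳ (ρ 0))
  PA-holds pa6 ρ k = k (trans (NP.*-suc (ρ 0) (ρ 1)) (NP.+-comm (ρ 0) _))
  PA-holds (ind φ) ρ (z , s) zero    = sub-to φ (single-env zer ρ) z
  PA-holds (ind φ) ρ (z , s) (suc x) = sub-to φ (λ { zero → refl ; (suc i) → refl })
    (s x (PA-holds (ind φ) ρ (z , s) x))

  sound : ∀ {φ} → PA ⊢ φ → ∀ ρ → holds φ ρ
  sound (ax a)          ρ = PA-holds a ρ
  sound (taut {φ} t)    ρ = tautology-holds φ ρ t
  sound (mp d e)        ρ = sound d ρ (sound e ρ)
  sound (gen d)         ρ x = sound d (x ∷ₛ ρ)
  sound (∀-inst φ t)    ρ a = sub-from φ (single-env t ρ) (a (evalT ρ t))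
  sound (∀-dist φ ψ)    ρ a b x = a x (shift-from ψ b)
  sound (∃-intr φ t)    ρ a k = k (evalT ρ t) (sub-to φ (single-env t ρ) a)
  sound (∃-elim φ ψ)    ρ a b = stable ψ (λ k → b (λ x h → k (shift-to ψ (a x h))))
  sound (eq-refl t)     ρ k = k refl
  sound (eq-subst φ s t) ρ e a = stable (φ [ t ]) (λ k → e (λ q →
    k (sub-from φ (single-env t ρ) (subst (λ x → holds φ (x ∷ₛ ρ)) q (sub-to φ (single-env s ρ) a)))))

  le-holds : ∀ {ρ} i x → (holds (le (var 0) (var (suc i))) (x ∷ₛ ρ) → R) → x ≤ ρ i → R
  le-holds {ρ} i x k p = k (λ l → l (ρ i N.∸ x) (λ m → m (NP.m∸n+n≡m p)))

  holds-le : ∀ {ρ} i x → holds (le (var 0) (var (suc i))) (x ∷ₛ ρ) → (x ≤ ρ i → R) → R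
  holds-le {ρ} i x h k = h (λ z l → l (λ e → k (subst (x ≤_) e (NP.m≤n+m x z))))

  -- Bounded formulas are decided in the metatheory, so here the translation follows plain truth,
  -- with R in the place of a contradiction.
  bounded-true  : ∀ φ ρ → ⟦ φ ⟧ ρ → holds (formula φ) ρ
  bounded-false : ∀ φ ρ → ¬ ⟦ φ ⟧ ρ → holds (formula φ) ρ → R
  bounded-true (s ≐ᵇ t)  ρ d k = k d
  bounded-true (¬ᵇ φ)    ρ d = bounded-false φ ρ d
  bounded-true (φ ∧ᵇ ψ) ρ (d , e) = bounded-true φ ρ d , bounded-true ψ ρ e
  bounded-true (φ ∨ᵇ ψ) ρ (inj₁ d) (k , _) = k (bounded-true φ ρ d)
  bounded-true (φ ∨ᵇ ψ) ρ (inj₂ d) (_ , k) = k (bounded-true ψ ρ d)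
  bounded-true (φ ⇒ᵇ ψ) ρ d with ⟦ φ ⟧? ρ
  ... | yes a = λ _ → bounded-true ψ ρ (d a)
  ... | no ¬a = from-R (formula ψ) ∘ bounded-false φ ρ ¬a
  bounded-true (∀≤ i φ)  ρ d x h = stable (formula φ) (λ k → holds-le {ρ} i x h (λ p → k (bounded-true φ (x ∷ₛ ρ) (d x p))))
  bounded-true (∃≤ i φ)  ρ (x , p , d) k = le-holds {ρ} i x (λ l → k x (l , bounded-true φ (x ∷ₛ ρ) d)) p
  bounded-true (call φ is) ρ d = sub-from (formula φ) (evalT-args ρ is) (bounded-true φ (vals ρ is) d)
  bounded-false (s ≐ᵇ t)  ρ d h = h (⊥-elim ∘ d)
  bounded-false (¬ᵇ φ)    ρ d h with ⟦ φ ⟧? ρ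
  ... | yes a = h (bounded-true φ ρ a)
  ... | no ¬a = ⊥-elim (d ¬a)
  bounded-false (φ ∧ᵇ ψ) ρ d (h , h') with ⟦ φ ⟧? ρ
  ... | yes a = bounded-false ψ ρ (λ b → d (a , b)) h'
  ... | no ¬a = bounded-false φ ρ ¬a h
  bounded-false (φ ∨ᵇ ψ) ρ d h = h (bounded-false φ ρ (d ∘ inj₁) , bounded-false ψ ρ (d ∘ inj₂))
  bounded-false (φ ⇒ᵇ ψ) ρ d h with ⟦ φ ⟧? ρ
  ... | yes a = bounded-false ψ ρ (λ b → d (λ _ → b)) (h (bounded-true φ ρ a))
  ... | no ¬a = ⊥-elim (d (⊥-elim ∘ ¬a))
  bounded-false (∀≤ i φ)  ρ d h with ⟦ ∃≤ i (¬ᵇ φ) ⟧? ρ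
  ... | yes (x , p , n) = le-holds {ρ} i x (λ l → bounded-false φ (x ∷ₛ ρ) n (h x l)) p
  ... | no ¬e = ⊥-elim (d (λ x p → decidable-stable (⟦ φ ⟧? (x ∷ₛ ρ)) (λ n → ¬e (x , p , n))))
  bounded-false (∃≤ i φ)  ρ d h = h (λ x → λ { (l , a) → holds-le {ρ} i x l
    (λ p → bounded-false φ (x ∷ₛ ρ) (λ b → d (x , p , b)) a) })
  bounded-false (call φ is) ρ d h = bounded-false φ (vals ρ is) d (sub-to (formula φ) (evalT-args ρ is) h)

-- Finite sets of numbers coded by divisibility

-- Unlike `node` this pairing is a polynomial, hence a term of the language. It is injective because
-- with s = x + y the value lies between s² and s² + s, short of the next square.
cpair : ℕ → ℕ → ℕ
cpair x y = (x N.+ y) N.* (x N.+ y) N.+ x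

cpairᵗ : Term → Term → Term
cpairᵗ s t = (s +' t) *' (s +' t) +' s

cnode-<-sum : ∀ x y x' y' → x N.+ y < x' N.+ y' → cpair x y < cpair x' y'
cnode-<-sum x y x' y' p = NP.<-≤-trans (NP.+-monoʳ-< (s N.* s) (s≤s (NP.m≤m+n x y)))
  (NP.≤-trans (NP.≤-trans (subst (s N.* s N.+ suc s ≤_) (sym (NP.*-suc (suc s) s))
       (subst (s N.* s N.+ suc s ≤_) (NP.+-comm (suc s N.* s) (suc s)) (NP.+-monoˡ-≤ (suc s) (NP.m≤n+m (s N.* s) s))))
     (NP.*-mono-≤ p p)) (NP.m≤m+n (s' N.* s') x'))
  where
  s s' : ℕ
  s = x N.+ y
  s' = x' N.+ y'

cnode-inj : ∀ {x y x' y'} → cpair x y ≡ cpair x' y' → x ≡ x' × y ≡ y'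
cnode-inj {x} {y} {x'} {y'} e with NP.<-cmp (x N.+ y) (x' N.+ y')
... | tri< p _ _ = ⊥-elim (NP.<⇒≢ (cnode-<-sum x y x' y' p) e)
... | tri> _ _ p = ⊥-elim (NP.<⇒≢ (cnode-<-sum x' y' x y p) (sym e))
... | tri≈ _ q _ with NP.+-cancelˡ-≡ ((x' N.+ y') N.* (x' N.+ y')) x x' (subst (λ s → s N.* s N.+ x ≡ cpair x' y') q e)
...   | refl = refl , NP.+-cancelˡ-≡ x y y' q

m≤m*m : ∀ m → m ≤ m N.* m
m≤m*m zero    = z≤n
m≤m*m (suc m) = NP.m≤m*n (suc m) (suc m)

cpair-≤ˡ : ∀ x y → x ≤ cpair x y
cpair-≤ˡ x y = NP.m≤n+m x _

cpair-≤ʳ : ∀ x y → y ≤ cpair x y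
cpair-≤ʳ x y = NP.≤-trans (NP.m≤n+m y x) (NP.≤-trans (m≤m*m (x N.+ y)) (NP.m≤m+n _ x))

leq lt : ℕ → ℕ → BF
leq i j = ∃≤ j (var 0 ≐ᵇ var (suc i))
lt i j  = ∃≤ j (var 0 ≐ᵇ suc' (var (suc i)))

leq-to : ∀ {i j ρ} → ⟦ leq i j ⟧ ρ → ρ i ≤ ρ j
leq-to (_ , p , refl) = p

leq-from : ∀ {i j ρ} → ρ i ≤ ρ j → ⟦ leq i j ⟧ ρ
leq-from p = _ , p , refl

lt-to : ∀ {i j ρ} → ⟦ lt i j ⟧ ρ → ρ i < ρ j
lt-to (_ , p , refl) = p

lt-from : ∀ {i j ρ} → ρ i < ρ j → ⟦ lt i j ⟧ ρ
lt-from p = _ , p , refl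

-- The moduli of Gödel's β-function: for d = n! and c ≤ n they are pairwise coprime, so a finite set
-- is coded by the product of the moduli of its members.
modulus : ℕ → ℕ → ℕ
modulus d c = suc (suc c N.* d)

opaque
  -- The code is ⟨n, ⟨d, a⟩⟩, and c belongs to it if its modulus divides a. The condition c ≤ n is
  -- needed since coprimality is guaranteed only up to n. Inside, the variables are the quotient, a,
  -- d, n, c, u.
  mem : BF
  mem = ∃≤ 1 (∃≤ 2 (∃≤ 3 (∃≤ 4 (var 5 ≐ᵇ cpairᵗ (var 3) (cpairᵗ (var 2) (var 1)) ∧ᵇ leq 4 3
          ∧ᵇ var 1 ≐ᵇ var 0 *' suc' (suc' (var 4) *' var 2)))))

Mem : ℕ → ℕ → Set
Mem c u = ⟦ mem ⟧ (c ∷ₛ u ∷ₛ λ _ → 0)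

opaque
  unfolding mem
  Mem-≤ : ∀ {c u} → Mem c u → c ≤ u
  Mem-≤ {c} {u} (n , n≤u , d , _ , a , _ , q , _ , _ , c≤n , _) = NP.≤-trans (leq-to {4} {3} {q ∷ₛ a ∷ₛ d ∷ₛ n ∷ₛ c ∷ₛ u ∷ₛ λ _ → 0} c≤n) n≤u

opaque
  setCode : ℕ → List ℕ → ℕ
  setCode n l = cpair n (cpair (n !) (product (map (modulus (n !)) l)))

  setCode-≥ : ∀ n l → n ≤ setCode n l
  setCode-≥ n l = cpair-≤ˡ n _

-- A common divisor divides (j + 1) times the modulus of i minus (i + 1) times the modulus of j,
-- which is j - i. Hence it divides n!, and then 1.
modulus-coprime : ∀ n i j → i < j → j ≤ n → Coprime (modulus (n !) i) (modulus (n !) j)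
modulus-coprime n i j i<j j≤n {g} (g∣i , g∣j) = ∣1⇒≡1 (∣m+n∣m⇒∣n (subst (g ∣_) (NP.+-comm 1 (suc i N.* D)) g∣i) (∣n⇒∣m*n (suc i) g∣D))
  where
  D k : ℕ
  D = n !
  k = j N.∸ i
  cross : suc i N.* modulus D j N.+ k ≡ suc j N.* modulus D i
  cross = subst (λ m → suc i N.* modulus D m N.+ k ≡ suc m N.* modulus D i) (NP.m+[n∸m]≡n (NP.<⇒≤ i<j)) (poly i k D)
    where
    poly : ∀ i k D → suc i N.* suc (suc (i N.+ k) N.* D) N.+ k ≡ suc (i N.+ k) N.* suc (suc i N.* D)
    poly i k D = trans (cong (N._+ k) (NP.*-suc (suc i) (S' N.* D)))
      (trans (NP.+-assoc (suc i) (suc i N.* (S' N.* D)) k)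
      (trans (cong (suc i N.+_) (trans (NP.+-comm (suc i N.* (S' N.* D)) k) (cong (k N.+_) swap)))
      (trans (sym (NP.+-assoc (suc i) k (S' N.* (suc i N.* D)))) (sym (NP.*-suc S' (suc i N.* D))))))
      where
      S' : ℕ
      S' = suc (i N.+ k)
      swap : suc i N.* (S' N.* D) ≡ S' N.* (suc i N.* D)
      swap = trans (sym (NP.*-assoc (suc i) S' D)) (trans (cong (N._* D) (NP.*-comm (suc i) S')) (NP.*-assoc S' (suc i) D))
  instance
    k≢0 : NonZero k
    k≢0 = N.>-nonZero (NP.m<n⇒0<n∸m i<j)
  k∣k! : ∀ k → {{NonZero k}} → k ∣ k !
  k∣k! (suc k) = m∣m*n (k !)
  g∣D : g ∣ D
  g∣D = ∣-trans (∣m+n∣m⇒∣n (subst (g ∣_) (sym cross) (∣n⇒∣m*n (suc j) g∣i)) (∣n⇒∣m*n (suc i) g∣j))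
          (∣-trans (k∣k! k) (m≤n⇒m!∣n! (NP.≤-trans (NP.m∸n≤m j i) j≤n)))

modulus-∤1 : ∀ n i → ¬ modulus (n !) i ∣ 1
modulus-∤1 n i h with NP.m*n≡0⇒m≡0∨n≡0 (suc i) (NP.suc-injective (∣1⇒≡1 h))
... | inj₂ e = NP.<⇒≢ (NP.1≤n! n) (sym e)

-- The modulus of c is coprime to the factors belonging to other members, so Euclid's lemma strips
-- them off one at a time.
∈-product : ∀ n c l → c ≤ n → All (_≤ n) l → modulus (n !) c ∣ product (map (modulus (n !)) l) → c ∈ l
∈-product n c []      p q h = ⊥-elim (modulus-∤1 n c h)
∈-product n c (x ∷ l) p (x≤n ∷ q) h with NP.<-cmp c x
... | tri≈ _ refl _ = here refl
... | tri< c<x _ _ = there (∈-product n c l p q (coprime-divisor (modulus-coprime n c x c<x x≤n) h))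
... | tri> _ _ x<c = there (∈-product n c l p q
        (coprime-divisor (λ { (d , d') → modulus-coprime n x c x<c p (d' , d) }) h))

product-∈ : ∀ n c l → c ∈ l → modulus (n !) c ∣ product (map (modulus (n !)) l)
product-∈ n c (x ∷ l) (here refl) = m∣m*n _
product-∈ n c (x ∷ l) (there h)   = ∣n⇒∣m*n (modulus (n !) x) (product-∈ n c l h)

opaque
  unfolding mem setCode
  Mem-setCode : ∀ n l c → All (_≤ n) l → c ∈ l → Mem c (setCode n l)
  Mem-setCode n l c q h with product-∈ n c l h
  ... | divides k e = n , cpair-≤ˡ n _ , n ! , NP.≤-trans (cpair-≤ˡ (n !) A) (cpair-≤ʳ n _) ,
        A , A≤ , k , NP.≤-trans (subst (k ≤_) (sym e) (NP.m≤m*n k (modulus (n !) c))) A≤ ,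
        refl , leq-from {4} {3} {k ∷ₛ A ∷ₛ n ! ∷ₛ n ∷ₛ c ∷ₛ λ _ → 0} (All.lookup q h) , e
    where
    A : ℕ
    A = product (map (modulus (n !)) l)
    A≤ : A ≤ setCode n l
    A≤ = NP.≤-trans (cpair-≤ʳ (n !) A) (cpair-≤ʳ n _)

  setCode-Mem : ∀ n l c → All (_≤ n) l → Mem c (setCode n l) → c ∈ l
  setCode-Mem n l c q (n' , _ , d , _ , a , _ , k , _ , e , c≤n , e') with cnode-inj {n} {_} {n'} {cpair d a} e
  ... | refl , e₂ with cnode-inj {n !} {_} {d} {a} e₂
  ...   | refl , refl = ∈-product n c l (leq-to {4} {3} {k ∷ₛ a ∷ₛ d ∷ₛ n ∷ₛ c ∷ₛ λ _ → 0} c≤n) q (divides k e')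

-- Inductive definitions over ℕ given by finitely many clauses

-- Sums and successors are included to express comparisons of de Bruijn indices: i < k is matched as
-- k = i + j + 1.
data Pat (A : Set) : Set where
  V   : A → Pat A
  Zₚ  : Pat A
  Sₚ  : Pat A → Pat A
  _⊕_ : Pat A → Pat A → Pat A
  pr  : Pat A → Pat A → Pat A

lit : ∀ {A} → ℕ → Pat A
lit zero    = Zₚ
lit (suc n) = Sₚ (lit n)

evalPat : ∀ {A} → (A → ℕ) → Pat A → ℕ
evalPat v (V a)    = v a
evalPat v Zₚ       = 0
evalPat v (Sₚ p)   = suc (evalPat v p)
evalPat v (p ⊕ q)  = evalPat v p N.+ evalPat v q
evalPat v (pr p q) = node (evalPat v p) (evalPat v q)

evalPat-lit : ∀ {A} (v : A → ℕ) n → evalPat v (lit n) ≡ n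
evalPat-lit v zero    = refl
evalPat-lit v (suc n) = cong suc (evalPat-lit v n)

record Fact : Set where
  constructor fact
  field tag x₁ x₂ x₃ x₄ : ℕ

record Atom (A : Set) : Set where
  constructor atm
  field
    tag         : ℕ
    p₁ p₂ p₃ p₄ : Pat A

evalA : ∀ {A} → (A → ℕ) → Atom A → Fact
evalA v (atm t p q r s) = fact t (evalPat v p) (evalPat v q) (evalPat v r) (evalPat v s)

codeFact : Fact → ℕ
codeFact (fact t x y z w) = node t (node x (node y (node z w)))

codeFact-inj : ∀ f g → codeFact f ≡ codeFact g → f ≡ g
codeFact-inj (fact t x y z w) (fact t' x' y' z' w') e with node-inj t t' {node x (node y (node z w))} {node x' (node y' (node z' w'))} e
... | refl , e₁ with node-inj x x' {node y (node z w)} {node y' (node z' w')} e₁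
... | refl , e₂ with node-inj y y' {node z w} {node z' w'} e₂
... | refl , e₃ with node-inj z z' {w} {w'} e₃
... | refl , refl = refl

atomPat : ∀ {A} → Atom A → Pat A
atomPat (atm t p q r s) = pr (lit t) (pr p (pr q (pr r s)))

evalPat-atom : ∀ {A} (v : A → ℕ) a → evalPat v (atomPat a) ≡ codeFact (evalA v a)
evalPat-atom v (atm t p q r s) =
  cong (λ k → node k (node (evalPat v p) (node (evalPat v q) (node (evalPat v r) (evalPat v s))))) (evalPat-lit v t)

-- A derivation is coded by a set containing triples for the graph of node
-- and facts with time stamps that decrease from conclusion to premises.

pairEntry : ℕ → ℕ → ℕ → ℕ
pairEntry x y z = cpair 0 (cpair x (cpair y z))

factEntry : ℕ → ℕ → ℕ
factEntry t h = cpair (suc t) h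

pairEntryᵗ : Term → Term → Term → Term
pairEntryᵗ x y z = cpairᵗ zer (cpairᵗ x (cpairᵗ y z))

memb : ℕ → ℕ → BF
memb i j = call mem (i ∷ j ∷ [])

-- pmatch f s d p j: the variable j equals the value of the pattern p, whose
-- variable a is read at index d + f a, according to the pairs in the set s.
pmatch : ∀ {A} → (A → ℕ) → ℕ → ℕ → Pat A → ℕ → BF
pmatch f s d (V a)    j = var j ≐ᵇ var (d N.+ f a)
pmatch f s d Zₚ       j = var j ≐ᵇ zer
pmatch f s d (Sₚ p)   j = ∃≤ s (pmatch f (suc s) (suc d) p 0 ∧ᵇ var (suc j) ≐ᵇ suc' (var 0))
pmatch f s d (p ⊕ q)  j = ∃≤ s (∃≤ (suc s) (pmatch f (2 N.+ s) (2 N.+ d) p 1 ∧ᵇ pmatch f (2 N.+ s) (2 N.+ d) q 0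
                            ∧ᵇ var (2 N.+ j) ≐ᵇ var 1 +' var 0))
pmatch f s d (pr p q) j = ∃≤ s (∃≤ (suc s) (pmatch f (2 N.+ s) (2 N.+ d) p 1 ∧ᵇ pmatch f (2 N.+ s) (2 N.+ d) q 0
                            ∧ᵇ ∃≤ (2 N.+ s) (var 0 ≐ᵇ pairEntryᵗ (var 2) (var 1) (var (3 N.+ j)) ∧ᵇ memb 0 (3 N.+ s))))

PairsOK : ℕ → Set
PairsOK s = ∀ x y z → Mem (pairEntry x y z) s → z ≡ node x y

pmatch-sound : ∀ {A} (f : A → ℕ) p s d j {ρ} → PairsOK (ρ s) → ⟦ pmatch f s d p j ⟧ ρ →
               ρ j ≡ evalPat (λ a → ρ (d N.+ f a)) p
pmatch-sound f (V a)    s d j ok h = h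
pmatch-sound f Zₚ       s d j ok h = h
pmatch-sound f (Sₚ p)   s d j ok (x , _ , h , e) = trans e (cong suc (pmatch-sound f p (suc s) (suc d) 0 ok h))
pmatch-sound f (p ⊕ q)  s d j ok (x , _ , y , _ , h , h' , e) = trans e
  (cong₂ N._+_ (pmatch-sound f p (2 N.+ s) (2 N.+ d) 1 ok h) (pmatch-sound f q (2 N.+ s) (2 N.+ d) 0 ok h'))
pmatch-sound f (pr p q) s d j ok (x , _ , y , _ , h , h' , z , _ , refl , m) = trans (ok x y _ m)
  (cong₂ node (pmatch-sound f p (2 N.+ s) (2 N.+ d) 1 ok h) (pmatch-sound f q (2 N.+ s) (2 N.+ d) 0 ok h'))

-- Bounds all values met while matching, in particular both arguments of every `node`, so a set with
-- all pairs up to this bound suffices for the match.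
bnd : ∀ {A} → (A → ℕ) → Pat A → ℕ
bnd v (V a)    = v a
bnd v Zₚ       = 0
bnd v (Sₚ p)   = suc (bnd v p)
bnd v (p ⊕ q)  = bnd v p N.+ bnd v q
bnd v (pr p q) = node (evalPat v p) (evalPat v q) ⊔ (bnd v p ⊔ bnd v q)

evalPat≤bnd : ∀ {A} (v : A → ℕ) p → evalPat v p ≤ bnd v p
evalPat≤bnd v (V a)    = NP.≤-refl
evalPat≤bnd v Zₚ       = z≤n
evalPat≤bnd v (Sₚ p)   = s≤s (evalPat≤bnd v p)
evalPat≤bnd v (p ⊕ q)  = NP.+-mono-≤ (evalPat≤bnd v p) (evalPat≤bnd v q)
evalPat≤bnd v (pr p q) = NP.m≤m⊔n _ _

Saturated : ℕ → ℕ → Set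
Saturated m s = m ≤ s × (∀ x y → x ≤ m → y ≤ m → Mem (pairEntry x y (node x y)) s)

pmatch-complete : ∀ {A} (f : A → ℕ) p s d j {ρ m} → Saturated m (ρ s) → bnd (λ a → ρ (d N.+ f a)) p ≤ m →
                  ρ j ≡ evalPat (λ a → ρ (d N.+ f a)) p → ⟦ pmatch f s d p j ⟧ ρ
pmatch-complete f (V a)    s d j sat b e = e
pmatch-complete f Zₚ       s d j sat b e = e
pmatch-complete f (Sₚ p)   s d j {ρ} sat b e =
  _ , NP.≤-trans (NP.≤-trans (evalPat≤bnd _ p) b') (proj₁ sat) ,
  pmatch-complete f p (suc s) (suc d) 0 sat b' refl , e
  where b' = NP.≤-trans (NP.n≤1+n _) b
pmatch-complete f (p ⊕ q)  s d j {ρ} sat b e =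
  _ , NP.≤-trans (NP.≤-trans (evalPat≤bnd _ p) bp) (proj₁ sat) ,
  _ , NP.≤-trans (NP.≤-trans (evalPat≤bnd _ q) bq) (proj₁ sat) ,
  pmatch-complete f p (2 N.+ s) (2 N.+ d) 1 sat bp refl ,
  pmatch-complete f q (2 N.+ s) (2 N.+ d) 0 sat bq refl , e
  where
  bp = NP.≤-trans (NP.m≤m+n _ _) b
  bq = NP.≤-trans (NP.m≤n+m _ (bnd (λ a → ρ (d N.+ f a)) p)) b
pmatch-complete f (pr p q) s d j {ρ} sat b e =
  _ , NP.≤-trans ep (proj₁ sat) , _ , NP.≤-trans eq (proj₁ sat) ,
  pmatch-complete f p (2 N.+ s) (2 N.+ d) 1 sat bp refl ,
  pmatch-complete f q (2 N.+ s) (2 N.+ d) 0 sat bq refl ,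
  _ , Mem-≤ m , refl , m
  where
  v = λ a → ρ (d N.+ f a)
  bp = NP.≤-trans (NP.m≤m⊔n (bnd v p) (bnd v q)) (NP.≤-trans (NP.m≤n⊔m (node (evalPat v p) (evalPat v q)) _) b)
  bq = NP.≤-trans (NP.m≤n⊔m (bnd v p) (bnd v q)) (NP.≤-trans (NP.m≤n⊔m (node (evalPat v p) (evalPat v q)) _) b)
  ep = NP.≤-trans (evalPat≤bnd v p) bp
  eq = NP.≤-trans (evalPat≤bnd v q) bq
  m : Mem (pairEntry (evalPat v p) (evalPat v q) (ρ j)) (ρ s)
  m = subst (λ z → Mem (pairEntry (evalPat v p) (evalPat v q) z) (ρ s)) (sym e) (proj₂ sat _ _ ep eq)

exN : ℕ → ℕ → BF → BF
exN zero    s φ = φ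
exN (suc k) s φ = exN k s (∃≤ (k N.+ s) φ)

_++ₛ_ : ∀ {k} → Vec ℕ k → (ℕ → ℕ) → ℕ → ℕ
[] ++ₛ ρ       = ρ
(x ∷ v) ++ₛ ρ = x ∷ₛ (v ++ₛ ρ)

++ₛ-skip : ∀ {k} (v : Vec ℕ k) ρ s → (v ++ₛ ρ) (k N.+ s) ≡ ρ s
++ₛ-skip []      ρ s = refl
++ₛ-skip (x ∷ v) ρ s = ++ₛ-skip v ρ s

++ₛ-lookup : ∀ {k} (v : Vec ℕ k) ρ i → (v ++ₛ ρ) (toℕ i) ≡ lookup v i
++ₛ-lookup (x ∷ v) ρ Fin.zero    = refl
++ₛ-lookup (x ∷ v) ρ (Fin.suc i) = ++ₛ-lookup v ρ i

exN-to : ∀ k s φ {ρ} → ⟦ exN k s φ ⟧ ρ → ∃ λ (v : Vec ℕ k) → ⟦ φ ⟧ (v ++ₛ ρ)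
exN-to zero    s φ h = [] , h
exN-to (suc k) s φ h with exN-to k s _ h
... | v , x , _ , h' = (x ∷ v) , h'

exN-from : ∀ {k} (v : Vec ℕ k) s φ {ρ} → (∀ i → lookup v i ≤ ρ s) → ⟦ φ ⟧ (v ++ₛ ρ) → ⟦ exN k s φ ⟧ ρ
exN-from []      s φ b h = h
exN-from (x ∷ v) s φ {ρ} b h = exN-from v s _ (b ∘ Fin.suc)
  (x , subst (x ≤_) (sym (++ₛ-skip v ρ s)) (b Fin.zero) , h)

orL andL : List BF → BF
orL []        = zer ≐ᵇ suc' zer
orL (φ ∷ φs)  = φ ∨ᵇ orL φs
andL []       = zer ≐ᵇ zer
andL (φ ∷ φs) = φ ∧ᵇ andL φs

module _ {B : Set} (f : B → BF) where
  orL-to : ∀ bs {ρ} → ⟦ orL (map f bs) ⟧ ρ → ∃ λ b → b ∈ bs × ⟦ f b ⟧ ρ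
  orL-to (b ∷ bs) (inj₁ h) = b , here refl , h
  orL-to (b ∷ bs) (inj₂ h) with orL-to bs h
  ... | b' , m , h' = b' , there m , h'

  orL-from : ∀ {b bs ρ} → b ∈ bs → ⟦ f b ⟧ ρ → ⟦ orL (map f bs) ⟧ ρ
  orL-from (here refl) h = inj₁ h
  orL-from (there m)   h = inj₂ (orL-from m h)

  andL-to : ∀ bs {ρ} → ⟦ andL (map f bs) ⟧ ρ → All (λ b → ⟦ f b ⟧ ρ) bs
  andL-to []       h       = []
  andL-to (b ∷ bs) (h , k) = h ∷ andL-to bs k

  andL-from : ∀ {bs ρ} → All (λ b → ⟦ f b ⟧ ρ) bs → ⟦ andL (map f bs) ⟧ ρ
  andL-from []       = refl
  andL-from (h ∷ hs) = h , andL-from hs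

evalPat-ext : ∀ {A} {v w : A → ℕ} → (∀ a → v a ≡ w a) → ∀ p → evalPat v p ≡ evalPat w p
evalPat-ext h (V a)    = h a
evalPat-ext h Zₚ       = refl
evalPat-ext h (Sₚ p)   = cong suc (evalPat-ext h p)
evalPat-ext h (p ⊕ q)  = cong₂ N._+_ (evalPat-ext h p) (evalPat-ext h q)
evalPat-ext h (pr p q) = cong₂ node (evalPat-ext h p) (evalPat-ext h q)

bnd-ext : ∀ {A} {v w : A → ℕ} → (∀ a → v a ≡ w a) → ∀ p → bnd v p ≡ bnd w p
bnd-ext h (V a)    = h a
bnd-ext h Zₚ       = refl
bnd-ext h (Sₚ p)   = cong suc (bnd-ext h p)
bnd-ext h (p ⊕ q)  = cong₂ N._+_ (bnd-ext h p) (bnd-ext h q)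
bnd-ext h (pr p q) = cong₂ _⊔_ (cong₂ node (evalPat-ext h p) (evalPat-ext h q)) (cong₂ _⊔_ (bnd-ext h p) (bnd-ext h q))

-- Eight variables are what the clause for the substitution axiom of equality needs.
record Clause : Set where
  constructor _⊃_
  field
    prems : List (Atom (Fin 8))
    head  : Atom (Fin 8)
open Clause public

module Derivations (Π : List Clause) where

  data Drv : Fact → Set where
    step : ∀ {c} → c ∈ Π → (v : Vec ℕ 8) → All (λ p → Drv (evalA (lookup v) p)) (prems c) →
           Drv (evalA (lookup v) (head c))

  -- In the surrounding environment the indices 0 to 7 hold the variables of the clause, 8 the
  -- number of the fact, 9 its time stamp, 10 its entry and 11 the set. The three quantifiers move
  -- these up by three.
  premB : Atom (Fin 8) → BF
  premB p = ∃≤ 11 (∃≤ 12 (∃≤ 13 (var 0 ≐ᵇ cpairᵗ (suc' (var 1)) (var 2) ∧ᵇ memb 0 14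
              ∧ᵇ pmatch toℕ 14 3 (atomPat p) 2 ∧ᵇ lt 1 12)))

  clauseB : Clause → BF
  clauseB c = pmatch toℕ 11 0 (atomPat (head c)) 8 ∧ᵇ andL (map premB (prems c))

  -- The recursion node 0 y = 2y + 1, node (x + 1) y = 2 · node x y, where the entry for the smaller
  -- pair must belong to the same set.
  pairB : BF
  pairB = ∃≤ 1 (∃≤ 2 (∃≤ 3 (var 3 ≐ᵇ pairEntryᵗ (var 2) (var 1) (var 0) ∧ᵇ
    ((var 2 ≐ᵇ zer ∧ᵇ var 0 ≐ᵇ suc' (var 1 +' var 1)) ∨ᵇ
     ∃≤ 4 (∃≤ 5 (var 4 ≐ᵇ suc' (var 1) ∧ᵇ var 2 ≐ᵇ var 0 +' var 0
        ∧ᵇ ∃≤ 6 (var 0 ≐ᵇ pairEntryᵗ (var 2) (var 4) (var 1) ∧ᵇ memb 0 7)))))))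

  factB : BF
  factB = ∃≤ 1 (∃≤ 2 (var 2 ≐ᵇ cpairᵗ (suc' (var 1)) (var 0) ∧ᵇ exN 8 3 (orL (map clauseB Π))))

  valid : BF
  valid = ∀≤ 0 (memb 0 1 ⇒ᵇ pairB ∨ᵇ factB)

  Valid : ℕ → Set
  Valid s = ⟦ valid ⟧ (s ∷ₛ λ _ → 0)

  -- A valid set may lack pairs but has no wrong ones: each entry is traced back along its first
  -- component.
  valid-pairs : ∀ {s} → Valid s → PairsOK s
  valid-pairs {s} val zero y z m with val _ (Mem-≤ m) m
  ... | inj₂ (t , _ , h , _ , e , _) = ⊥-elim (NP.0≢1+n (proj₁ (cnode-inj {0} {cpair zero (cpair y z)} {suc t} {h} e)))
  ... | inj₁ (x' , _ , y' , _ , z' , _ , e , h) with cnode-inj {0} {cpair zero (cpair y z)} {0} {cpair x' (cpair y' z')} e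
  ...   | _ , e₁ with cnode-inj {zero} {cpair y z} {x'} {cpair y' z'} e₁
  ...     | refl , e₂ with cnode-inj {y} {z} {y'} {z'} e₂
  valid-pairs val zero y z m | inj₁ (x' , _ , y' , _ , z' , _ , e , inj₁ (_ , q)) | _ , e₁ | refl , e₂ | refl , refl =
    trans q (trans (cong (λ k → suc (y N.+ k)) (sym (NP.+-identityʳ y))) (sym (node-zero y)))
  valid-pairs val zero y z m | inj₁ (x' , _ , y' , _ , z' , _ , e , inj₂ (_ , _ , _ , _ , () , _)) | _ , e₁ | refl , e₂ | refl , refl
  valid-pairs {s} val (suc x) y z m with val _ (Mem-≤ m) m
  ... | inj₂ (t , _ , h , _ , e , _) = ⊥-elim (NP.0≢1+n (proj₁ (cnode-inj {0} {cpair (suc x) (cpair y z)} {suc t} {h} e)))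
  ... | inj₁ (x' , _ , y' , _ , z' , _ , e , h) with cnode-inj {0} {cpair (suc x) (cpair y z)} {0} {cpair x' (cpair y' z')} e
  ...   | _ , e₁ with cnode-inj {suc x} {cpair y z} {x'} {cpair y' z'} e₁
  ...     | refl , e₂ with cnode-inj {y} {z} {y'} {z'} e₂
  valid-pairs val (suc x) y z m | inj₁ (x' , _ , y' , _ , z' , _ , e , inj₁ (() , _)) | _ , e₁ | refl , e₂ | refl , refl
  valid-pairs val (suc x) y z m | inj₁ (x' , _ , y' , _ , z' , _ , e , inj₂ (_ , _ , w , _ , refl , q , _ , _ , refl , m')) | _ , e₁ | refl , e₂ | refl , refl =
    trans q (trans (cong₂ N._+_ ih (trans ih (sym (NP.+-identityʳ _)))) (sym (node-suc x y)))
    where ih = valid-pairs val x y w m'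

  -- Induction on the time stamp, which excludes facts that support each other in a circle.
  valid-facts : ∀ {s} → Valid s → ∀ t h → Mem (factEntry t h) s → ∃ λ f → h ≡ codeFact f × Drv f
  valid-facts {s} val = NI.<-rec (λ t → ∀ h → Mem (factEntry t h) s → ∃ λ f → h ≡ codeFact f × Drv f) go
    where
    ok = valid-pairs val
    go : ∀ t → (∀ {t'} → t' < t → ∀ h → Mem (factEntry t' h) s → ∃ λ f → h ≡ codeFact f × Drv f) →
         ∀ h → Mem (factEntry t h) s → ∃ λ f → h ≡ codeFact f × Drv f
    go t ih h m with val _ (Mem-≤ m) m
    ... | inj₁ (x , _ , y , _ , z , _ , e , _) = ⊥-elim (NP.0≢1+n (sym (proj₁ (cnode-inj {suc t} {h} {0} {cpair x (cpair y z)} e))))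
    ... | inj₂ (t' , _ , h' , _ , e , body) with cnode-inj {suc t} {h} {suc t'} {h'} e
    ...   | refl , refl with exN-to 8 3 (orL (map clauseB Π)) {h' ∷ₛ t ∷ₛ factEntry t h ∷ₛ s ∷ₛ λ _ → 0} body
    ...     | v , h₁ with orL-to clauseB Π {v ++ₛ (h' ∷ₛ t ∷ₛ factEntry t h ∷ₛ s ∷ₛ λ _ → 0)} h₁
    ...       | c , c∈ , hd , ps = evalA w (head c) , value , step c∈ v (All.map (λ {p} → prem p) (andL-to premB (prems c) {ρ} ps))
      where
      ρ : ℕ → ℕ
      ρ = v ++ₛ (h ∷ₛ t ∷ₛ factEntry t h ∷ₛ s ∷ₛ λ _ → 0)
      w : Fin 8 → ℕ
      w = lookup v
      len : ∀ {v : Vec ℕ 8} {ρ'} → ∀ j → (v ++ₛ ρ') (8 N.+ j) ≡ ρ' j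
      len {v} {ρ'} = ++ₛ-skip v ρ'
      value : h ≡ codeFact (evalA w (head c))
      value = trans (sym (len {v} 0)) (trans (pmatch-sound toℕ (atomPat (head c)) 11 0 8 {ρ} (subst PairsOK (sym (len {v} 3)) ok) hd)
                (trans (evalPat-ext (++ₛ-lookup v _) (atomPat (head c))) (evalPat-atom w (head c))))
      prem : ∀ p → ⟦ premB p ⟧ ρ → Drv (evalA w p)
      prem p (h' , _ , t' , _ , y' , _ , refl , m' , pm , l) with ih
          (subst (t' <_) (len {v} 1) (lt-to {1} {12} {y' ∷ₛ t' ∷ₛ h' ∷ₛ ρ} l)) h' (subst (Mem y') (len {v} 3) m')
      ... | f , e₁ , d = subst Drv (codeFact-inj f (evalA w p) (trans (sym e₁)
              (trans (pmatch-sound toℕ (atomPat p) 14 3 2 {y' ∷ₛ t' ∷ₛ h' ∷ₛ ρ} (subst PairsOK (sym (len {v} 3)) ok) pm)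
                (trans (evalPat-ext (++ₛ-lookup v _) (atomPat p)) (evalPat-atom w p))))) d

  Timed : Set
  Timed = List (ℕ × Fact)

  -- The number m bounds everything that the later pattern matching touches; `Coding` then puts all
  -- pairs with components up to m into the set.
  record Justified (m : ℕ) (L : Timed) (t : ℕ) (f : Fact) : Set where
    constructor justified
    field
      {clause} : Clause
      clause∈  : clause ∈ Π
      v        : Vec ℕ 8
      is-head  : f ≡ evalA (lookup v) (head clause)
      v≤m      : ∀ i → lookup v i ≤ m
      head≤m   : bnd (lookup v) (atomPat (head clause)) ≤ m
      earlier  : All (λ p → bnd (lookup v) (atomPat p) ≤ m × ∃ λ t' → t' < t × (t' , evalA (lookup v) p) ∈ L) (prems clause)

  AllJustified : ℕ → Timed → Set
  AllJustified m L = ∀ {t f} → (t , f) ∈ L → Justified m L t f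

  Justified-mono : ∀ {m m' L L' t f} → m ≤ m' → (∀ {x} → x ∈ L → x ∈ L') → Justified m L t f → Justified m' L' t f
  Justified-mono p i (justified c v e b b' ps) = justified c v e (λ k → NP.≤-trans (b k) p) (NP.≤-trans b' p)
    (All.map (λ { (b'' , t' , l , x) → NP.≤-trans b'' p , t' , l , i x }) ps)

  AllJustified-++ : ∀ {m m' L L'} → AllJustified m L → AllJustified m' L' → AllJustified (m ⊔ m') (L ++ L')
  AllJustified-++ {m} {m'} {L} j j' x with ∈-++⁻ L x
  ... | inj₁ y = Justified-mono (NP.m≤m⊔n m m') ∈-++⁺ˡ (j y)
  ... | inj₂ y = Justified-mono (NP.m≤n⊔m m m') (∈-++⁺ʳ L) (j' y)

  maxV : ∀ {k} (v : Vec ℕ k) → ∃ λ m → ∀ i → lookup v i ≤ m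
  maxV []      = 0 , λ ()
  maxV (x ∷ v) with maxV v
  ... | m , h = x ⊔ m , λ { Fin.zero → NP.m≤m⊔n x m ; (Fin.suc i) → NP.≤-trans (h i) (NP.m≤n⊔m x m) }

  -- The number t returned by `timedAll` lies above the stamps of all premises, hence serves as the
  -- stamp of the conclusion.
  timed : ∀ {f} → Drv f → ∃ λ m → ∃ λ L → ∃ λ t → (t , f) ∈ L × AllJustified m L
  timedAll : ∀ {v : Vec ℕ 8} {ps} → All (λ p → Drv (evalA (lookup v) p)) ps → ∃ λ m → ∃ λ L → ∃ λ t → AllJustified m L ×
             All (λ p → bnd (lookup v) (atomPat p) ≤ m × ∃ λ t' → t' < t × (t' , evalA (lookup v) p) ∈ L) ps
  timed (step {c} c∈ v ds) with timedAll {v} ds | maxV v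
  ... | m , L , t , j , es | m' , b = M , (t , f) ∷ L , t , here refl , all
    where
    f = evalA (lookup v) (head c)
    M = m ⊔ (m' ⊔ bnd (lookup v) (atomPat (head c)))
    all : AllJustified M ((t , f) ∷ L)
    all (here refl) = justified c∈ v refl (λ i → NP.≤-trans (b i) (NP.≤-trans (NP.m≤m⊔n m' _) (NP.m≤n⊔m m _)))
      (NP.≤-trans (NP.m≤n⊔m m' _) (NP.m≤n⊔m m _))
      (All.map (λ { (b'' , t' , l , x) → NP.≤-trans b'' (NP.m≤m⊔n m _) , t' , l , there x }) es)
    all (there x) = Justified-mono (NP.m≤m⊔n m _) there (j x)
  timedAll [] = 0 , [] , 0 , (λ ()) , []
  timedAll {v} (_∷_ {p} d ds) with timed d | timedAll {v} ds
  ... | m , L , t , x , j | m' , L' , t' , j' , es =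
    bnd (lookup v) (atomPat p) ⊔ (m ⊔ m') , L ++ L' , suc t ⊔ t' ,
    (λ y → Justified-mono (NP.m≤n⊔m (bnd (lookup v) (atomPat p)) _) id (AllJustified-++ j j' y)) ,
    ((NP.m≤m⊔n _ _ , t , NP.m≤m⊔n (suc t) t' , ∈-++⁺ˡ x) ∷
     All.map (λ { (b , s , l , y) → NP.≤-trans b (NP.≤-trans (NP.m≤n⊔m m m') (NP.m≤n⊔m (bnd (lookup v) (atomPat p)) _)) , s ,
       NP.≤-trans l (NP.m≤n⊔m (suc t) t') , ∈-++⁺ʳ L y }) es)

  entry : ℕ × Fact → ℕ
  entry (t , f) = factEntry t (codeFact f)

  entries : ℕ → Timed → List ℕ
  entries m L = cartesianProductWith (λ x y → pairEntry x y (node x y)) (upTo (suc m)) (upTo (suc m)) ++ map entry L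

  maxL : (l : List ℕ) → ∃ λ m → All (_≤ m) l
  maxL []      = 0 , []
  maxL (x ∷ l) with maxL l
  ... | m , h = x ⊔ m , (NP.m≤m⊔n x m ∷ All.map (λ p → NP.≤-trans p (NP.m≤n⊔m x m)) h)

  module Coding (m : ℕ) (L : Timed) (j : AllJustified m L) where
    l : List ℕ
    l = entries m L
    n s : ℕ
    n = m ⊔ proj₁ (maxL l)
    s = setCode n l
    l≤n : All (_≤ n) l
    l≤n = All.map (λ p → NP.≤-trans p (NP.m≤n⊔m m _)) (proj₂ (maxL l))
    m≤s : m ≤ s
    m≤s = NP.≤-trans (NP.m≤m⊔n m _) (setCode-≥ n l)
    pairs∈ : ∀ x y → x ≤ m → y ≤ m → Mem (pairEntry x y (node x y)) s
    pairs∈ x y p q = Mem-setCode n l _ l≤n (∈-++⁺ˡ (∈-cartesianProductWith⁺ _ (∈-upTo⁺ (s≤s p)) (∈-upTo⁺ (s≤s q))))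
    facts∈ : ∀ {t f} → (t , f) ∈ L → Mem (factEntry t (codeFact f)) s
    facts∈ x = Mem-setCode n l _ l≤n (∈-++⁺ʳ (cartesianProductWith _ (upTo (suc m)) (upTo (suc m))) (∈-map⁺ entry x))
    sat : Saturated m s
    sat = m≤s , pairs∈
    upTo-≤ : ∀ {x k} → x ∈ upTo (suc k) → x ≤ k
    upTo-≤ {x} {k} h = NP.≤-pred (∈-upTo⁻ h)
    ≤-entry₁ : ∀ {x y z} → Mem (pairEntry x y z) s → x ≤ s × y ≤ s × z ≤ s
    ≤-entry₁ {x} {y} {z} h = NP.≤-trans (cpair-≤ˡ x _) a , NP.≤-trans (cpair-≤ˡ y z) b , NP.≤-trans (cpair-≤ʳ y z) b
      where
      a = NP.≤-trans (cpair-≤ʳ 0 _) (Mem-≤ h)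
      b = NP.≤-trans (cpair-≤ʳ x _) a
    pair-ok : ∀ x y → x ≤ m → y ≤ m → ⟦ pairB ⟧ (pairEntry x y (node x y) ∷ₛ s ∷ₛ λ _ → 0)
    pair-ok zero y p q with ≤-entry₁ {0} {y} {node 0 y} (pairs∈ 0 y p q)
    ... | a , b , c = 0 , a , y , b , node 0 y , c , refl , inj₁ (refl , trans (node-zero y) (cong (λ k → suc (y N.+ k)) (NP.+-identityʳ y)))
    pair-ok (suc x) y p q with ≤-entry₁ {suc x} {y} {node (suc x) y} (pairs∈ (suc x) y p q) | ≤-entry₁ {x} {y} {node x y} (pairs∈ x y (NP.≤-trans (NP.n≤1+n x) p) q)
    ... | a , b , c | a' , b' , c' = suc x , a , y , b , node (suc x) y , c , refl , inj₂ (x , a' , node x y , c' , refl ,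
        trans (node-suc x y) (cong (node x y N.+_) (NP.+-identityʳ _)) , _ , Mem-≤ mm , refl , mm)
      where mm = pairs∈ x y (NP.≤-trans (NP.n≤1+n x) p) q
    ≤-entry₂ : ∀ {t h} → Mem (factEntry t h) s → t ≤ s × h ≤ s
    ≤-entry₂ {t} {h} q = NP.≤-trans (NP.n≤1+n t) (NP.≤-trans (cpair-≤ˡ (suc t) h) (Mem-≤ q)) ,
                         NP.≤-trans (cpair-≤ʳ (suc t) h) (Mem-≤ q)
    fact-ok : ∀ t f → (t , f) ∈ L → ⟦ factB ⟧ (factEntry t (codeFact f) ∷ₛ s ∷ₛ λ _ → 0)
    fact-ok t f x with j x
    ... | justified {c} c∈ v refl v≤m head≤m ps = t , proj₁ (≤-entry₂ (facts∈ x)) , codeFact f , proj₂ (≤-entry₂ (facts∈ x)) , refl ,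
        exN-from v 3 (orL (map clauseB Π)) {ρ₀} (λ i → NP.≤-trans (v≤m i) m≤s) (orL-from clauseB {c} {Π} {ρ} c∈ (hd , andL-from premB {prems c} {ρ} (All.map (λ {p} → prem p) ps)))
      where
      ρ₀ ρ : ℕ → ℕ
      ρ₀ = codeFact f ∷ₛ t ∷ₛ factEntry t (codeFact f) ∷ₛ s ∷ₛ λ _ → 0
      ρ = v ++ₛ ρ₀
      w : Fin 8 → ℕ
      w = lookup v
      sat' : Saturated m (ρ 11)
      sat' = subst (Saturated m) (sym (++ₛ-skip v ρ₀ 3)) sat
      look = λ a → sym (++ₛ-lookup v ρ₀ a)
      hd : ⟦ pmatch toℕ 11 0 (atomPat (head c)) 8 ⟧ ρ
      hd = pmatch-complete toℕ (atomPat (head c)) 11 0 8 {ρ} sat' (subst (_≤ m) (bnd-ext look (atomPat (head c))) head≤m)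
             (trans (++ₛ-skip v ρ₀ 0) (trans (sym (evalPat-atom w (head c))) (evalPat-ext look (atomPat (head c)))))
      prem : ∀ p → bnd w (atomPat p) ≤ m × (∃ λ t' → t' < t × (t' , evalA w p) ∈ L) → ⟦ premB p ⟧ ρ
      prem p (b , t' , t'<t , y) =
        h' , subst (h' ≤_) (sym (++ₛ-skip v ρ₀ 3)) (proj₂ (≤-entry₂ (facts∈ y))) ,
        t' , subst (t' ≤_) (sym (++ₛ-skip v ρ₀ 3)) (proj₁ (≤-entry₂ (facts∈ y))) ,
        factEntry t' h' , subst (factEntry t' h' ≤_) (sym (++ₛ-skip v ρ₀ 3)) (Mem-≤ (facts∈ y)) , refl ,
        subst (Mem (factEntry t' h')) (sym (++ₛ-skip v ρ₀ 3)) (facts∈ y) ,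
        pmatch-complete toℕ (atomPat p) 14 3 2 {factEntry t' h' ∷ₛ t' ∷ₛ h' ∷ₛ ρ} sat'
          (subst (_≤ m) (bnd-ext look (atomPat p)) b)
          (trans (sym (evalPat-atom w p)) (evalPat-ext look (atomPat p))) ,
        lt-from {1} {12} {factEntry t' h' ∷ₛ t' ∷ₛ h' ∷ₛ ρ} (subst (t' <_) (sym (++ₛ-skip v ρ₀ 1)) t'<t)
        where h' = codeFact (evalA w p)
    isValid : Valid s
    isValid y _ h with ∈-++⁻ (cartesianProductWith _ (upTo (suc m)) (upTo (suc m))) (setCode-Mem n l y l≤n h)
    ... | inj₁ q with ∈-cartesianProductWith⁻ _ (upTo (suc m)) (upTo (suc m)) q
    ...   | a , b , a∈ , b∈ , refl = inj₁ (pair-ok a b (upTo-≤ a∈) (upTo-≤ b∈))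
    isValid y _ h | inj₂ q with ∈-map⁻ entry q
    ...   | (t , f) , x , refl = inj₂ (fact-ok t f x)

  argAtom : ℕ → Atom ℕ
  argAtom t = atm t (V 0) (V 1) (V 2) (V 3)

  opaque
    inSet : ℕ → BF
    inSet t = call valid (0 ∷ []) ∧ᵇ ∃≤ 0 (∃≤ 1 (∃≤ 2 (var 0 ≐ᵇ cpairᵗ (suc' (var 1)) (var 2) ∧ᵇ memb 0 3
                ∧ᵇ pmatch id 3 4 (atomPat (argAtom t)) 2)))

  -- The stage only bounds the code of the derivation, so what is known at one stage remains known
  -- at all later ones. The stage itself, at index 1, is not passed on.
  known : ℕ → BF
  known t = ∃≤ 0 (call (inSet t) (0 ∷ 2 ∷ 3 ∷ 4 ∷ 5 ∷ []))

  Known : ℕ → Fact → Set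
  Known b (fact t x y z w) = ⟦ known t ⟧ (b ∷ₛ x ∷ₛ y ∷ₛ z ∷ₛ w ∷ₛ λ _ → 0)

  Known-mono : ∀ {b b' f} → b ≤ b' → Known b f → Known b' f
  Known-mono p (s , q , h) = s , NP.≤-trans q p , h

  opaque
    unfolding inSet
    Known-sound : ∀ {b f} → Known b f → Drv f
    Known-sound {b} {fact t x y z w} (s , _ , val , h , _ , i , _ , e , _ , refl , m , k) with valid-facts val i h m
    ... | f , q , d = subst Drv (codeFact-inj f (fact t x y z w) (trans (sym q)
            (trans (pmatch-sound id (atomPat (argAtom t)) 3 4 2 {e ∷ₛ i ∷ₛ h ∷ₛ s ∷ₛ x ∷ₛ y ∷ₛ z ∷ₛ w ∷ₛ λ _ → 0} (valid-pairs val) k)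
              (evalPat-atom _ (argAtom t))))) d

    Known-complete : ∀ {f} → Drv f → ∃ λ b → Known b f
    Known-complete {fact t x y z w} d with timed d
    ... | m , L , i , x∈ , j = s , s , NP.≤-refl , isValid ,
        codeFact f , proj₂ (≤-entry₂ (facts∈ x∈)) , i , proj₁ (≤-entry₂ (facts∈ x∈)) , entry (i , f) , Mem-≤ (facts∈ x∈) , refl , facts∈ x∈ ,
        pmatch-complete id (atomPat (argAtom t)) 3 4 2
          {entry (i , f) ∷ₛ i ∷ₛ codeFact f ∷ₛ s ∷ₛ x ∷ₛ y ∷ₛ z ∷ₛ w ∷ₛ λ _ → 0} sat (NP.m≤n⊔m m _) (sym (evalPat-atom _ (argAtom t)))
      where
      f : Fact
      f = fact t x y z w
      m' : ℕ
      m' = m ⊔ bnd (x ∷ₛ y ∷ₛ z ∷ₛ w ∷ₛ λ _ → 0) (atomPat (argAtom t))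
      open Coding m' L (λ q → Justified-mono (NP.m≤m⊔n m _) id (j q))

-- Clauses for the syntax of arithmetic and for provability

cnum : ℕ → ℕ
cnum n = gnT (num n)

-- The number of the formula obtained from the provability predicate with
-- matrix number e by substituting the numeral of u, see gn-box.
box : ℕ → ℕ → ℕ
box e u = node 6 (node 6 (node 6 (node 6 (node 6 (node 2 (node (node 0 (node (node 0 0) (cnum u)))
            (node 2 (node (node 0 (node (node 0 1) (cnum e))) e))))))))

boxes : ℕ → ℕ → ℕ → ℕ
boxes e zero    a = a
boxes e (suc k) a = box e (boxes e k a)

v₀ v₁ v₂ v₃ v₄ v₅ v₆ v₇ : Pat (Fin 8)
v₀ = V (# 0)
v₁ = V (# 1)
v₂ = V (# 2)
v₃ = V (# 3)
v₄ = V (# 4)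
v₅ = V (# 5)
v₆ = V (# 6)
v₇ = V (# 7)

tg : ℕ → Pat (Fin 8) → Pat (Fin 8)
tg n p = pr (lit n) p

impₚ : Pat (Fin 8) → Pat (Fin 8) → Pat (Fin 8)
impₚ p q = tg 4 (pr p q)

boxₚ : Pat (Fin 8) → Pat (Fin 8) → Pat (Fin 8) → Pat (Fin 8)
boxₚ e ce cu = tg 6 (tg 6 (tg 6 (tg 6 (tg 6 (tg 2 (pr (tg 0 (pr (pr Zₚ Zₚ) cu)) (tg 2 (pr (tg 0 (pr (pr Zₚ (lit 1)) ce)) e))))))))

CNumₐ Liftₐ Thmₐ : Pat (Fin 8) → Pat (Fin 8) → Atom (Fin 8)
Evₐ Evsₐ : Pat (Fin 8) → Pat (Fin 8) → Pat (Fin 8) → Atom (Fin 8)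
Itₐ OpTₐ OpFₐ : Pat (Fin 8) → Pat (Fin 8) → Pat (Fin 8) → Pat (Fin 8) → Atom (Fin 8)
CNumₐ p q   = atm 0 p q Zₚ Zₚ
Itₐ         = atm 1
OpTₐ        = atm 2
OpFₐ        = atm 3
Liftₐ p q   = atm 4 p q Zₚ Zₚ
Evₐ p q r   = atm 5 p q r Zₚ
Evsₐ p q r  = atm 6 p q r Zₚ
Thmₐ p q    = atm 7 p q Zₚ Zₚ

-- A number is recognised as a term or a formula by the fact that its shift can be computed, so
-- well-formedness needs no clauses of its own.
Tmₐ Fmₐ : Pat (Fin 8) → Pat (Fin 8) → Atom (Fin 8)
Tmₐ t t' = OpTₐ Zₚ Zₚ t t'
Fmₐ a a' = OpFₐ Zₚ Zₚ a a'

patP : Prop 3 → Pat (Fin 8)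
patP A₀         = v₀
patP A₁         = v₁
patP A₂         = v₂
patP (¬ₚ p)     = tg 1 (patP p)
patP (p ∧ₚ q)  = tg 2 (pr (patP p) (patP q))
patP (p ∨ₚ q)  = tg 3 (pr (patP p) (patP q))
patP (p ⇒ₚ q)  = tg 4 (pr (patP p) (patP q))

-- Enough tautologies to evaluate a formula under a conjunction A₀ of literals
-- and to split a proof on the truth value of a prime formula.
tautologies : List (Prop 3)
tautologies =
    ((A₀ ⇒ₚ A₁) ⇒ₚ A₀ ⇒ₚ ¬ₚ ¬ₚ A₁)
  ∷ ((A₀ ⇒ₚ A₁) ⇒ₚ (A₀ ⇒ₚ A₂) ⇒ₚ A₀ ⇒ₚ A₁ ∧ₚ A₂)
  ∷ ((A₀ ⇒ₚ ¬ₚ A₁) ⇒ₚ A₀ ⇒ₚ ¬ₚ (A₁ ∧ₚ A₂))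
  ∷ ((A₀ ⇒ₚ ¬ₚ A₂) ⇒ₚ A₀ ⇒ₚ ¬ₚ (A₁ ∧ₚ A₂))
  ∷ ((A₀ ⇒ₚ A₁) ⇒ₚ A₀ ⇒ₚ (A₁ ∨ₚ A₂))
  ∷ ((A₀ ⇒ₚ A₂) ⇒ₚ A₀ ⇒ₚ (A₁ ∨ₚ A₂))
  ∷ ((A₀ ⇒ₚ ¬ₚ A₁) ⇒ₚ (A₀ ⇒ₚ ¬ₚ A₂) ⇒ₚ A₀ ⇒ₚ ¬ₚ (A₁ ∨ₚ A₂))
  ∷ ((A₀ ⇒ₚ ¬ₚ A₁) ⇒ₚ A₀ ⇒ₚ A₁ ⇒ₚ A₂)
  ∷ ((A₀ ⇒ₚ A₂) ⇒ₚ A₀ ⇒ₚ A₁ ⇒ₚ A₂)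
  ∷ ((A₀ ⇒ₚ A₁) ⇒ₚ (A₀ ⇒ₚ ¬ₚ A₂) ⇒ₚ A₀ ⇒ₚ ¬ₚ (A₁ ⇒ₚ A₂))
  ∷ (A₁ ∧ₚ A₀ ⇒ₚ A₁)
  ∷ ((A₀ ⇒ₚ A₁) ⇒ₚ A₂ ∧ₚ A₀ ⇒ₚ A₁)
  ∷ ((A₂ ∧ₚ A₀ ⇒ₚ A₁) ⇒ₚ (¬ₚ A₂ ∧ₚ A₀ ⇒ₚ A₁) ⇒ₚ A₀ ⇒ₚ A₁)
  ∷ []

tautologies-valid : All (λ p → T (validB 3 (boolP p))) tautologies
tautologies-valid = tt ∷ tt ∷ tt ∷ tt ∷ tt ∷ tt ∷ tt ∷ tt ∷ tt ∷ tt ∷ tt ∷ tt ∷ tt ∷ []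

tautClause : Prop 3 → Clause
tautClause p = (Fmₐ v₀ v₃ ∷ Fmₐ v₁ v₄ ∷ Fmₐ v₂ v₅ ∷ []) ⊃ Thmₐ v₆ (patP p)

binTClause binFClause quantClause : ℕ → Clause
binTClause c = (OpTₐ v₀ v₁ v₂ v₃ ∷ OpTₐ v₀ v₁ v₄ v₅ ∷ []) ⊃ OpTₐ v₀ v₁ (tg c (pr v₂ v₄)) (tg c (pr v₃ v₅))
binFClause c = (OpFₐ v₀ v₁ v₂ v₃ ∷ OpFₐ v₀ v₁ v₄ v₅ ∷ []) ⊃ OpFₐ v₀ v₁ (tg c (pr v₂ v₄)) (tg c (pr v₃ v₅))
quantClause c = (Liftₐ v₀ v₄ ∷ OpFₐ v₄ (Sₚ v₁) v₂ v₃ ∷ []) ⊃ OpFₐ v₀ v₁ (tg c v₂) (tg c v₃)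

-- OpT and OpF: substitution under k binders, in mode 0 for the shift and in
-- mode suc t for the replacement of variable k by the term with number t.
baseClauses : List Clause
baseClauses =
    ([] ⊃ CNumₐ Zₚ (tg 1 Zₚ))
  ∷ ((CNumₐ v₀ v₁ ∷ []) ⊃ CNumₐ (Sₚ v₀) (tg 2 v₁))
  ∷ ((CNumₐ v₀ v₁ ∷ CNumₐ v₂ v₃ ∷ []) ⊃ Itₐ v₀ Zₚ v₂ (boxₚ v₀ v₁ v₃))
  ∷ ((Itₐ v₀ v₄ v₅ v₂ ∷ CNumₐ v₀ v₁ ∷ CNumₐ v₂ v₃ ∷ []) ⊃ Itₐ v₀ (Sₚ v₄) v₅ (boxₚ v₀ v₁ v₃))
  ∷ ([] ⊃ OpTₐ v₀ (Sₚ (v₁ ⊕ v₂)) (tg 0 v₁) (tg 0 v₁))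
  ∷ ([] ⊃ OpTₐ Zₚ v₁ (tg 0 (v₁ ⊕ v₂)) (tg 0 (Sₚ (v₁ ⊕ v₂))))
  ∷ ([] ⊃ OpTₐ (Sₚ v₀) v₁ (tg 0 v₁) v₀)
  ∷ ([] ⊃ OpTₐ (Sₚ v₀) v₁ (tg 0 (Sₚ (v₁ ⊕ v₂))) (tg 0 (v₁ ⊕ v₂)))
  ∷ ([] ⊃ OpTₐ v₀ v₁ (tg 1 Zₚ) (tg 1 Zₚ))
  ∷ ((OpTₐ v₀ v₁ v₂ v₃ ∷ []) ⊃ OpTₐ v₀ v₁ (tg 2 v₂) (tg 2 v₃))
  ∷ binTClause 3
  ∷ binTClause 4
  ∷ ((OpTₐ v₀ v₁ v₂ v₃ ∷ OpTₐ v₀ v₁ v₄ v₅ ∷ []) ⊃ OpFₐ v₀ v₁ (tg 0 (pr v₂ v₄)) (tg 0 (pr v₃ v₅)))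
  ∷ ((OpFₐ v₀ v₁ v₂ v₃ ∷ []) ⊃ OpFₐ v₀ v₁ (tg 1 v₂) (tg 1 v₃))
  ∷ binFClause 2
  ∷ binFClause 3
  ∷ binFClause 4
  ∷ quantClause 5
  ∷ quantClause 6
  ∷ ([] ⊃ Liftₐ Zₚ Zₚ)
  ∷ ((OpTₐ Zₚ Zₚ v₀ v₁ ∷ []) ⊃ Liftₐ (Sₚ v₀) (Sₚ v₁))
  ∷ ([] ⊃ Evₐ (tg 0 Zₚ) v₀ Zₚ)
  ∷ ([] ⊃ Evₐ (tg 1 Zₚ) (pr v₀ v₁) (Sₚ v₀))
  ∷ ([] ⊃ Evₐ (tg 2 Zₚ) (pr v₀ v₁) v₀)
  ∷ ((Evₐ (tg 2 v₀) v₁ v₂ ∷ []) ⊃ Evₐ (tg 2 (Sₚ v₀)) (pr v₃ v₁) v₂)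
  ∷ ((Evsₐ v₀ v₁ v₂ ∷ Evₐ v₃ v₂ v₄ ∷ []) ⊃ Evₐ (tg 3 (pr v₃ v₀)) v₁ v₄)
  ∷ ((Evₐ v₀ v₁ v₂ ∷ []) ⊃ Evₐ (tg 4 (pr v₀ v₃)) (pr Zₚ v₁) v₂)
  ∷ ((Evₐ (tg 4 (pr v₀ v₃)) (pr v₄ v₁) v₂ ∷ Evₐ v₃ (pr v₄ (pr v₂ v₁)) v₅ ∷ []) ⊃ Evₐ (tg 4 (pr v₀ v₃)) (pr (Sₚ v₄) v₁) v₅)
  ∷ ([] ⊃ Evsₐ Zₚ v₀ Zₚ)
  ∷ ((Evₐ v₀ v₁ v₂ ∷ Evsₐ v₃ v₁ v₄ ∷ []) ⊃ Evsₐ (pr v₀ v₃) v₁ (pr v₂ v₄))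
  ∷ ((Thmₐ v₀ (impₚ v₁ v₂) ∷ Thmₐ v₀ v₁ ∷ []) ⊃ Thmₐ v₀ v₂)
  ∷ ((Thmₐ v₀ v₁ ∷ []) ⊃ Thmₐ v₀ (tg 5 v₁))
  ∷ ((Tmₐ v₁ v₂ ∷ OpFₐ (Sₚ v₁) Zₚ v₃ v₄ ∷ []) ⊃ Thmₐ v₀ (impₚ (tg 5 v₃) v₄))
  ∷ ((Fmₐ v₁ v₂ ∷ OpFₐ Zₚ Zₚ v₃ v₄ ∷ []) ⊃ Thmₐ v₀ (impₚ (tg 5 (impₚ v₄ v₁)) (impₚ v₃ (tg 5 v₁))))
  ∷ ((Tmₐ v₁ v₂ ∷ OpFₐ (Sₚ v₁) Zₚ v₃ v₄ ∷ []) ⊃ Thmₐ v₀ (impₚ v₄ (tg 6 v₃)))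
  ∷ ((Fmₐ v₁ v₂ ∷ OpFₐ Zₚ Zₚ v₃ v₄ ∷ []) ⊃ Thmₐ v₀ (impₚ (tg 5 (impₚ v₁ v₄)) (impₚ (tg 6 v₁) v₃)))
  ∷ ((Tmₐ v₁ v₂ ∷ []) ⊃ Thmₐ v₀ (tg 0 (pr v₁ v₁)))
  ∷ ((Tmₐ v₁ v₂ ∷ Tmₐ v₃ v₄ ∷ OpFₐ (Sₚ v₁) Zₚ v₅ v₆ ∷ OpFₐ (Sₚ v₃) Zₚ v₅ v₇ ∷ [])
       ⊃ Thmₐ v₀ (impₚ (tg 0 (pr v₁ v₃)) (impₚ v₆ v₇)))
  -- The axioms of T enter here, through the primitive recursive function with number v₀. It may
  -- also accept numbers that code no formula, which `Fmₐ` excludes.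
  ∷ ((Evₐ v₀ (pr v₁ Zₚ) (lit 1) ∷ Fmₐ v₁ v₂ ∷ []) ⊃ Thmₐ v₀ v₁)
  ∷ []

clauses : List Clause
clauses = baseClauses ++ map tautClause tautologies

open Derivations clauses public

data Mode : Set where
  shift : Mode
  inst  : Term → Mode

codeM : Mode → ℕ
codeM shift    = 0
codeM (inst t) = suc (gnT t)

liftM : Mode → Mode
liftM shift    = shift
liftM (inst t) = inst (shiftT t)

bump : ℕ → ℕ → ℕ
bump zero    i       = suc i
bump (suc k) zero    = zero
bump (suc k) (suc i) = suc (bump k i)

skip : ℕ → ℕ → Maybe ℕ
skip zero    zero    = nothing
skip zero    (suc i) = just i
skip (suc k) zero    = just zero
skip (suc k) (suc i) = Maybe.map suc (skip k i)

-- The k-fold lifting of a shift or of `single t`, given directly on indices in the way in which the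
-- clauses for variables compute it.
op : Mode → ℕ → ℕ → Term
op shift    k i = var (bump k i)
op (inst t) k i = maybe′ var t (skip k i)

op-lift : ∀ μ k i → liftS (op μ k) i ≡ op (liftM μ) (suc k) i
op-lift shift    k zero    = refl
op-lift shift    k (suc i) = refl
op-lift (inst t) k zero    = refl
op-lift (inst t) k (suc i) with skip k i
... | just j  = refl
... | nothing = refl

op-below : ∀ μ i j → op μ (suc (i N.+ j)) i ≡ var i
op-below shift    i j = cong var (go i)
  where
  go : ∀ i → bump (suc (i N.+ j)) i ≡ i
  go zero    = refl
  go (suc i) = cong suc (go i)
op-below (inst t) i j = cong (maybe′ var t) (go i)
  where
  go : ∀ i → skip (suc (i N.+ j)) i ≡ just i
  go zero    = refl
  go (suc i) = cong (Maybe.map suc) (go i)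

op-shift : ∀ k j → op shift k (k N.+ j) ≡ var (suc (k N.+ j))
op-shift k j = cong var (go k)
  where
  go : ∀ k → bump k (k N.+ j) ≡ suc (k N.+ j)
  go zero    = refl
  go (suc k) = cong suc (go k)

op-hit : ∀ t k → op (inst t) k k ≡ t
op-hit t k = cong (maybe′ var t) (go k)
  where
  go : ∀ k → skip k k ≡ nothing
  go zero    = refl
  go (suc k) = cong (Maybe.map suc) (go k)

op-above : ∀ t k j → op (inst t) k (suc (k N.+ j)) ≡ var (k N.+ j)
op-above t k j = cong (maybe′ var t) (go k)
  where
  go : ∀ k → skip k (suc (k N.+ j)) ≡ just (k N.+ j)
  go zero    = refl
  go (suc k) = cong (Maybe.map suc) (go k)

op-single : ∀ t i → op (inst t) 0 i ≡ single t i
op-single t zero    = refl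
op-single t (suc i) = refl

subF-inst : ∀ t φ → subF (op (inst t) 0) φ ≡ φ [ t ]
subF-inst t φ = subF-ext (op-single t) φ

subF-shift : ∀ φ → subF (op shift 0) φ ≡ shiftF φ
subF-shift φ = sym (renF-subF suc φ)

codePR : ∀ {n} → PR n → ℕ
codePRs : ∀ {n m} → Vec (PR n) m → ℕ
codePR Z           = node 0 0
codePR S           = node 1 0
codePR (P i)       = node 2 (toℕ i)
codePR (comp f gs) = node 3 (node (codePR f) (codePRs gs))
codePR (rec g h)   = node 4 (node (codePR g) (codePR h))
codePRs []       = 0
codePRs (g ∷ gs) = node (codePR g) (codePRs gs)

codeV : ∀ {n} → Vec ℕ n → ℕ
codeV []      = 0
codeV (x ∷ v) = node x (codeV v)

node≢0 : ∀ {a b} → node a b ≢ 0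
node≢0 {a} {b} e = NP.<⇒≢ (node-pos a b) (sym e)

tagPR bodyPR : ∀ {n} → PR n → ℕ
tagPR Z           = 0
tagPR S           = 1
tagPR (P i)       = 2
tagPR (comp f gs) = 3
tagPR (rec g h)   = 4
bodyPR Z           = 0
bodyPR S           = 0
bodyPR (P i)       = toℕ i
bodyPR (comp f gs) = node (codePR f) (codePRs gs)
bodyPR (rec g h)   = node (codePR g) (codePR h)

codePR-inv : ∀ k b {n} (f : PR n) → node k b ≡ codePR f → k ≡ tagPR f × b ≡ bodyPR f
codePR-inv k b f e = node-inj k (tagPR f) {b} {bodyPR f} (trans e (lem f))
  where
  lem : ∀ {n} (f : PR n) → codePR f ≡ node (tagPR f) (bodyPR f)
  lem Z           = refl
  lem S           = refl
  lem (P i)       = refl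
  lem (comp f gs) = refl
  lem (rec g h)   = refl

-- Soundness of the clauses

module Soundness (Γ : Theory) (χ : PR 1)
                 (χ-sound : ∀ φ → evalPR χ (gn φ ∷ []) ≡ 1 → Γ φ) where

  -- Facts are also derivable for modes, programs and axiom sets that code nothing. Such arguments
  -- are therefore assumed to be codes, as in `m ≡ codeM μ →`, while the term or formula operated on
  -- is asserted to exist.
  Mean : Fact → Set
  Mean (fact 0 n c _ _)  = c ≡ cnum n
  Mean (fact 1 e k a x)  = x ≡ boxes e (suc k) a
  Mean (fact 2 m k x y)  = ∃ λ s → x ≡ gnT s × (∀ μ → m ≡ codeM μ → y ≡ gnT (subT (op μ k) s))
  Mean (fact 3 m k x y)  = ∃ λ φ → x ≡ gn φ × (∀ μ → m ≡ codeM μ → y ≡ gn (subF (op μ k) φ))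
  Mean (fact 4 m m' _ _) = ∀ μ → m ≡ codeM μ → m' ≡ codeM (liftM μ)
  Mean (fact 5 e x y _)  = ∀ {n} (f : PR n) v → e ≡ codePR f → x ≡ codeV v → y ≡ evalPR f v
  Mean (fact 6 e x y _)  = ∀ {n m} (fs : Vec (PR n) m) v → e ≡ codePRs fs → x ≡ codeV v → y ≡ codeV (evalPRs fs v)
  Mean (fact 7 c x _ _)  = c ≡ codePR χ → ∃ λ φ → x ≡ gn φ × (Γ ⊢ φ)
  Mean _                 = ⊤

  SoundClause : Clause → Set
  SoundClause c = ∀ (v : Vec ℕ 8) → All (λ p → Mean (evalA (lookup v) p)) (prems c) → Mean (evalA (lookup v) (head c))

  pair-cong₂ : ∀ k {a b a' b'} → a ≡ a' → b ≡ b' → node k (node a b) ≡ node k (node a' b')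
  pair-cong₂ k refl refl = refl

  bin-T : ∀ c (_⊙_ : Term → Term → Term) → (∀ s t → gnT (s ⊙ t) ≡ node c (node (gnT s) (gnT t))) →
          (∀ σ s t → subT σ (s ⊙ t) ≡ subT σ s ⊙ subT σ t) → SoundClause (binTClause c)
  bin-T c _⊙_ h h' v@(m ∷ k ∷ a ∷ a' ∷ b ∷ b' ∷ _) ((s , refl , f) ∷ (t , refl , g) ∷ []) =
    s ⊙ t , trans (cong (λ i → node i (node a b)) (evalPat-lit (lookup v) c)) (sym (h s t)) , λ μ e →
    trans (cong (λ i → node i (node a' b')) (evalPat-lit (lookup v) c)) (trans (pair-cong₂ c {a'} {b'} (f μ e) (g μ e))
      (trans (sym (h _ _)) (cong gnT (sym (h' (op μ k) s t)))))

  bin-F : ∀ c (_⊙_ : Formula → Formula → Formula) → (∀ s t → gn (s ⊙ t) ≡ node c (node (gn s) (gn t))) →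
          (∀ σ s t → subF σ (s ⊙ t) ≡ subF σ s ⊙ subF σ t) → SoundClause (binFClause c)
  bin-F c _⊙_ h h' v@(m ∷ k ∷ a ∷ a' ∷ b ∷ b' ∷ _) ((s , refl , f) ∷ (t , refl , g) ∷ []) =
    s ⊙ t , trans (cong (λ i → node i (node a b)) (evalPat-lit (lookup v) c)) (sym (h s t)) , λ μ e →
    trans (cong (λ i → node i (node a' b')) (evalPat-lit (lookup v) c)) (trans (pair-cong₂ c {a'} {b'} (f μ e) (g μ e))
      (trans (sym (h _ _)) (cong gn (sym (h' (op μ k) s t)))))

  lifted : ∀ μ k φ → gn (subF (op (liftM μ) (suc k)) φ) ≡ gn (subF (liftS (op μ k)) φ)
  lifted μ k φ = cong gn (sym (subF-ext (op-lift μ k) φ))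

  inst-gn : ∀ t φ {y} → (∀ μ → suc (gnT t) ≡ codeM μ → y ≡ gn (subF (op μ 0) φ)) → y ≡ gn (φ [ t ])
  inst-gn t φ f = trans (f (inst t) refl) (cong gn (subF-inst t φ))

  shift-gn : ∀ φ {y} → (∀ μ → 0 ≡ codeM μ → y ≡ gn (subF (op μ 0) φ)) → y ≡ gn (shiftF φ)
  shift-gn φ f = trans (f shift refl) (cong gn (subF-shift φ))

  patP-gn : ∀ (p : Prop 3) (v : Vec ℕ 8) φ ψ ξ → lookup v (# 0) ≡ gn φ → lookup v (# 1) ≡ gn ψ → lookup v (# 2) ≡ gn ξ →
              evalPat (lookup v) (patP p) ≡ gn (instP p (φ ∷ ψ ∷ ξ ∷ []))
  patP-gn A₀        v φ ψ ξ a b c = a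
  patP-gn A₁        v φ ψ ξ a b c = b
  patP-gn A₂        v φ ψ ξ a b c = c
  patP-gn (¬ₚ p)    v φ ψ ξ a b c = cong (node 1) (patP-gn p v φ ψ ξ a b c)
  patP-gn (p ∧ₚ q) v φ ψ ξ a b c = pair-cong₂ 2 (patP-gn p v φ ψ ξ a b c) (patP-gn q v φ ψ ξ a b c)
  patP-gn (p ∨ₚ q) v φ ψ ξ a b c = pair-cong₂ 3 (patP-gn p v φ ψ ξ a b c) (patP-gn q v φ ψ ξ a b c)
  patP-gn (p ⇒ₚ q) v φ ψ ξ a b c = pair-cong₂ 4 (patP-gn p v φ ψ ξ a b c) (patP-gn q v φ ψ ξ a b c)

  tautClause-sound : ∀ {p} → T (validB 3 (boolP p)) → SoundClause (tautClause p)
  tautClause-sound {p} h v ((φ , a , _) ∷ (ψ , b , _) ∷ (ξ , c , _) ∷ []) _ =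
    instP p (φ ∷ ψ ∷ ξ ∷ []) , patP-gn p v φ ψ ξ a b c , prop p (φ ∷ ψ ∷ ξ ∷ []) {h}

  evZ : ∀ {n} (f : PR n) v → node 0 0 ≡ codePR f → 0 ≡ evalPR f v
  evZ f v e with codePR-inv 0 0 f e
  evZ Z v e | _ = refl
  evS : ∀ {n} (f : PR n) v a x → node 1 0 ≡ codePR f → node a x ≡ codeV v → suc a ≡ evalPR f v
  evS f v a x e e' with codePR-inv 1 0 f e
  evS S (b ∷ []) a x e e' | _ = cong suc (proj₁ (node-inj a b {x} {0} e'))
  evP₀ : ∀ {n} (f : PR n) v a x → node 2 0 ≡ codePR f → node a x ≡ codeV v → a ≡ evalPR f v
  evP₀ f v a x e e' with codePR-inv 2 0 f e
  evP₀ (P Fin.zero) (b ∷ v) a x e e' | _ = proj₁ (node-inj a b {x} {codeV v} e')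
  evP₁ : ∀ i x y a → (∀ {n} (f : PR n) v → node 2 i ≡ codePR f → x ≡ codeV v → y ≡ evalPR f v) →
         ∀ {n} (f : PR n) v → node 2 (suc i) ≡ codePR f → node a x ≡ codeV v → y ≡ evalPR f v
  evP₁ i x y a ih f v e e' with codePR-inv 2 (suc i) f e
  evP₁ i x y a ih (P (Fin.suc j)) (b ∷ v) e e' | _ , q =
    ih (P j) v (cong (node 2) (NP.suc-injective q)) (proj₂ (node-inj a b {x} {codeV v} e'))
  evC : ∀ gs x y g z → (∀ {n m} (fs : Vec (PR n) m) v → gs ≡ codePRs fs → x ≡ codeV v → y ≡ codeV (evalPRs fs v)) →
        (∀ {n} (f : PR n) v → g ≡ codePR f → y ≡ codeV v → z ≡ evalPR f v) →
        ∀ {n} (f : PR n) v → node 3 (node g gs) ≡ codePR f → x ≡ codeV v → z ≡ evalPR f v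
  evC gs x y g z ih ih' f v e e' with codePR-inv 3 (node g gs) f e
  evC gs x y g z ih ih' (comp f fs) v e e' | _ , q with node-inj g (codePR f) {gs} {codePRs fs} q
  ... | q₁ , q₂ = ih' f (evalPRs fs v) q₁ (ih fs v q₂ e')
  evR₀ : ∀ g x y h → (∀ {n} (f : PR n) v → g ≡ codePR f → x ≡ codeV v → y ≡ evalPR f v) →
         ∀ {n} (f : PR n) v → node 4 (node g h) ≡ codePR f → node 0 x ≡ codeV v → y ≡ evalPR f v
  evR₀ g x y h ih f v e e' with codePR-inv 4 (node g h) f e
  evR₀ g x y h ih (rec f f') (b ∷ v) e e' | _ , q with node-inj 0 b {x} {codeV v} e'
  ... | refl , r = ih f v (proj₁ (node-inj g (codePR f) {h} {codePR f'} q)) r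
  evR₁ : ∀ g x r h k y →
         (∀ {n} (f : PR n) v → node 4 (node g h) ≡ codePR f → node k x ≡ codeV v → r ≡ evalPR f v) →
         (∀ {n} (f : PR n) v → h ≡ codePR f → node k (node r x) ≡ codeV v → y ≡ evalPR f v) →
         ∀ {n} (f : PR n) v → node 4 (node g h) ≡ codePR f → node (suc k) x ≡ codeV v → y ≡ evalPR f v
  evR₁ g x r h k y ih ih' f v e e' with codePR-inv 4 (node g h) f e
  evR₁ g x r h k y ih ih' (rec f f') (b ∷ v) e e' | _ , q with node-inj (suc k) b {x} {codeV v} e'
  ... | refl , s = ih' f' (k ∷ evalPR (rec f f') (k ∷ v) ∷ v) (proj₂ (node-inj g (codePR f) {h} {codePR f'} q))
    (cong (node k) (trans (cong (λ z → node z x) (ih (rec f f') (k ∷ v) e (cong (node k) s))) (cong (node (evalPR (rec f f') (k ∷ v))) s)))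
  evs : ∀ g x y gs ys → (∀ {n} (f : PR n) v → g ≡ codePR f → x ≡ codeV v → y ≡ evalPR f v) →
        (∀ {n m} (fs : Vec (PR n) m) v → gs ≡ codePRs fs → x ≡ codeV v → ys ≡ codeV (evalPRs fs v)) →
        ∀ {n m} (fs : Vec (PR n) m) v → node g gs ≡ codePRs fs → x ≡ codeV v → node y ys ≡ codeV (evalPRs fs v)
  evs g x y gs ys ih ih' []       v e e' = ⊥-elim (node≢0 {g} {gs} e)
  evs g x y gs ys ih ih' (f ∷ fs) v e e' with node-inj g (codePR f) {gs} {codePRs fs} e
  ... | q₁ , q₂ = cong₂ node (ih f v q₁ e') (ih' fs v q₂ e')
  mpS : ∀ a b → (∃ λ φ → node 4 (node a b) ≡ gn φ × (Γ ⊢ φ)) → (∃ λ φ → a ≡ gn φ × (Γ ⊢ φ)) → ∃ λ φ → b ≡ gn φ × (Γ ⊢ φ)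
  mpS a b (χ , e , d) (φ , e' , d') with view-⇒ χ {a} {b} e
  ... | φ' , ψ , refl , p , q = ψ , q , mp d (subst (Γ ⊢_) (gn-inj φ φ' (trans (sym e') p)) d')
  genS : ∀ a → (∃ λ φ → a ≡ gn φ × (Γ ⊢ φ)) → ∃ λ φ → node 5 a ≡ gn φ × (Γ ⊢ φ)
  genS a (φ , refl , d) = ∀' φ , refl , gen d

  baseClauses-sound : All SoundClause baseClauses
  baseClauses-sound =
      (λ v _ → refl)
    ∷ (λ { (n ∷ c ∷ _) (refl ∷ []) → refl })
    ∷ (λ { (e ∷ ce ∷ u ∷ cu ∷ _) (refl ∷ refl ∷ []) → refl })
    ∷ (λ { (e ∷ ce ∷ u ∷ cu ∷ k ∷ a ∷ _) (refl ∷ refl ∷ refl ∷ []) → refl })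
    ∷ (λ { (m ∷ i ∷ j ∷ _) _ → var i , refl , λ μ _ → cong gnT (sym (op-below μ i j)) })
    ∷ (λ { (_ ∷ k ∷ j ∷ _) _ → var (k N.+ j) , refl , λ { shift _ → cong gnT (sym (op-shift k j)) } })
    ∷ (λ { (t ∷ k ∷ _) _ → var k , refl , λ { (inst r) e → trans (NP.suc-injective e) (cong gnT (sym (op-hit r k))) } })
    ∷ (λ { (t ∷ k ∷ j ∷ _) _ → var (suc (k N.+ j)) , refl , λ { (inst r) e → cong gnT (sym (op-above r k j)) } })
    ∷ (λ { (m ∷ k ∷ _) _ → zer , refl , λ μ _ → refl })
    ∷ (λ { (m ∷ k ∷ a ∷ b ∷ _) ((s , refl , f) ∷ []) → suc' s , refl , λ μ e → cong (node 2) (f μ e) })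
    ∷ bin-T 3 _+'_ (λ _ _ → refl) (λ _ _ _ → refl)
    ∷ bin-T 4 _*'_ (λ _ _ → refl) (λ _ _ _ → refl)
    ∷ (λ { (m ∷ k ∷ a ∷ a' ∷ b ∷ b' ∷ _) ((s , refl , f) ∷ (t , refl , g) ∷ []) →
           (s ≐ t) , refl , λ μ e → pair-cong₂ 0 (f μ e) (g μ e) })
    ∷ (λ { (m ∷ k ∷ a ∷ b ∷ _) ((φ , refl , f) ∷ []) → ¬' φ , refl , λ μ e → cong (node 1) (f μ e) })
    ∷ bin-F 2 _∧'_ (λ _ _ → refl) (λ _ _ _ → refl)
    ∷ bin-F 3 _∨'_ (λ _ _ → refl) (λ _ _ _ → refl)
    ∷ bin-F 4 _⇒_ (λ _ _ → refl) (λ _ _ _ → refl)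
    ∷ (λ { (m ∷ k ∷ a ∷ b ∷ m' ∷ _) (l ∷ (φ , refl , f) ∷ []) →
           ∀' φ , refl , λ μ e → cong (node 5) (trans (f (liftM μ) (l μ e)) (lifted μ k φ)) })
    ∷ (λ { (m ∷ k ∷ a ∷ b ∷ m' ∷ _) (l ∷ (φ , refl , f) ∷ []) →
           ∃' φ , refl , λ μ e → cong (node 6) (trans (f (liftM μ) (l μ e)) (lifted μ k φ)) })
    ∷ (λ { _ _ shift e → refl })
    ∷ (λ { (t ∷ t' ∷ _) ((s , refl , f) ∷ []) (inst r) e → cong suc (trans (f shift refl)
           (cong gnT (trans (cong (subT (op shift 0)) (gnT-inj s r (NP.suc-injective e))) (sym (renT-subT suc r))))) })
    ∷ (λ { _ _ f v e _ → evZ f v e })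
    ∷ (λ { (a ∷ x ∷ _) _ f v e e' → evS f v a x e e' })
    ∷ (λ { (a ∷ x ∷ _) _ f v e e' → evP₀ f v a x e e' })
    ∷ (λ { (i ∷ x ∷ y ∷ a ∷ _) (ih ∷ []) f v e e' → evP₁ i x y a ih f v e e' })
    ∷ (λ { (gs ∷ x ∷ y ∷ g ∷ z ∷ _) (ih ∷ ih' ∷ []) f v e e' → evC gs x y g z ih ih' f v e e' })
    ∷ (λ { (g ∷ x ∷ y ∷ h ∷ _) (ih ∷ []) f v e e' → evR₀ g x y h ih f v e e' })
    ∷ (λ { (g ∷ x ∷ r ∷ h ∷ k ∷ y ∷ _) (ih ∷ ih' ∷ []) f v e e' → evR₁ g x r h k y ih ih' f v e e' })
    ∷ (λ { _ _ [] v e e' → refl ; _ _ (g ∷ gs) v e e' → ⊥-elim (node≢0 {codePR g} {codePRs gs} (sym e)) })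
    ∷ (λ { (g ∷ x ∷ y ∷ gs ∷ ys ∷ _) (ih ∷ ih' ∷ []) fs v e e' → evs g x y gs ys ih ih' fs v e e' })
    ∷ (λ { (c ∷ a ∷ b ∷ _) (d ∷ d' ∷ []) q → mpS a b (d q) (d' q) })
    ∷ (λ { (c ∷ a ∷ _) (d ∷ []) q → genS a (d q) })
    ∷ (λ { (c ∷ t ∷ t' ∷ a ∷ b ∷ _) ((s , refl , _) ∷ (φ , refl , f) ∷ []) _ →
           (∀' φ ⇒ φ [ s ]) , pair-cong₂ 4 refl (inst-gn s φ f) , ∀-inst φ s })
    ∷ (λ { (c ∷ a ∷ _ ∷ b ∷ b' ∷ _) ((φ , refl , _) ∷ (ψ , refl , f) ∷ []) _ →
           (∀' (shiftF ψ ⇒ φ) ⇒ (ψ ⇒ ∀' φ)) ,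
           pair-cong₂ 4 (cong (node 5) (pair-cong₂ 4 (shift-gn ψ f) refl)) refl , ∀-dist φ ψ })
    ∷ (λ { (c ∷ t ∷ t' ∷ a ∷ b ∷ _) ((s , refl , _) ∷ (φ , refl , f) ∷ []) _ →
           (φ [ s ] ⇒ ∃' φ) , pair-cong₂ 4 (inst-gn s φ f) refl , ∃-intr φ s })
    ∷ (λ { (c ∷ a ∷ _ ∷ b ∷ b' ∷ _) ((φ , refl , _) ∷ (ψ , refl , f) ∷ []) _ →
           (∀' (φ ⇒ shiftF ψ) ⇒ (∃' φ ⇒ ψ)) ,
           pair-cong₂ 4 (cong (node 5) (pair-cong₂ 4 refl (shift-gn ψ f))) refl , ∃-elim φ ψ })
    ∷ (λ { (c ∷ t ∷ _) ((s , refl , _) ∷ []) _ → (s ≐ s) , refl , eq-refl s })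
    ∷ (λ { (c ∷ s ∷ _ ∷ t ∷ _ ∷ a ∷ b ∷ b' ∷ []) ((s' , refl , _) ∷ (t' , refl , _) ∷ (φ , refl , f) ∷ (φ' , e , g) ∷ []) _ →
           (s' ≐ t' ⇒ (φ [ s' ] ⇒ φ [ t' ])) ,
           pair-cong₂ 4 refl (pair-cong₂ 4 (inst-gn s' φ f)
             (trans (inst-gn t' φ' g) (cong (λ ψ → gn (ψ [ t' ])) (sym (gn-inj φ φ' e))))) , eq-subst φ s' t' })
    ∷ (λ { (c ∷ a ∷ _) (ev ∷ (φ , refl , _) ∷ []) q → φ , refl , ax (χ-sound φ (sym (ev χ (gn φ ∷ []) q refl))) })
    ∷ []

  clauses-sound : ∀ {c} → c ∈ clauses → SoundClause c
  clauses-sound = All.lookup {P = SoundClause} (AllP.++⁺ {P = SoundClause} {xs = baseClauses} baseClauses-sound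
    (AllP.map⁺ {P = SoundClause} {f = tautClause} (All.map (λ {p} → tautClause-sound {p}) tautologies-valid)))

  Drv-sound  : ∀ {f} → Drv f → Mean f
  Drvs-sound : ∀ {v : Vec ℕ 8} {ps} → All (λ p → Drv (evalA (lookup v) p)) ps → All (λ p → Mean (evalA (lookup v) p)) ps
  Drv-sound (step c∈ v ds) = clauses-sound c∈ v (Drvs-sound {v} ds)
  Drvs-sound []       = []
  Drvs-sound {v} (d ∷ ds) = Drv-sound d ∷ Drvs-sound {v} ds

-- Derivability of the intended facts

rule : ∀ i v → All (λ p → Drv (evalA (lookup v) p)) (prems (List.lookup clauses i)) →
       Drv (evalA (lookup v) (head (List.lookup clauses i)))
rule i v ds = step (∈-lookup {xs = clauses} i) v ds

env₁ : ℕ → Vec ℕ 8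
env₁ a = a ∷ 0 ∷ 0 ∷ 0 ∷ 0 ∷ 0 ∷ 0 ∷ 0 ∷ []
env₃ : ℕ → ℕ → ℕ → Vec ℕ 8
env₃ a b c = a ∷ b ∷ c ∷ 0 ∷ 0 ∷ 0 ∷ 0 ∷ 0 ∷ []
env₅ : ℕ → ℕ → ℕ → ℕ → ℕ → Vec ℕ 8
env₅ a b c d e = a ∷ b ∷ c ∷ d ∷ e ∷ 0 ∷ 0 ∷ 0 ∷ []
env₆ : ℕ → ℕ → ℕ → ℕ → ℕ → ℕ → Vec ℕ 8
env₆ a b c d e f = a ∷ b ∷ c ∷ d ∷ e ∷ f ∷ 0 ∷ 0 ∷ []

derive-CNum : ∀ n → Drv (fact 0 n (cnum n) 0 0)
derive-CNum zero    = rule (# 0) (env₁ 0) []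
derive-CNum (suc n) = rule (# 1) (env₃ n (cnum n) 0) (derive-CNum n ∷ [])

derive-It : ∀ e k a → Drv (fact 1 e k a (boxes e (suc k) a))
derive-It e zero    a = rule (# 2) (env₅ e (cnum e) a (cnum a) 0) (derive-CNum e ∷ derive-CNum a ∷ [])
derive-It e (suc k) a = rule (# 3) (env₆ e (cnum e) (boxes e (suc k) a) (cnum (boxes e (suc k) a)) k a)
  (derive-It e k a ∷ derive-CNum e ∷ derive-CNum (boxes e (suc k) a) ∷ [])

derive-OpT : ∀ μ k s → Drv (fact 2 (codeM μ) k (gnT s) (gnT (subT (op μ k) s)))
derive-OpT μ k zer      = rule (# 8) (env₃ (codeM μ) k 0) []
derive-OpT μ k (suc' s) = rule (# 9) (env₅ (codeM μ) k (gnT s) (gnT (subT (op μ k) s)) 0) (derive-OpT μ k s ∷ [])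
derive-OpT μ k (s +' t) = rule (# 10) (env₆ (codeM μ) k (gnT s) (gnT (subT (op μ k) s)) (gnT t) (gnT (subT (op μ k) t)))
  (derive-OpT μ k s ∷ derive-OpT μ k t ∷ [])
derive-OpT μ k (s *' t) = rule (# 11) (env₆ (codeM μ) k (gnT s) (gnT (subT (op μ k) s)) (gnT t) (gnT (subT (op μ k) t)))
  (derive-OpT μ k s ∷ derive-OpT μ k t ∷ [])
derive-OpT μ k (var i) with compare i k
derive-OpT μ _ (var i) | less i j = subst (λ t → Drv (fact 2 (codeM μ) (suc (i N.+ j)) (node 0 i) (gnT t)))
  (sym (op-below μ i j)) (rule (# 4) (env₃ (codeM μ) i j) [])
derive-OpT (inst r) k (var _) | equal _ = subst (λ t → Drv (fact 2 (suc (gnT r)) k (node 0 k) (gnT t)))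
  (sym (op-hit r k)) (rule (# 6) (env₃ (gnT r) k 0) [])
derive-OpT (inst r) k (var _) | greater _ j = subst (λ t → Drv (fact 2 (suc (gnT r)) k (node 0 (suc (k N.+ j))) (gnT t)))
  (sym (op-above r k j)) (rule (# 7) (env₃ (gnT r) k j) [])
-- The shift has one clause for all indices k + j; equality is the case j = 0.
derive-OpT shift k (var _) | equal _ =
  subst (λ i → Drv (fact 2 0 k (node 0 i) (gnT (op shift k i)))) (NP.+-identityʳ k)
    (subst (λ t → Drv (fact 2 0 k (node 0 (k N.+ 0)) (gnT t))) (sym (op-shift k 0)) (rule (# 5) (env₃ 0 k 0) []))
derive-OpT shift k (var _) | greater _ j =
  subst (λ i → Drv (fact 2 0 k (node 0 i) (gnT (op shift k i)))) (NP.+-suc k j)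
    (subst (λ t → Drv (fact 2 0 k (node 0 (k N.+ suc j)) (gnT t))) (sym (op-shift k (suc j))) (rule (# 5) (env₃ 0 k (suc j)) []))

derive-Lift : ∀ μ → Drv (fact 4 (codeM μ) (codeM (liftM μ)) 0 0)
derive-Lift shift    = rule (# 19) (env₁ 0) []
derive-Lift (inst t) = subst (λ s → Drv (fact 4 (suc (gnT t)) (suc (gnT s)) 0 0)) (sym (renT-subT suc t))
  (rule (# 20) (env₃ (gnT t) (gnT (subT (op shift 0) t)) 0) (derive-OpT shift 0 t ∷ []))

derive-OpF : ∀ μ k φ → Drv (fact 3 (codeM μ) k (gn φ) (gn (subF (op μ k) φ)))
derive-OpF μ k (s ≐ t)  = rule (# 12) (env₆ (codeM μ) k (gnT s) (gnT (subT (op μ k) s)) (gnT t) (gnT (subT (op μ k) t)))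
  (derive-OpT μ k s ∷ derive-OpT μ k t ∷ [])
derive-OpF μ k (¬' φ)   = rule (# 13) (env₅ (codeM μ) k (gn φ) (gn (subF (op μ k) φ)) 0) (derive-OpF μ k φ ∷ [])
derive-OpF μ k (φ ∧' ψ) = rule (# 14) (env₆ (codeM μ) k (gn φ) (gn (subF (op μ k) φ)) (gn ψ) (gn (subF (op μ k) ψ)))
  (derive-OpF μ k φ ∷ derive-OpF μ k ψ ∷ [])
derive-OpF μ k (φ ∨' ψ) = rule (# 15) (env₆ (codeM μ) k (gn φ) (gn (subF (op μ k) φ)) (gn ψ) (gn (subF (op μ k) ψ)))
  (derive-OpF μ k φ ∷ derive-OpF μ k ψ ∷ [])
derive-OpF μ k (φ ⇒ ψ)  = rule (# 16) (env₆ (codeM μ) k (gn φ) (gn (subF (op μ k) φ)) (gn ψ) (gn (subF (op μ k) ψ)))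
  (derive-OpF μ k φ ∷ derive-OpF μ k ψ ∷ [])
derive-OpF μ k (∀' φ)   = rule (# 17) (env₅ (codeM μ) k (gn φ) (gn (subF (liftS (op μ k)) φ)) (codeM (liftM μ)))
  (derive-Lift μ ∷ subst (λ ψ → Drv (fact 3 (codeM (liftM μ)) (suc k) (gn φ) (gn ψ))) (sym (subF-ext (op-lift μ k) φ))
    (derive-OpF (liftM μ) (suc k) φ) ∷ [])
derive-OpF μ k (∃' φ)   = rule (# 18) (env₅ (codeM μ) k (gn φ) (gn (subF (liftS (op μ k)) φ)) (codeM (liftM μ)))
  (derive-Lift μ ∷ subst (λ ψ → Drv (fact 3 (codeM (liftM μ)) (suc k) (gn φ) (gn ψ))) (sym (subF-ext (op-lift μ k) φ))
    (derive-OpF (liftM μ) (suc k) φ) ∷ [])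

derive-Fm : ∀ φ → Drv (fact 3 0 0 (gn φ) (gn (shiftF φ)))
derive-Fm φ = subst (λ ψ → Drv (fact 3 0 0 (gn φ) (gn ψ))) (subF-shift φ) (derive-OpF shift 0 φ)

derive-inst : ∀ t φ → Drv (fact 3 (suc (gnT t)) 0 (gn φ) (gn (φ [ t ])))
derive-inst t φ = subst (λ ψ → Drv (fact 3 (suc (gnT t)) 0 (gn φ) (gn ψ))) (subF-inst t φ) (derive-OpF (inst t) 0 φ)

derive-Ev  : ∀ {n} (f : PR n) v → Drv (fact 5 (codePR f) (codeV v) (evalPR f v) 0)
derive-Evs : ∀ {n m} (fs : Vec (PR n) m) v → Drv (fact 6 (codePRs fs) (codeV v) (codeV (evalPRs fs v)) 0)
derive-Ev Z v           = rule (# 21) (env₁ (codeV v)) []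
derive-Ev S (a ∷ [])    = rule (# 22) (env₃ a 0 0) []
derive-Ev (P Fin.zero)    (a ∷ v) = rule (# 23) (env₃ a (codeV v) 0) []
derive-Ev (P (Fin.suc i)) (a ∷ v) = rule (# 24) (env₅ (toℕ i) (codeV v) (lookup v i) a 0) (derive-Ev (P i) v ∷ [])
derive-Ev (comp f gs) v = rule (# 25) (env₅ (codePRs gs) (codeV v) (codeV (evalPRs gs v)) (codePR f) (evalPR f (evalPRs gs v)))
  (derive-Evs gs v ∷ derive-Ev f (evalPRs gs v) ∷ [])
derive-Ev (rec g h) (zero ∷ v)  = rule (# 26) (env₅ (codePR g) (codeV v) (evalPR g v) (codePR h) 0) (derive-Ev g v ∷ [])
derive-Ev (rec g h) (suc k ∷ v) = rule (# 27)
  (env₆ (codePR g) (codeV v) (evalPR (rec g h) (k ∷ v)) (codePR h) k (evalPR h (k ∷ evalPR (rec g h) (k ∷ v) ∷ v)))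
  (derive-Ev (rec g h) (k ∷ v) ∷ derive-Ev h (k ∷ evalPR (rec g h) (k ∷ v) ∷ v) ∷ [])
derive-Evs []       v = rule (# 28) (env₁ (codeV v)) []
derive-Evs (g ∷ gs) v = rule (# 29) (env₅ (codePR g) (codeV v) (evalPR g v) (codePRs gs) (codeV (evalPRs gs v)))
  (derive-Ev g v ∷ derive-Evs gs v ∷ [])

-- Completeness of the clauses for provability

module Completeness (Γ : Theory) (χ : PR 1)
                    (χ-complete : ∀ φ → Γ φ → evalPR χ (gn φ ∷ []) ≡ 1) where

  c : ℕ
  c = codePR χ

  record Th (φ : Formula) : Set where
    constructor th
    field drv : Drv (fact 7 c (gn φ) 0 0)
  open Th public

  Th-mp : ∀ {φ ψ} → Th (φ ⇒ ψ) → Th φ → Th ψ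
  Th-mp {φ} {ψ} (th d) (th e) = th (rule (# 30) (env₃ c (gn φ) (gn ψ)) (d ∷ e ∷ []))

  patP-gn : ∀ (p : Prop 3) φ ψ ξ v₃ v₄ v₅ → evalPat (lookup (gn φ ∷ gn ψ ∷ gn ξ ∷ v₃ ∷ v₄ ∷ v₅ ∷ c ∷ 0 ∷ [])) (patP p) ≡ gn (instP p (φ ∷ ψ ∷ ξ ∷ []))
  patP-gn A₀        φ ψ ξ x y z = refl
  patP-gn A₁        φ ψ ξ x y z = refl
  patP-gn A₂        φ ψ ξ x y z = refl
  patP-gn (¬ₚ p)    φ ψ ξ x y z = cong (node 1) (patP-gn p φ ψ ξ x y z)
  patP-gn (p ∧ₚ q) φ ψ ξ x y z = cong₂ (λ a b → node 2 (node a b)) (patP-gn p φ ψ ξ x y z) (patP-gn q φ ψ ξ x y z)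
  patP-gn (p ∨ₚ q) φ ψ ξ x y z = cong₂ (λ a b → node 3 (node a b)) (patP-gn p φ ψ ξ x y z) (patP-gn q φ ψ ξ x y z)
  patP-gn (p ⇒ₚ q) φ ψ ξ x y z = cong₂ (λ a b → node 4 (node a b)) (patP-gn p φ ψ ξ x y z) (patP-gn q φ ψ ξ x y z)

  Th-taut : ∀ (i : Fin 13) φ ψ ξ → Th (instP (List.lookup tautologies i) (φ ∷ ψ ∷ ξ ∷ []))
  Th-taut i φ ψ ξ = th (subst (λ x → Drv (fact 7 c x 0 0)) (patP-gn (List.lookup tautologies i) φ ψ ξ (gn (shiftF φ)) (gn (shiftF ψ)) (gn (shiftF ξ)))
    (step {tautClause (List.lookup tautologies i)} (∈-++⁺ʳ baseClauses (∈-map⁺ tautClause (∈-lookup {xs = tautologies} i)))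
      (gn φ ∷ gn ψ ∷ gn ξ ∷ gn (shiftF φ) ∷ gn (shiftF ψ) ∷ gn (shiftF ξ) ∷ c ∷ 0 ∷ [])
      (derive-Fm φ ∷ derive-Fm ψ ∷ derive-Fm ξ ∷ [])))

  literal : Bool → Formula → Formula
  literal b φ = if b then φ else ¬' φ

  Primes : (Formula → Set) → Formula → Set
  Primes Q (¬' φ)   = Primes Q φ
  Primes Q (φ ∧' ψ) = Primes Q φ × Primes Q ψ
  Primes Q (φ ∨' ψ) = Primes Q φ × Primes Q ψ
  Primes Q (φ ⇒ ψ)  = Primes Q φ × Primes Q ψ
  Primes Q φ        = Q φ

  Primes-map : ∀ {Q R} → (∀ φ → Q φ → R φ) → ∀ φ → Primes Q φ → Primes R φ
  Primes-map h (s ≐ t)  q = h _ q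
  Primes-map h (∀' φ)   q = h _ q
  Primes-map h (∃' φ)   q = h _ q
  Primes-map h (¬' φ)   q = Primes-map h φ q
  Primes-map h (φ ∧' ψ) (q , r) = Primes-map h φ q , Primes-map h ψ r
  Primes-map h (φ ∨' ψ) (q , r) = Primes-map h φ q , Primes-map h ψ r
  Primes-map h (φ ⇒ ψ)  (q , r) = Primes-map h φ q , Primes-map h ψ r

  Decided : Formula → (Formula → Bool) → Formula → Set
  Decided γ ν φ = Th (γ ⇒ literal (ν φ) φ)

  -- Kalmár's lemma. The tautologies with indices 0 to 9 are one per connective and combination of
  -- values that matters.
  evaluate : ∀ γ ν φ → Primes (Decided γ ν) φ → Th (γ ⇒ literal (evalP ν φ) φ)
  evaluate γ ν (s ≐ t)  q = q
  evaluate γ ν (∀' φ)   q = q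
  evaluate γ ν (∃' φ)   q = q
  evaluate γ ν (¬' φ)   q with evalP ν φ | evaluate γ ν φ q
  ... | true  | d = Th-mp (Th-taut (# 0) γ φ φ) d
  ... | false | d = d
  evaluate γ ν (φ ∧' ψ) (q , r) with evalP ν φ | evaluate γ ν φ q | evalP ν ψ | evaluate γ ν ψ r
  ... | true  | d | true  | e = Th-mp (Th-mp (Th-taut (# 1) γ φ ψ) d) e
  ... | true  | d | false | e = Th-mp (Th-taut (# 3) γ φ ψ) e
  ... | false | d | _     | _ = Th-mp (Th-taut (# 2) γ φ ψ) d
  evaluate γ ν (φ ∨' ψ) (q , r) with evalP ν φ | evaluate γ ν φ q | evalP ν ψ | evaluate γ ν ψ r
  ... | true  | d | _     | _ = Th-mp (Th-taut (# 4) γ φ ψ) d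
  ... | false | d | true  | e = Th-mp (Th-taut (# 5) γ φ ψ) e
  ... | false | d | false | e = Th-mp (Th-mp (Th-taut (# 6) γ φ ψ) d) e
  evaluate γ ν (φ ⇒ ψ) (q , r) with evalP ν φ | evaluate γ ν φ q | evalP ν ψ | evaluate γ ν ψ r
  ... | true  | d | true  | e = Th-mp (Th-taut (# 8) γ φ ψ) e
  ... | true  | d | false | e = Th-mp (Th-mp (Th-taut (# 9) γ φ ψ) d) e
  ... | false | d | _     | _ = Th-mp (Th-taut (# 7) γ φ ψ) d

  gnV : (ℕ → Bool) → Formula → Bool
  gnV v φ = v (gn φ)

  module _ (φ : Formula) (φ-taut : Tautology φ) where
    Pending : List Formula → Formula → (Formula → Bool) → Set
    Pending qs γ ν = Primes (λ q → q ∈ qs ⊎ Decided γ ν q) φ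

    assume : ∀ q b qs γ v → Pending (q ∷ qs) γ (gnV v) → Pending qs (literal b q ∧' γ) (gnV (update v (gn q) b))
    assume q b qs γ v = Primes-map go φ
      where
      go : ∀ r → r ∈ q ∷ qs ⊎ Decided γ (gnV v) r → r ∈ qs ⊎ Decided (literal b q ∧' γ) (gnV (update v (gn q) b)) r
      go r (inj₁ (there m)) = inj₁ m
      go r (inj₁ (here refl)) with gn r NP.≟ gn r
      ... | yes _ = inj₂ (Th-taut (# 10) γ (literal b q) q)
      ... | no ¬e = ⊥-elim (¬e refl)
      go r (inj₂ d) with gn r NP.≟ gn q
      ... | no _  = inj₂ (Th-mp (Th-taut (# 11) γ (literal (v (gn r)) r) (literal b q)) d)
      ... | yes e with gn-inj r q e
      ...   | refl = inj₂ (Th-taut (# 10) γ (literal b q) q)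

    -- When no prime part is pending any more, the value of φ is known, and it is true since φ is a
    -- tautology. The tautology with index 12 merges the two branches.
    split : ∀ qs γ v → Pending qs γ (gnV v) → Th (γ ⇒ φ)
    split [] γ v p = subst (λ b → Th (γ ⇒ literal b φ)) (φ-taut (gnV v))
      (evaluate γ (gnV v) φ (Primes-map (λ { _ (inj₁ ()) ; _ (inj₂ d) → d }) φ p))
    split (q ∷ qs) γ v p = Th-mp (Th-mp (Th-taut (# 12) γ φ q)
      (split qs (q ∧' γ) (update v (gn q) true) (assume q true qs γ v p)))
      (split qs (¬' q ∧' γ) (update v (gn q) false) (assume q false qs γ v p))

    primes : Formula → List Formula
    primes (¬' φ)   = primes φ
    primes (φ ∧' ψ) = primes φ ++ primes ψ
    primes (φ ∨' ψ) = primes φ ++ primes ψ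
    primes (φ ⇒ ψ)  = primes φ ++ primes ψ
    primes φ        = φ ∷ []

    primes-all : ∀ φ → Primes (_∈ primes φ) φ
    primes-all (s ≐ t)  = here refl
    primes-all (∀' φ)   = here refl
    primes-all (∃' φ)   = here refl
    primes-all (¬' φ)   = primes-all φ
    primes-all (φ ∧' ψ) = Primes-map (λ _ → ∈-++⁺ˡ) φ (primes-all φ) , Primes-map (λ _ → ∈-++⁺ʳ (primes φ)) ψ (primes-all ψ)
    primes-all (φ ∨' ψ) = Primes-map (λ _ → ∈-++⁺ˡ) φ (primes-all φ) , Primes-map (λ _ → ∈-++⁺ʳ (primes φ)) ψ (primes-all ψ)
    primes-all (φ ⇒ ψ)  = Primes-map (λ _ → ∈-++⁺ˡ) φ (primes-all φ) , Primes-map (λ _ → ∈-++⁺ʳ (primes φ)) ψ (primes-all ψ)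

    Th-tautology : Th φ
    -- The empty conjunction of hypotheses is represented by 0 = 0, which is discharged by
    -- reflexivity.
    Th-tautology = Th-mp (split (primes φ) (zer ≐ zer) (λ _ → false) (Primes-map (λ _ → inj₁) φ (primes-all φ)))
      (th (rule (# 36) (env₃ c (gnT zer) (gnT zer)) (derive-OpT shift 0 zer ∷ [])))

  derive-Tm : ∀ t → Drv (fact 2 0 0 (gnT t) (gnT (subT (op shift 0) t)))
  derive-Tm t = derive-OpT shift 0 t

  complete : ∀ {φ} → Γ ⊢ φ → Th φ
  complete (ax {φ} a)   = th (rule (# 38) (env₃ c (gn φ) (gn (shiftF φ)))
    (subst (λ y → Drv (fact 5 c (node (gn φ) 0) y 0)) (χ-complete φ a) (derive-Ev χ (gn φ ∷ [])) ∷ derive-Fm φ ∷ []))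
  complete (taut {φ} t) = Th-tautology φ t
  complete (mp d e)     = Th-mp (complete d) (complete e)
  complete (gen {φ} d)  = th (rule (# 31) (env₃ c (gn φ) 0) (drv (complete d) ∷ []))
  complete (∀-inst φ t) = th (rule (# 32) (env₅ c (gnT t) (gnT (subT (op shift 0) t)) (gn φ) (gn (φ [ t ]))) (derive-Tm t ∷ derive-inst t φ ∷ []))
  complete (∀-dist φ ψ) = th (rule (# 33) (env₅ c (gn φ) (gn (shiftF φ)) (gn ψ) (gn (shiftF ψ))) (derive-Fm φ ∷ derive-Fm ψ ∷ []))
  complete (∃-intr φ t) = th (rule (# 34) (env₅ c (gnT t) (gnT (subT (op shift 0) t)) (gn φ) (gn (φ [ t ]))) (derive-Tm t ∷ derive-inst t φ ∷ []))
  complete (∃-elim φ ψ) = th (rule (# 35) (env₅ c (gn φ) (gn (shiftF φ)) (gn ψ) (gn (shiftF ψ))) (derive-Fm φ ∷ derive-Fm ψ ∷ []))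
  complete (eq-refl t)  = th (rule (# 36) (env₃ c (gnT t) (gnT (subT (op shift 0) t))) (derive-Tm t ∷ []))
  complete (eq-subst φ s t) = th (rule (# 37)
    (c ∷ gnT s ∷ gnT (subT (op shift 0) s) ∷ gnT t ∷ gnT (subT (op shift 0) t) ∷ gn φ ∷ gn (φ [ s ]) ∷ gn (φ [ t ]) ∷ [])
    (derive-Tm s ∷ derive-Tm t ∷ derive-inst s φ ∷ derive-inst t φ ∷ []))

-- The provability predicate as a bounded formula

ngn : ℕ → ℕ
ngn x = node 1 x

-- The name of the world 2s. It has the shape of an equation whose left side has number 0, and no
-- term has that number. The even inner part keeps names apart from the numbers `varCode`, which use
-- odd ones.
junk : ℕ → ℕ
junk s = node 0 (node 0 (s N.+ s))

-- For a fixed first component `node` is linear in the second, so negations and names are computed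
-- by terms and need no set of pairs.
oddᵗ negᵗ junkᵗ : Term → Term
oddᵗ t  = suc' (t +' t)
negᵗ t  = oddᵗ t +' oddᵗ t
junkᵗ t = oddᵗ (oddᵗ (t +' t))

node-0 : ∀ b → node 0 b ≡ suc (b N.+ b)
node-0 b = trans (node-zero b) (cong (λ k → suc (b N.+ k)) (NP.+-identityʳ b))

neg-eval : ∀ x → suc (x N.+ x) N.+ suc (x N.+ x) ≡ ngn x
neg-eval x = sym (trans (node-suc 0 x) (trans (cong (node 0 x N.+_) (NP.+-identityʳ (node 0 x))) (cong₂ N._+_ (node-0 x) (node-0 x))))

junk-eval : ∀ s → suc (suc ((s N.+ s) N.+ (s N.+ s)) N.+ suc ((s N.+ s) N.+ (s N.+ s))) ≡ junk s
junk-eval s = sym (trans (node-0 (node 0 (s N.+ s))) (cong (λ k → suc (k N.+ k)) (node-0 (s N.+ s))))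

opaque
  itB thmB : BF
  itB  = call (known 1) (0 ∷ 1 ∷ 2 ∷ 3 ∷ 4 ∷ [])
  thmB = call (known 7) (0 ∷ 1 ∷ 2 ∷ [])

It : ℕ → ℕ → ℕ → ℕ → ℕ → Set
It b e k a x = ⟦ itB ⟧ (b ∷ₛ e ∷ₛ k ∷ₛ a ∷ₛ x ∷ₛ λ _ → 0)

Thm : ℕ → ℕ → ℕ → Set
Thm b c x = ⟦ thmB ⟧ (b ∷ₛ c ∷ₛ x ∷ₛ λ _ → 0)

opaque
  unfolding itB
  It-sound : ∀ {b e k a x} → It b e k a x → x ≡ boxes e (suc k) a
  -- The meaning of these facts does not involve the axioms, so soundness is taken for the theory in
  -- which every formula is an axiom.
  It-sound {b} {e} {k} {a} {x} h = Soundness.Drv-sound (λ _ → ⊤) Z (λ _ _ → tt) (Known-sound {b} {fact 1 e k a x} h)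

  It-complete : ∀ e k a → ∃ λ b → It b e k a (boxes e (suc k) a)
  It-complete e k a = Known-complete (derive-It e k a)

  It-mono : ∀ {b b' e k a x} → b ≤ b' → It b e k a x → It b' e k a x
  It-mono {b} {b'} {e} {k} {a} {x} = Known-mono {b} {b'} {fact 1 e k a x}

  Thm-from : ∀ {b c x} → Known b (fact 7 c x 0 0) → Thm b c x
  Thm-from h = h

  Thm-to : ∀ {b c x} → Thm b c x → Known b (fact 7 c x 0 0)
  Thm-to h = h

  Thm-mono : ∀ {b b' c x} → b ≤ b' → Thm b c x → Thm b' c x
  Thm-mono {b} {b'} {c} {x} p h = Known-mono {b} {b'} {fact 7 c x 0 0} p h

-- Variables: settledB b x e, xthB b x e c, beforeB w x e c.
opaque
  settledB : BF
  settledB = ∀≤ 1 (∀≤ 2 (∃≤ 2 (call itB (3 ∷ 5 ∷ 1 ∷ 2 ∷ 0 ∷ []))))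

opaque
  xthB : BF
  xthB = leq 1 0 ∧ᵇ call thmB (0 ∷ 3 ∷ 1 ∷ []) ∧ᵇ call settledB (0 ∷ 1 ∷ 2 ∷ [])

opaque
  beforeB : BF
  beforeB = ∃≤ 0 (lt 0 1 ∧ᵇ call xthB (0 ∷ 2 ∷ 3 ∷ 4 ∷ []))

-- The world 2a + 1 forces the number a to be provable; the world 2s forces the
-- numbers x with 2x in the set s and the world's own name junk s to be
-- provable, and the numbers x with 2x + 1 in the set s not to be provable.
opaque
  posB negB : BF
  posB = ∃≤ 1 (var 0 ≐ᵇ var 1 +' var 1 ∧ᵇ memb 0 2)
  negB = ∃≤ 1 (var 0 ≐ᵇ oddᵗ (var 1) ∧ᵇ memb 0 2)

opaque
  inWB : BF
  inWB = var 1 ≐ᵇ oddᵗ (var 0) ∨ᵇ ∃≤ 1 (var 2 ≐ᵇ var 0 +' var 0 ∧ᵇ (call posB (1 ∷ 0 ∷ []) ∨ᵇ var 1 ≐ᵇ junkᵗ (var 0)))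

opaque
  outWB : BF
  outWB = ∃≤ 1 (var 2 ≐ᵇ var 0 +' var 0 ∧ᵇ call negB (1 ∷ 0 ∷ []))

opaque
  -- A world may force its own name but not that of another world. Otherwise the presence of
  -- `junk s` in a set would not reveal that the world 2s has been chosen, as the fourth check
  -- demands.
  noJunkB : BF
  noJunkB = ∀≤ 0 (∀≤ 1 (var 0 ≐ᵇ junkᵗ (var 1) ∧ᵇ call inWB (0 ∷ 2 ∷ []) ⇒ᵇ var 2 ≐ᵇ var 1 +' var 1))

-- Variables of a base: a e c w u b; of cloB base: b x e c ℓ w u.
opaque
  cloB : BF → BF
  cloB base = leq 1 0 ∧ᵇ (call base (1 ∷ 2 ∷ 3 ∷ 5 ∷ 6 ∷ 0 ∷ []) ∨ᵇ (var 4 ≐ᵇ suc' zer ∧ᵇ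
    ∃≤ 0 (∃≤ 1 (call base (1 ∷ 4 ∷ 5 ∷ 7 ∷ 8 ∷ 2 ∷ []) ∧ᵇ call itB (2 ∷ 4 ∷ 0 ∷ 1 ∷ 3 ∷ [])))))

opaque
  jumpBaseB stageBaseB : BF
  jumpBaseB  = call beforeB (3 ∷ 0 ∷ 1 ∷ 2 ∷ []) ∨ᵇ call inWB (0 ∷ 4 ∷ [])
  stageBaseB = call xthB (5 ∷ 0 ∷ 1 ∷ 2 ∷ [])

-- Variables of the following: w u e c ℓ.
opaque
  conflict₁B conflict₂B conB : BF
  conflict₁B = ∃≤ 0 (call (cloB jumpBaseB) (1 ∷ 0 ∷ 3 ∷ 4 ∷ 5 ∷ 1 ∷ 2 ∷ []) ∧ᵇ
               ∃≤ 1 (var 0 ≐ᵇ negᵗ (var 1) ∧ᵇ call (cloB jumpBaseB) (2 ∷ 0 ∷ 4 ∷ 5 ∷ 6 ∷ 2 ∷ 3 ∷ [])))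
  conflict₂B = ∃≤ 0 (call outWB (0 ∷ 2 ∷ []) ∧ᵇ call (cloB jumpBaseB) (1 ∷ 0 ∷ 3 ∷ 4 ∷ 5 ∷ 1 ∷ 2 ∷ []))
  conB       = ¬ᵇ conflict₁B ∧ᵇ ¬ᵇ conflict₂B

opaque
  trigB : BF
  trigB = ∃≤ 0 (∃≤ 1 (∃≤ 2 (∃≤ 3 (call inWB (3 ∷ 5 ∷ []) ∧ᵇ call itB (4 ∷ 6 ∷ 2 ∷ 3 ∷ 1 ∷ []) ∧ᵇ var 0 ≐ᵇ negᵗ (var 1)
            ∧ᵇ call xthB (4 ∷ 0 ∷ 6 ∷ 7 ∷ []) ∧ᵇ (var 2 ≐ᵇ zer ∨ᵇ var 8 ≐ᵇ suc' zer)))))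

opaque
  jmpB : BF
  jmpB = leq 1 0 ∧ᵇ call noJunkB (1 ∷ []) ∧ᵇ call trigB (0 ∷ 1 ∷ 2 ∷ 3 ∷ 4 ∷ []) ∧ᵇ call conB (0 ∷ 1 ∷ 2 ∷ 3 ∷ 4 ∷ [])

opaque
  -- The least stage and then the least world at that stage: the choice must be unique, so that the
  -- sets of all later stages follow the same world.
  firstB : BF
  firstB = call jmpB (0 ∷ 1 ∷ 2 ∷ 3 ∷ 4 ∷ []) ∧ᵇ
           ∀≤ 0 (∀≤ 0 (call jmpB (1 ∷ 0 ∷ 4 ∷ 5 ∷ 6 ∷ []) ⇒ᵇ var 1 ≐ᵇ var 2 ∧ᵇ leq 3 0))

-- Variables: b x e c ℓ for setB and bodyB, b s e c ℓ for jumpedB, b e c ℓ for the checks.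
opaque
  setB : BF
  setB = ∃≤ 0 (∃≤ 0 (call firstB (1 ∷ 0 ∷ 4 ∷ 5 ∷ 6 ∷ []) ∧ᵇ call (cloB jumpBaseB) (2 ∷ 3 ∷ 4 ∷ 5 ∷ 6 ∷ 1 ∷ 0 ∷ [])))
      -- The closure of the theorems depends on no jump; index 5 lies beyond the variables and puts
      -- 0 for both the stage and the world of a jump.
      ∨ᵇ (∀≤ 0 (∀≤ 0 (¬ᵇ call jmpB (1 ∷ 0 ∷ 4 ∷ 5 ∷ 6 ∷ []))) ∧ᵇ call (cloB stageBaseB) (0 ∷ 1 ∷ 2 ∷ 3 ∷ 4 ∷ 5 ∷ 5 ∷ []))

opaque
  jumpedB : BF
  jumpedB = ∃≤ 0 (∃≤ 0 (var 0 ≐ᵇ var 3 +' var 3 ∧ᵇ call firstB (1 ∷ 0 ∷ 4 ∷ 5 ∷ 6 ∷ [])))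

-- These are the facts that PA would otherwise have to prove about all stages. In the first and
-- third check the stage t is separate from b, so that PA can apply the third to a numeral t, whose
-- computations it decides, below an arbitrary b.
check₁ check₂ check₃ check₄ check₅ : BF
-- Membership comes with the bound x ≤ b, so PA need not derive the transitivity of the order.
check₁ = ∀≤ 0 (∀≤ 0 (call setB (1 ∷ 0 ∷ 3 ∷ 4 ∷ 5 ∷ []) ⇒ᵇ leq 0 2 ∧ᵇ call setB (2 ∷ 0 ∷ 3 ∷ 4 ∷ 5 ∷ [])))
check₂ = ∀≤ 0 (∀≤ 1 (var 0 ≐ᵇ negᵗ (var 1) ⇒ᵇ call setB (2 ∷ 1 ∷ 3 ∷ 4 ∷ 5 ∷ []) ⇒ᵇ ¬ᵇ call setB (2 ∷ 0 ∷ 3 ∷ 4 ∷ 5 ∷ [])))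
-- Index 7 lies beyond the variables v x t b e c ℓ and reads 0, so `itB` speaks of a single box.
check₃ = ∀≤ 0 (∀≤ 0 (∀≤ 1 (var 6 ≐ᵇ suc' zer ⇒ᵇ call itB (2 ∷ 4 ∷ 7 ∷ 1 ∷ 0 ∷ []) ⇒ᵇ call settledB (2 ∷ 0 ∷ 4 ∷ []) ⇒ᵇ
            call setB (3 ∷ 1 ∷ 4 ∷ 5 ∷ 6 ∷ []) ⇒ᵇ call setB (3 ∷ 0 ∷ 4 ∷ 5 ∷ 6 ∷ []))))
check₄ = ∀≤ 0 (∀≤ 1 (var 0 ≐ᵇ junkᵗ (var 1) ⇒ᵇ call setB (2 ∷ 0 ∷ 3 ∷ 4 ∷ 5 ∷ []) ⇒ᵇ call jumpedB (2 ∷ 1 ∷ 3 ∷ 4 ∷ 5 ∷ [])))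
check₅ = ∀≤ 0 (call jumpedB (1 ∷ 0 ∷ 2 ∷ 3 ∷ 4 ∷ []) ⇒ᵇ ∀≤ 0 (
            (call posB (0 ∷ 1 ∷ []) ⇒ᵇ call setB (2 ∷ 0 ∷ 3 ∷ 4 ∷ 5 ∷ [])) ∧ᵇ
            (call negB (0 ∷ 1 ∷ []) ⇒ᵇ ¬ᵇ call setB (2 ∷ 0 ∷ 3 ∷ 4 ∷ 5 ∷ []))))

opaque
  checkB : BF
  checkB = check₁ ∧ᵇ check₂ ∧ᵇ check₃ ∧ᵇ check₄ ∧ᵇ check₅

opaque
  bodyB : BF
  bodyB = call checkB (0 ∷ 2 ∷ 3 ∷ 4 ∷ []) ∧ᵇ leq 1 0 ∧ᵇ call setB (0 ∷ 1 ∷ 2 ∷ 3 ∷ 4 ∷ [])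

double-odd : ∀ m n → m N.+ m ≢ suc (n N.+ n)
double-odd m n h = NP.even≢odd m n (trans (cong (m N.+_) (NP.+-identityʳ m)) (trans h (cong (λ k → suc (n N.+ k)) (sym (NP.+-identityʳ n)))))

double-inj : ∀ {m n} → m N.+ m ≡ n N.+ n → m ≡ n
double-inj {m} {n} h = NP.*-cancelˡ-≡ m n 2 (trans (cong (m N.+_) (NP.+-identityʳ m)) (trans h (cong (n N.+_) (sym (NP.+-identityʳ n)))))

ngn-> : ∀ x → x < ngn x
ngn-> x = node-<ʳ 1 x

ngn-≥-odd : ∀ x → suc (x N.+ x) ≤ ngn x
ngn-≥-odd x = subst (suc (x N.+ x) ≤_) (neg-eval x) (NP.m≤m+n _ _)

ngn≢junk : ∀ {x s} → ngn x ≢ junk s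
ngn≢junk h with proj₁ (node-inj 1 0 h)
... | ()

box≢ngn : ∀ {e u x} → box e u ≢ ngn x
box≢ngn h with proj₁ (node-inj 6 1 h)
... | ()

box≢junk : ∀ {e u s} → box e u ≢ junk s
box≢junk h with proj₁ (node-inj 6 0 h)
... | ()

junk-inj : ∀ {s t} → junk s ≡ junk t → s ≡ t
junk-inj h = double-inj (proj₂ (node-inj 0 0 (proj₂ (node-inj 0 0 h))))

double≤junk : ∀ s → s N.+ s ≤ junk s
double≤junk s = NP.<⇒≤ (NP.<-trans (node-<ʳ 0 _) (node-<ʳ 0 _))

≤junk : ∀ s → s ≤ junk s
≤junk s = NP.≤-trans (NP.m≤m+n s s) (double≤junk s)

gnT≢0 : ∀ t → gnT t ≢ 0
gnT≢0 t h = node≢0 (trans (sym (gnT-node t)) h)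

gn≢0-0 : ∀ φ {b} → gn φ ≢ node 0 (node 0 b)
gn≢0-0 φ h with gn-inv φ (sym h)
gn≢0-0 (s ≐ t) h | _ , q = gnT≢0 s (sym (proj₁ (node-inj 0 (gnT s) q)))

cnum-≥ : ∀ n → n ≤ cnum n
cnum-≥ zero    = z≤n
cnum-≥ (suc n) = NP.≤-<-trans (cnum-≥ n) (node-<ʳ 2 (cnum n))

box-> : ∀ e u → u < box e u
box-> e u = NP.≤-<-trans (cnum-≥ u) (NP.<-trans (node-<ʳ (node 0 0) _) (NP.<-trans (node-<ʳ 0 _) (NP.<-trans (node-<ˡ _ _)
  (NP.<-trans (node-<ʳ 2 _) (NP.<-trans (node-<ʳ 6 _) (NP.<-trans (node-<ʳ 6 _) (NP.<-trans (node-<ʳ 6 _) (NP.<-trans (node-<ʳ 6 _) (node-<ʳ 6 _)))))))))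

boxes-≥ : ∀ e k a → k N.+ a ≤ boxes e k a
boxes-≥ e zero    a = NP.≤-refl
boxes-≥ e (suc k) a = NP.≤-<-trans (boxes-≥ e k a) (box-> e _)

boxes-≥ᵃ : ∀ e k a → a ≤ boxes e k a
boxes-≥ᵃ e k a = NP.≤-trans (NP.m≤n+m a k) (boxes-≥ e k a)

boxes-≥ᵏ : ∀ e k a → k ≤ boxes e k a
boxes-≥ᵏ e k a = NP.≤-trans (NP.m≤m+n k a) (boxes-≥ e k a)

-- Finitely many witnesses are replaced by their maximum, which is harmless by monotonicity.
bounded-choice : ∀ {Q : ℕ → ℕ → Set} → (∀ {x b b'} → b ≤ b' → Q x b → Q x b') → (∀ x → ∃ (Q x)) →
                 ∀ n → ∃ λ b → ∀ x → x ≤ n → Q x b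
bounded-choice mono h zero    = proj₁ (h 0) , λ { zero z≤n → proj₂ (h 0) }
bounded-choice mono h (suc n) with bounded-choice mono h n | h (suc n)
... | b , f | b' , q = b ⊔ b' , go
  where
  go : ∀ x → x ≤ suc n → _
  go x p with NP.m≤n⇒m<n∨m≡n p
  ... | inj₁ l    = mono (NP.m≤m⊔n b b') (f x (NP.≤-pred l))
  ... | inj₂ refl = mono (NP.m≤n⊔m b b') q

-- The sets at actual stages

module Truth (T : Theory) (χ : PR 1)
             (χ-sound : ∀ φ → evalPR χ (gn φ ∷ []) ≡ 1 → T φ) (χ-complete : ∀ φ → T φ → evalPR χ (gn φ ∷ []) ≡ 1)
             (T-ext : Extends T PA) (T-con : Consistent T) (e ℓ : ℕ)
             (PrN : ℕ → Formula) (gn-PrN : ∀ n → gn (PrN n) ≡ box e n)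
             (PrN-intro : ∀ b n → ⟦ bodyB ⟧ (b ∷ₛ n ∷ₛ e ∷ₛ codePR χ ∷ₛ ℓ ∷ₛ λ _ → 0) → PA ⊢ PrN n) where

  c : ℕ
  c = codePR χ

  Prov : ℕ → Set
  Prov x = ∃ λ φ → x ≡ gn φ × (T ⊢ φ)

  prov : ∀ {φ} → Prov (gn φ) → T ⊢ φ
  prov {φ} (ψ , h , d) = subst (T ⊢_) (gn-inj ψ φ (sym h)) d

  Prov-consistent : ∀ {x} → Prov x → Prov (ngn x) → ⊥
  Prov-consistent (φ , refl , d) (ψ , h , d') with view-¬ ψ h
  ... | φ' , refl , q with gn-inj φ φ' q
  ...   | refl = T-con (mp (mp (prop (A₀ ⇒ₚ ¬ₚ A₀ ⇒ₚ A₁) (φ ∷ falsum ∷ [])) d) d')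

  ¬Prov-junk : ∀ {s} → ¬ Prov (junk s)
  ¬Prov-junk (φ , h , _) = gn≢0-0 φ (sym h)

  ¬Prov-0-0 : ∀ {b} → ¬ Prov (node 0 (node 0 b))
  ¬Prov-0-0 (φ , h , _) = gn≢0-0 φ (sym h)

  ¬Prov-ngn-0-0 : ∀ {b} → ¬ Prov (ngn (node 0 (node 0 b)))
  ¬Prov-ngn-0-0 (φ , h , _) with view-¬ φ h
  ... | φ' , _ , q = gn≢0-0 φ' (sym q)

  Settled XTh Before : ℕ → ℕ → Set
  Settled b x = ⟦ settledB ⟧ (b ∷ₛ x ∷ₛ e ∷ₛ λ _ → 0)
  XTh b x     = ⟦ xthB ⟧ (b ∷ₛ x ∷ₛ e ∷ₛ c ∷ₛ λ _ → 0)
  Before w x  = ⟦ beforeB ⟧ (w ∷ₛ x ∷ₛ e ∷ₛ c ∷ₛ λ _ → 0)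

  InW OutW : ℕ → ℕ → Set
  InW a u  = ⟦ inWB ⟧ (a ∷ₛ u ∷ₛ λ _ → 0)
  OutW a u = ⟦ outWB ⟧ (a ∷ₛ u ∷ₛ λ _ → 0)

  Pos Neg : ℕ → ℕ → Set
  Pos x s = ⟦ posB ⟧ (x ∷ₛ s ∷ₛ λ _ → 0)
  Neg x s = ⟦ negB ⟧ (x ∷ₛ s ∷ₛ λ _ → 0)

  NoJunk : ℕ → Set
  NoJunk u = ⟦ noJunkB ⟧ (u ∷ₛ λ _ → 0)

  Base Clo : BF → ℕ → ℕ → ℕ → ℕ → Set
  Base base b a w u = ⟦ base ⟧ (a ∷ₛ e ∷ₛ c ∷ₛ w ∷ₛ u ∷ₛ b ∷ₛ λ _ → 0)
  Clo base b x w u  = ⟦ cloB base ⟧ (b ∷ₛ x ∷ₛ e ∷ₛ c ∷ₛ ℓ ∷ₛ w ∷ₛ u ∷ₛ λ _ → 0)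

  JClo : ℕ → ℕ → ℕ → ℕ → Set
  JClo = Clo jumpBaseB

  SClo : ℕ → ℕ → Set
  SClo b x = Clo stageBaseB b x 0 0

  Con Trig Jmp First : ℕ → ℕ → Set
  Con w u   = ⟦ conB ⟧ (w ∷ₛ u ∷ₛ e ∷ₛ c ∷ₛ ℓ ∷ₛ λ _ → 0)
  Trig w u  = ⟦ trigB ⟧ (w ∷ₛ u ∷ₛ e ∷ₛ c ∷ₛ ℓ ∷ₛ λ _ → 0)
  Jmp w u   = ⟦ jmpB ⟧ (w ∷ₛ u ∷ₛ e ∷ₛ c ∷ₛ ℓ ∷ₛ λ _ → 0)
  First w u = ⟦ firstB ⟧ (w ∷ₛ u ∷ₛ e ∷ₛ c ∷ₛ ℓ ∷ₛ λ _ → 0)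

  InSet Jumped : ℕ → ℕ → Set
  InSet b x  = ⟦ setB ⟧ (b ∷ₛ x ∷ₛ e ∷ₛ c ∷ₛ ℓ ∷ₛ λ _ → 0)
  Jumped b s = ⟦ jumpedB ⟧ (b ∷ₛ s ∷ₛ e ∷ₛ c ∷ₛ ℓ ∷ₛ λ _ → 0)

  Check : ℕ → Set
  Check b = ⟦ checkB ⟧ (b ∷ₛ e ∷ₛ c ∷ₛ ℓ ∷ₛ λ _ → 0)

  SettledSpec : ℕ → ℕ → Set
  SettledSpec b x = ∀ a → a ≤ x → ∀ k → k ≤ x → ∃ λ y → y ≤ b × It b e k a y

  opaque
    unfolding settledB
    settled-to : ∀ {b x} → Settled b x → SettledSpec b x
    settled-to h = h

    settled-from : ∀ {b x} → SettledSpec b x → Settled b x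
    settled-from h = h

  opaque
    unfolding xthB
    xth-to : ∀ {b x} → XTh b x → x ≤ b × Thm b c x × Settled b x
    xth-to {b} {x} (p , h) = leq-to {1} {0} {b ∷ₛ x ∷ₛ e ∷ₛ c ∷ₛ λ _ → 0} p , h

    xth-from : ∀ {b x} → x ≤ b → Thm b c x → Settled b x → XTh b x
    xth-from {b} {x} p h k = leq-from {1} {0} {b ∷ₛ x ∷ₛ e ∷ₛ c ∷ₛ λ _ → 0} p , h , k

  opaque
    unfolding beforeB
    Before-to : ∀ {w x} → Before w x → ∃ λ w' → w' < w × XTh w' x
    Before-to {w} {x} (w' , _ , l , h) = w' , lt-to {0} {1} {w' ∷ₛ w ∷ₛ x ∷ₛ e ∷ₛ c ∷ₛ λ _ → 0} l , h

    Before-from : ∀ {w' w x} → w' < w → XTh w' x → Before w x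
    Before-from {w'} {w} {x} l h = w' , NP.<⇒≤ l , lt-from {0} {1} {w' ∷ₛ w ∷ₛ x ∷ₛ e ∷ₛ c ∷ₛ λ _ → 0} l , h

  opaque
    unfolding posB
    Pos-to : ∀ {x s} → Pos x s → Mem (x N.+ x) s
    Pos-to {x} {s} (y , p , h , m) = subst (λ z → Mem z s) h m

    Pos-from : ∀ {x s} → Mem (x N.+ x) s → Pos x s
    Pos-from {x} {s} m = x N.+ x , Mem-≤ m , refl , m

    Neg-to : ∀ {x s} → Neg x s → Mem (suc (x N.+ x)) s
    Neg-to {x} {s} (y , p , h , m) = subst (λ z → Mem z s) h m

    Neg-from : ∀ {x s} → Mem (suc (x N.+ x)) s → Neg x s
    Neg-from {x} {s} m = suc (x N.+ x) , Mem-≤ m , refl , m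

  Pos-≤ : ∀ {x s} → Pos x s → x ≤ s
  Pos-≤ {x} {s} h = NP.≤-trans (NP.m≤m+n x x) (Mem-≤ (Pos-to {x} {s} h))

  Neg-≤ : ∀ {x s} → Neg x s → x ≤ s
  Neg-≤ {x} {s} h = NP.≤-trans (NP.≤-trans (NP.m≤m+n x x) (NP.n≤1+n _)) (Mem-≤ (Neg-to {x} {s} h))

  opaque
    unfolding inWB
    InW-odd : ∀ a → InW a (suc (a N.+ a))
    InW-odd a = inj₁ refl

    InW-odd-to : ∀ {a b} → InW a (suc (b N.+ b)) → a ≡ b
    InW-odd-to (inj₁ h) = double-inj (sym (NP.suc-injective h))
    InW-odd-to {a} {b} (inj₂ (s , _ , h , _)) = ⊥-elim (double-odd s b (sym h))

    InW-even-to : ∀ {a s} → InW a (s N.+ s) → Pos a s ⊎ a ≡ junk s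
    InW-even-to {a} {s} (inj₁ h) = ⊥-elim (double-odd s a h)
    InW-even-to {a} {s} (inj₂ (t , _ , h , q)) = go t (double-inj {s} {t} h) q
      where
      go : ∀ t → s ≡ t → Pos a t ⊎ a ≡ evalT (λ _ → t) (junkᵗ (var 0)) → Pos a s ⊎ a ≡ junk s
      go t refl (inj₁ p) = inj₁ p
      go t refl (inj₂ z) = inj₂ (trans z (junk-eval s))

    InW-pos : ∀ {a s} → Pos a s → InW a (s N.+ s)
    InW-pos {a} {s} h = inj₂ (s , NP.m≤m+n s s , refl , inj₁ h)

    InW-junk : ∀ s → InW (junk s) (s N.+ s)
    InW-junk s = inj₂ (s , NP.m≤m+n s s , refl , inj₂ (sym (junk-eval s)))

    -- Only its own name can exceed a world, so the bounded quantifiers of `noJunkB` miss nothing.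
    InW-junk-to : ∀ {s u} → InW (junk s) u → junk s ≤ u ⊎ u ≡ s N.+ s
    InW-junk-to {s} {u} (inj₁ q) = inj₁ (subst (junk s ≤_) (sym q) (NP.≤-trans (NP.m≤m+n _ _) (NP.n≤1+n _)))
    InW-junk-to {s} {u} (inj₂ (t , r , q , inj₁ pos)) = inj₁ (NP.≤-trans (Pos-≤ {junk s} {t} pos) r)
    InW-junk-to {s} {u} (inj₂ (t , _ , q , inj₂ j)) = inj₂ (trans q (cong (λ k → k N.+ k) (sym (junk-inj {s} {t} (trans j (junk-eval t))))))

  opaque
    unfolding outWB
    OutW-to : ∀ {a u} → OutW a u → ∃ λ s → u ≡ s N.+ s × Neg a s
    OutW-to (s , _ , h , q) = s , h , q

    OutW-from : ∀ {a s} → Neg a s → OutW a (s N.+ s)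
    OutW-from {a} {s} h = s , NP.m≤m+n s s , refl , h

  opaque
    unfolding noJunkB
    noJunk-to : ∀ {u} → NoJunk u → ∀ {s} → InW (junk s) u → u ≡ s N.+ s
    noJunk-to {u} n {s} i = [ (λ p → n s (NP.≤-trans (≤junk s) p) (junk s) p (sym (junk-eval s) , i)) , id ]′ (InW-junk-to {s} {u} i)

    noJunk-from : ∀ {u} → (∀ s → InW (junk s) u → u ≡ s N.+ s) → NoJunk u
    noJunk-from {u} h s _ j _ (q , i) = h s (subst (λ k → InW k u) (trans q (junk-eval s)) i)

  NoJunk-odd : ∀ {a} → (∀ s → a ≢ junk s) → NoJunk (suc (a N.+ a))
  NoJunk-odd {a} h = noJunk-from (λ s i → ⊥-elim (h s (sym (InW-odd-to {junk s} {a} i))))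

  NoJunk-even : ∀ {s} → (∀ t → ¬ Pos (junk t) s) → NoJunk (s N.+ s)
  NoJunk-even {s} h = noJunk-from (λ t i → [ (λ p → ⊥-elim (h t p)) , (λ q → cong (λ k → k N.+ k) (sym (junk-inj {t} {s} q))) ]′ (InW-even-to {junk t} {s} i))

  opaque
    unfolding cloB
    Clo-to : ∀ base {b x w u} → Clo base b x w u →
             x ≤ b × (Base base b x w u ⊎ ℓ ≡ 1 × ∃₂ λ a k → Base base b a w u × It b e k a x)
    Clo-to base {b} {x} {w} {u} (p , inj₁ h) = leq-to {1} {0} {b ∷ₛ x ∷ₛ e ∷ₛ c ∷ₛ ℓ ∷ₛ w ∷ₛ u ∷ₛ λ _ → 0} p , inj₁ h
    Clo-to base {b} {x} {w} {u} (p , inj₂ (l , a , _ , k , _ , h , i)) =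
      leq-to {1} {0} {b ∷ₛ x ∷ₛ e ∷ₛ c ∷ₛ ℓ ∷ₛ w ∷ₛ u ∷ₛ λ _ → 0} p , inj₂ (l , a , k , h , i)

    Clo-base : ∀ base {b x w u} → x ≤ b → Base base b x w u → Clo base b x w u
    Clo-base base {b} {x} {w} {u} p h = leq-from {1} {0} {b ∷ₛ x ∷ₛ e ∷ₛ c ∷ₛ ℓ ∷ₛ w ∷ₛ u ∷ₛ λ _ → 0} p , inj₁ h

    Clo-box : ∀ base {b x w u k a} → ℓ ≡ 1 → x ≤ b → Base base b a w u → It b e k a x → Clo base b x w u
    Clo-box base {b} {x} {w} {u} {k} {a} l p h i = leq-from {1} {0} {b ∷ₛ x ∷ₛ e ∷ₛ c ∷ₛ ℓ ∷ₛ w ∷ₛ u ∷ₛ λ _ → 0} p ,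
      inj₂ (l , a , NP.≤-trans (boxes-≥ᵃ e (suc k) a) x≤b , k , NP.≤-trans (NP.n≤1+n k) (NP.≤-trans (boxes-≥ᵏ e (suc k) a) x≤b) , h , i)
      where
      x≤b : boxes e (suc k) a ≤ b
      x≤b = subst (_≤ b) (It-sound {b} {e} {k} {a} {x} i) p

  JumpBase : ℕ → ℕ → ℕ → Set
  JumpBase w u a = Before w a ⊎ InW a u

  opaque
    unfolding jumpBaseB
    jumpBase-to : ∀ {b a w u} → Base jumpBaseB b a w u → JumpBase w u a
    jumpBase-to h = h

    jumpBase-from : ∀ {b a w u} → JumpBase w u a → Base jumpBaseB b a w u
    jumpBase-from h = h

    stageBase-to : ∀ {b a w u} → Base stageBaseB b a w u → XTh b a
    stageBase-to h = h

    stageBase-from : ∀ {b a w u} → XTh b a → Base stageBaseB b a w u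
    stageBase-from h = h

  Conflict₁ Conflict₂ : ℕ → ℕ → Set
  Conflict₁ w u = ∃ λ x → x ≤ w × JClo w x w u × ngn x ≤ w × JClo w (ngn x) w u
  Conflict₂ w u = ∃ λ x → x ≤ w × OutW x u × JClo w x w u

  opaque
    unfolding conB
    con₁ : ∀ {w u} → Con w u → ¬ Conflict₁ w u
    con₁ {w} {u} (h , _) (x , p , a , q , b) = h (x , p , a , ngn x , q , sym (neg-eval x) , b)

    con₂ : ∀ {w u} → Con w u → ¬ Conflict₂ w u
    con₂ (_ , h) = h

    ¬Con-conflict : ∀ {w u} → ¬ Con w u → Conflict₁ w u ⊎ Conflict₂ w u
    ¬Con-conflict {w} {u} h = go (⟦ conflict₁B ⟧? ρ) (⟦ conflict₂B ⟧? ρ)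
      where
      ρ : ℕ → ℕ
      ρ = w ∷ₛ u ∷ₛ e ∷ₛ c ∷ₛ ℓ ∷ₛ λ _ → 0
      go : Dec (⟦ conflict₁B ⟧ ρ) → Dec (⟦ conflict₂B ⟧ ρ) → Conflict₁ w u ⊎ Conflict₂ w u
      go (yes (x , p , a , z , q , r , b)) _ = inj₁ (x , p , a , subst (_≤ w) z≡ q , subst (λ k → JClo w k w u) z≡ b)
        where
        z≡ : z ≡ ngn x
        z≡ = trans r (neg-eval x)
      go (no a) (yes b) = inj₂ b
      go (no a) (no b)  = ⊥-elim (h (a , b))

  opaque
    unfolding trigB
    trig-to : ∀ {w u} → Trig w u → ∃₂ λ a k → InW a u × (k ≡ 0 ⊎ ℓ ≡ 1) × XTh w (ngn (boxes e (suc k) a))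
    trig-to {w} {u} (a , _ , k , _ , y , _ , z , _ , i , it , q , h , l) =
      a , k , i , l , subst (XTh w) (trans q (trans (neg-eval y) (cong ngn (It-sound {w} {e} {k} {a} {y} it)))) h

    trig-intro : ∀ {w u a k} → a ≤ w → k ≤ w → boxes e (suc k) a ≤ w → ngn (boxes e (suc k) a) ≤ w → InW a u →
                 It w e k a (boxes e (suc k) a) → XTh w (ngn (boxes e (suc k) a)) → k ≡ 0 ⊎ ℓ ≡ 1 → Trig w u
    trig-intro {w} {u} {a} {k} p q r s i it h l = a , p , k , q , boxes e (suc k) a , r , ngn (boxes e (suc k) a) , s ,
      i , it , sym (neg-eval (boxes e (suc k) a)) , h , l

  opaque
    unfolding jmpB
    jmp-to : ∀ {w u} → Jmp w u → u ≤ w × NoJunk u × Trig w u × Con w u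
    jmp-to {w} {u} (p , h) = leq-to {1} {0} {w ∷ₛ u ∷ₛ e ∷ₛ c ∷ₛ ℓ ∷ₛ λ _ → 0} p , h

    jmp-from : ∀ {w u} → u ≤ w → NoJunk u → Trig w u → Con w u → Jmp w u
    jmp-from {w} {u} p h k l = leq-from {1} {0} {w ∷ₛ u ∷ₛ e ∷ₛ c ∷ₛ ℓ ∷ₛ λ _ → 0} p , h , k , l

  Jmp? : ∀ w u → Dec (Jmp w u)
  Jmp? w u = ⟦ jmpB ⟧? (w ∷ₛ u ∷ₛ e ∷ₛ c ∷ₛ ℓ ∷ₛ λ _ → 0)

  opaque
    unfolding firstB
    First-jmp : ∀ {w u} → First w u → Jmp w u
    First-jmp (h , _) = h

    First-min : ∀ {w u} → First w u → ∀ {w' u'} → w' ≤ w → u' ≤ w' → Jmp w' u' → w' ≡ w × u ≤ u'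
    First-min {w} {u} (_ , m) {w'} {u'} p q j = proj₁ (m w' p u' q j) ,
      leq-to {3} {0} {u' ∷ₛ w' ∷ₛ w ∷ₛ u ∷ₛ e ∷ₛ c ∷ₛ ℓ ∷ₛ λ _ → 0} (proj₂ (m w' p u' q j))

    First-from : ∀ {w u} → Jmp w u → (∀ w' u' → w' ≤ w → u' ≤ w' → Jmp w' u' → w' ≡ w × u ≤ u') → First w u
    First-from {w} {u} j m = j , λ w' p u' q j' → proj₁ (m w' u' p q j') ,
      leq-from {3} {0} {u' ∷ₛ w' ∷ₛ w ∷ₛ u ∷ₛ e ∷ₛ c ∷ₛ ℓ ∷ₛ λ _ → 0} (proj₂ (m w' u' p q j'))

  opaque
    unfolding setB
    set-to : ∀ {b x} → InSet b x → (∃ λ w → w ≤ b × ∃ λ u → u ≤ w × First w u × JClo b x w u)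
                                   ⊎ ((∀ w → w ≤ b → ∀ u → u ≤ w → ¬ Jmp w u) × SClo b x)
    set-to h = h

    set-from : ∀ {b x} → (∃ λ w → w ≤ b × ∃ λ u → u ≤ w × First w u × JClo b x w u)
                         ⊎ ((∀ w → w ≤ b → ∀ u → u ≤ w → ¬ Jmp w u) × SClo b x) → InSet b x
    set-from h = h

  set-≤ : ∀ {b x} → InSet b x → x ≤ b
  set-≤ {b} {x} h = [ (λ { (w , _ , u , _ , _ , k) → proj₁ (Clo-to jumpBaseB {b} {x} {w} {u} k) }) ,
                     (λ { (_ , k) → proj₁ (Clo-to stageBaseB {b} {x} {0} {0} k) }) ]′ (set-to {b} {x} h)

  opaque
    unfolding jumpedB
    jumped-to : ∀ {b s} → Jumped b s → ∃ λ w → w ≤ b × First w (s N.+ s)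
    jumped-to (w , p , u , _ , q , f) = w , p , subst (First w) q f

    jumped-from : ∀ {b s w} → w ≤ b → s N.+ s ≤ w → First w (s N.+ s) → Jumped b s
    jumped-from {b} {s} {w} p q f = w , p , s N.+ s , q , refl , f

  opaque
    unfolding checkB
    check-from : ∀ {b} →
      (∀ t → t ≤ b → ∀ x → x ≤ b → InSet t x → InSet b x) →
      (∀ x → x ≤ b → ngn x ≤ b → InSet b x → ¬ InSet b (ngn x)) →
      (∀ t → t ≤ b → ∀ x → x ≤ t → ∀ v → v ≤ t → ℓ ≡ 1 → It t e 0 x v → Settled t v → InSet b x → InSet b v) →
      (∀ s → s ≤ b → junk s ≤ b → InSet b (junk s) → Jumped b s) →
      (∀ s → s ≤ b → Jumped b s → ∀ x → x ≤ s → (Pos x s → InSet b x) × (Neg x s → ¬ InSet b x)) →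
      Check b
    check-from {b} c₁ c₂ c₃ c₄ c₅ =
      (λ t p x q h → leq-from {0} {2} {x ∷ₛ t ∷ₛ b ∷ₛ e ∷ₛ c ∷ₛ ℓ ∷ₛ λ _ → 0} (NP.≤-trans q p) , c₁ t p x (NP.≤-trans q p) h) ,
      (λ x p z q r h → subst (λ k → ¬ InSet b k) (sym (trans r (neg-eval x))) (c₂ x p (subst (_≤ b) (trans r (neg-eval x)) q) h)) ,
      c₃ ,
      (λ s p j q r h → c₄ s p (subst (_≤ b) (trans r (junk-eval s)) q) (subst (InSet b) (trans r (junk-eval s)) h)) ,
      c₅

  opaque
    unfolding bodyB
    body-from : ∀ {b x} → Check b → InSet b x → ⟦ bodyB ⟧ (b ∷ₛ x ∷ₛ e ∷ₛ c ∷ₛ ℓ ∷ₛ λ _ → 0)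
    body-from {b} {x} h k = h , leq-from {1} {0} {b ∷ₛ x ∷ₛ e ∷ₛ c ∷ₛ ℓ ∷ₛ λ _ → 0} (set-≤ {b} {x} k) , k

    body-to : ∀ {b x} → ⟦ bodyB ⟧ (b ∷ₛ x ∷ₛ e ∷ₛ c ∷ₛ ℓ ∷ₛ λ _ → 0) → InSet b x
    body-to (_ , _ , k) = k

  -- The purpose of `settledB`: when the negation of an iterated box appears as a theorem, the
  -- iterated box itself has been computed at that very stage and can be recognised.
  settled-It : ∀ {b x} a k → Settled b x → a ≤ x → k ≤ x → It b e k a (boxes e (suc k) a)
  settled-It {b} {x} a k h p q with settled-to {b} {x} h a p k q
  ... | y , _ , i = subst (It b e k a) (It-sound {b} {e} {k} {a} {y} i) i

  settled-mono : ∀ {b b' x} → b ≤ b' → Settled b x → Settled b' x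
  settled-mono {b} {b'} {x} p h = settled-from {b'} {x} go
    where
    go : SettledSpec b' x
    go a q k r with settled-to {b} {x} h a q k r
    ... | y , s , i = y , NP.≤-trans s p , It-mono {b} {b'} p i

  settled-complete : ∀ x → ∃ λ b → Settled b x
  settled-complete x = proj₁ all , settled-from {proj₁ all} {x} (λ a p k q → proj₂ all a p k q)
    where
    Row : ℕ → ℕ → ℕ → Set
    Row a k b = ∃ λ y → y ≤ b × It b e k a y
    widen : ∀ {a k b b'} → b ≤ b' → Row a k b → Row a k b'
    widen {a} {k} {b} {b'} p (y , q , i) = y , NP.≤-trans q p , It-mono {b} {b'} p i
    one : ∀ a k → ∃ (Row a k)
    one a k with It-complete e k a
    ... | b , i = b ⊔ boxes e (suc k) a , boxes e (suc k) a , NP.m≤n⊔m b _ , It-mono {b} (NP.m≤m⊔n b _) i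
    inner : ∀ a → ∃ λ b → ∀ k → k ≤ x → Row a k b
    inner a = bounded-choice {Row a} (widen {a}) (one a) x
    all : ∃ λ b → ∀ a → a ≤ x → ∀ k → k ≤ x → Row a k b
    all = bounded-choice {λ a b → ∀ k → k ≤ x → Row a k b} (λ {a} p f k q → widen {a} p (f k q)) inner x

  XTh-≤ : ∀ {b x} → XTh b x → x ≤ b
  XTh-≤ {b} {x} h = proj₁ (xth-to {b} {x} h)

  XTh-settled : ∀ {b x} → XTh b x → Settled b x
  XTh-settled {b} {x} h = proj₂ (proj₂ (xth-to {b} {x} h))

  XTh-prov : ∀ {b x} → XTh b x → Prov x
  XTh-prov {b} {x} h = Soundness.Drv-sound T χ χ-sound (Known-sound {b} {fact 7 c x 0 0} (Thm-to {b} (proj₁ (proj₂ (xth-to {b} {x} h))))) refl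

  XTh-mono : ∀ {b b' x} → b ≤ b' → XTh b x → XTh b' x
  XTh-mono {b} {b'} {x} p h with xth-to {b} {x} h
  ... | q , t , s = xth-from {b'} {x} (NP.≤-trans q p) (Thm-mono {b} {b'} p t) (settled-mono {b} {b'} {x} p s)

  XTh-complete : ∀ {x} → Prov x → ∃ λ b → XTh b x
  XTh-complete {x} (φ , refl , d) with Known-complete (Completeness.drv (Completeness.complete T χ χ-complete d)) | settled-complete x
  ... | b , k | b' , s = x ⊔ (b ⊔ b') , xth-from {x ⊔ (b ⊔ b')} {x} (NP.m≤m⊔n x _)
    (Thm-mono {b} (NP.≤-trans (NP.m≤m⊔n b b') (NP.m≤n⊔m x _)) (Thm-from {b} k))
    (settled-mono {b'} {_} {x} (NP.≤-trans (NP.m≤n⊔m b b') (NP.m≤n⊔m x _)) s)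

  Before-prov : ∀ {w x} → Before w x → Prov x
  Before-prov {w} {x} h with Before-to {w} {x} h
  ... | w' , _ , t = XTh-prov {w'} {x} t

  -- A count of boxes takes the place of a recursive closure: i = 0 gives the base itself, and
  -- larger counts require ℓ = 1.
  Closed : (ℕ → Set) → ℕ → Set
  Closed B x = ∃₂ λ i a → (i ≡ 0 ⊎ ℓ ≡ 1) × B a × x ≡ boxes e i a

  JClo-closed : ∀ {b x w u} → JClo b x w u → Closed (JumpBase w u) x
  JClo-closed {b} {x} {w} {u} h with Clo-to jumpBaseB {b} {x} {w} {u} h
  ... | _ , inj₁ q = 0 , x , inj₁ refl , jumpBase-to {b} {x} {w} {u} q , refl
  ... | _ , inj₂ (l , a , k , q , i) = suc k , a , inj₂ l , jumpBase-to {b} {a} {w} {u} q , It-sound {b} {e} {k} {a} {x} i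

  SClo-closed : ∀ {b x} → SClo b x → Closed (XTh b) x
  SClo-closed {b} {x} h with Clo-to stageBaseB {b} {x} {0} {0} h
  ... | _ , inj₁ q = 0 , x , inj₁ refl , stageBase-to {b} {x} {0} {0} q , refl
  ... | _ , inj₂ (l , a , k , q , i) = suc k , a , inj₂ l , stageBase-to {b} {a} {0} {0} q , It-sound {b} {e} {k} {a} {x} i

  -- Boxes are numbers of existential formulas, so passing to the closure adds no negation and, by
  -- the next lemma, no name of a world.
  Closed-ngn : ∀ {B x} → Closed B (ngn x) → B (ngn x)
  Closed-ngn {B} (zero , a , _ , h , q)  = subst B (sym q) h
  Closed-ngn {x = x} (suc i , a , _ , _ , q) = ⊥-elim (box≢ngn {e} {boxes e i a} {x} (sym q))

  Closed-junk : ∀ {B s} → Closed B (junk s) → B (junk s)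
  Closed-junk {B} (zero , a , _ , h , q)  = subst B (sym q) h
  Closed-junk {s = s} (suc i , a , _ , _ , q) = ⊥-elim (box≢junk {e} {boxes e i a} {s} (sym q))

  -- The third check: closures contain the box of each of their members whose
  -- iterated boxes have been computed.
  Clo-step : ∀ base {b x w u t v} → ℓ ≡ 1 → t ≤ b → v ≤ t → It t e 0 x v → Settled t v → Clo base b x w u → Clo base b v w u
  Clo-step base {b} {x} {w} {u} {t} {v} l p q i s h with Clo-to base {b} {x} {w} {u} h
  ... | _ , inj₁ h' = Clo-box base {b} {v} {w} {u} {0} {x} l (NP.≤-trans q p) h' (It-mono {t} p i)
  ... | _ , inj₂ (_ , a , k , h' , j) =
    -- Here x is already an iterated box of a member a of the base. `Settled t v` supplies the next
    -- one, since a and the count are bounded by v.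
    Clo-box base {b} {v} {w} {u} {suc k} {a} l (NP.≤-trans q p) h' (It-mono {t} p (subst (It t e (suc k) a) (sym v≡)
      (settled-It {t} {v} a (suc k) s (subst (a ≤_) (sym v≡) (boxes-≥ᵃ e (2 N.+ k) a))
         (subst (suc k ≤_) (sym v≡) (NP.≤-trans (NP.n≤1+n _) (boxes-≥ᵏ e (2 N.+ k) a))))))
    where
    v≡ : v ≡ boxes e (2 N.+ k) a
    v≡ = trans (It-sound {t} {e} {0} {x} {v} i) (cong (box e) (It-sound {b} {e} {k} {a} {x} j))

  boxes<ngn : ∀ k a → boxes e k a < ngn (boxes e (suc k) a)
  boxes<ngn k a = NP.<-trans (box-> e (boxes e k a)) (ngn-> _)

  a≤ngn : ∀ k a → a ≤ ngn (boxes e (suc k) a)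
  a≤ngn k a = NP.≤-trans (boxes-≥ᵃ e k a) (NP.<⇒≤ (boxes<ngn k a))

  k≤ngn : ∀ k a → k ≤ ngn (boxes e (suc k) a)
  k≤ngn k a = NP.≤-trans (boxes-≥ᵏ e k a) (NP.<⇒≤ (boxes<ngn k a))

  trig-from : ∀ {w u a k} → InW a u → XTh w (ngn (boxes e (suc k) a)) → k ≡ 0 ⊎ ℓ ≡ 1 → Trig w u
  trig-from {w} {u} {a} {k} i h l = trig-intro {w} {u} {a} {k} (NP.≤-trans (a≤ngn k a) z≤w) (NP.≤-trans (k≤ngn k a) z≤w)
    (NP.≤-trans (NP.<⇒≤ (ngn-> _)) z≤w) z≤w i (settled-It {w} a k (XTh-settled {w} h) (a≤ngn k a) (k≤ngn k a)) h l
    where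
    z≤w : ngn (boxes e (suc k) a) ≤ w
    z≤w = XTh-≤ {w} h

  First-unique : ∀ {w u w' u'} → First w u → First w' u' → w' ≤ w → w' ≡ w × u' ≡ u
  First-unique {w} {u} {w'} {u'} f g p with First-min {w} {u} f {w'} {u'} p (proj₁ (jmp-to {w'} {u'} (First-jmp {w'} {u'} g))) (First-jmp {w'} {u'} g)
  ... | refl , q = refl , NP.≤-antisym (proj₂ (First-min {w} {u'} g {w} {u} NP.≤-refl (proj₁ (jmp-to {w} {u} (First-jmp {w} {u} f))) (First-jmp {w} {u} f))) q

  first-exists : ∀ {w u} → Jmp w u → ∃₂ First
  first-exists {w} {u} = NI.<-rec (λ w → ∀ u → Jmp w u → ∃₂ First) go w u
    where
    go : ∀ w → (∀ {w'} → w' < w → ∀ u → Jmp w' u → ∃₂ First) → ∀ u → Jmp w u → ∃₂ First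
    go w ih u j = earlier (NP.anyUpTo? (λ w' → NP.anyUpTo? (Jmp? w') (suc w')) w)
      where
      least : (∀ w' u' → w' < w → u' ≤ w' → ¬ Jmp w' u') → ∀ u → (∀ {u'} → u' < u → Jmp w u' → ∃₂ First) → Jmp w u → ∃₂ First
      least none u ih' j = smaller (NP.anyUpTo? (Jmp? w) u)
        where
        smaller : Dec (∃ λ u' → u' < u × Jmp w u') → ∃₂ First
        smaller (yes (u' , l , j')) = ih' l j'
        smaller (no no') = w , u , First-from {w} {u} j (λ w' u' p q j' →
          [ (λ l → ⊥-elim (none w' u' l q j'))
          , (λ { refl → refl , [ (λ l → ⊥-elim (no' (u' , l , j'))) , id ]′ (NP.<-≤-connex u' u) }) ]′ (NP.m≤n⇒m<n∨m≡n p))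
      earlier : Dec (∃ λ w' → w' < w × ∃ λ u' → u' < suc w' × Jmp w' u') → ∃₂ First
      earlier (yes (w' , l , u' , _ , j')) = ih l u' j'
      earlier (no none) = NI.<-rec (λ u → Jmp w u → ∃₂ First)
        (least (λ w' u' l q j' → none (w' , l , u' , s≤s q , j'))) u j

  Conflict : ℕ → ℕ → Set
  Conflict w u = (∃ λ x → Closed (JumpBase w u) x × JumpBase w u (ngn x)) ⊎ (∃ λ x → OutW x u × Closed (JumpBase w u) x)

  -- Every condition for a jump except compatibility is given, so compatibility fails. With `¬Jmp`
  -- this becomes the source of all conclusions drawn from a refuted box.
  no-jump-conflict : ∀ {w u a k} → InW a u → XTh w (ngn (boxes e (suc k) a)) → k ≡ 0 ⊎ ℓ ≡ 1 → u ≤ w → NoJunk u →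
                     ¬ Jmp w u → Conflict w u
  no-jump-conflict {w} {u} {a} {k} i h l p n ¬j =
    Sum.map (λ { (x , _ , q , _ , r) → x , JClo-closed {w} {x} {w} {u} q , Closed-ngn {JumpBase w u} {x} (JClo-closed {w} {ngn x} {w} {u} r) })
            (λ { (x , _ , q , r) → x , q , JClo-closed {w} {x} {w} {u} r })
    (¬Con-conflict {w} {u} (λ con → ¬j (jmp-from {w} {u} p n (trig-from {w} {u} {a} {k} i h l) con)))

  -- A jump at stage w would make T refute a formula PrN n that PA proves.
  module AtJump (w u : ℕ) (f : First w u) where
    con : Con w u
    con = proj₂ (proj₂ (proj₂ (jmp-to {w} {u} (First-jmp {w} {u} f))))

    noJunk : NoJunk u
    noJunk = proj₁ (proj₂ (jmp-to {w} {u} (First-jmp {w} {u} f)))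

    u≤w : u ≤ w
    u≤w = proj₁ (jmp-to {w} {u} (First-jmp {w} {u} f))

    set→clo : ∀ {x} → InSet w x → JClo w x w u
    set→clo {x} h = [ (λ { (w' , p , u' , _ , g , q) → move w' u' (First-unique {w} {u} {w'} {u'} f g p) q })
                    , (λ { (n , _) → ⊥-elim (n w NP.≤-refl u u≤w (First-jmp {w} {u} f)) }) ]′ (set-to {w} {x} h)
      where
      move : ∀ w' u' → w' ≡ w × u' ≡ u → JClo w x w' u' → JClo w x w u
      move w' u' (refl , refl) q = q

    clo→set : ∀ {x} → JClo w x w u → InSet w x
    clo→set {x} h = set-from {w} {x} (inj₁ (w , NP.≤-refl , u , u≤w , f , h))

    -- Before the first jump the sets hold only theorems and their boxes, and the base of the jump
    -- retains those theorems.
    earlier-set : ∀ {t} x → t < w → x ≤ w → InSet t x → InSet w x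
    earlier-set {t} x l q h = [ (λ { (w' , p , u' , r , g , _) → ⊥-elim (NP.<-irrefl
        (proj₁ (First-min {w} {u} f {w'} {u'} (NP.≤-trans p (NP.<⇒≤ l)) r (First-jmp {w'} {u'} g))) (NP.≤-<-trans p l)) })
      , (λ { (_ , k) → clo→set {x} ([ base , boxed ]′ (proj₂ (Clo-to stageBaseB {t} {x} {0} {0} k))) }) ]′ (set-to {t} {x} h)
      where
      base : Base stageBaseB t x 0 0 → JClo w x w u
      base k = Clo-base jumpBaseB {w} {x} {w} {u} q (jumpBase-from {w} {x} {w} {u} (inj₁ (Before-from {t} {w} {x} l (stageBase-to {t} {x} {0} {0} k))))
      boxed : (ℓ ≡ 1 × ∃₂ λ a k → Base stageBaseB t a 0 0 × It t e k a x) → JClo w x w u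
      boxed (m , a , k , k' , i) = Clo-box jumpBaseB {w} {x} {w} {u} {k} {a} m q
        (jumpBase-from {w} {a} {w} {u} (inj₁ (Before-from {t} {w} {a} l (stageBase-to {t} {a} {0} {0} k')))) (It-mono {t} {w} (NP.<⇒≤ l) i)

    JumpBase-junk : ∀ {s} → JumpBase w u (junk s) → u ≡ s N.+ s
    JumpBase-junk {s} (inj₁ h) = ⊥-elim (¬Prov-junk {s} (Before-prov {w} {junk s} h))
    JumpBase-junk {s} (inj₂ h) = noJunk-to {u} noJunk {s} h

    jumped-here : ∀ {s} → Jumped w s → u ≡ s N.+ s
    jumped-here {s} h with jumped-to {w} {s} h
    ... | w' , p , g = sym (proj₂ (First-unique {w} {u} {w'} {s N.+ s} f g p))

    -- The conditions on a jump are tailored to this: compatibility yields the second check and the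
    -- negative half of the fifth, and `noJunkB` yields the fourth.
    check : Check w
    check = check-from {w}
      (λ t p x q h → [ (λ l → earlier-set {t} x l q h) , (λ r → subst (λ k → InSet k x) r h) ]′ (NP.m≤n⇒m<n∨m≡n p))
      (λ x p q h h' → con₁ {w} {u} con (x , p , set→clo {x} h , q , set→clo {ngn x} h'))
      (λ t p x q v r l i s h → clo→set {v} (Clo-step jumpBaseB {w} {x} {w} {u} {t} {v} l p r i s (set→clo {x} h)))
      (λ s p q h → let u≡ = JumpBase-junk {s} (Closed-junk {JumpBase w u} {s} (JClo-closed {w} {junk s} {w} {u} (set→clo {junk s} h))) in
         jumped-from {w} {s} {w} NP.≤-refl (subst (_≤ w) u≡ u≤w) (subst (First w) u≡ f))
      (λ s p h x q → let u≡ = jumped-here {s} h ; x≤w = NP.≤-trans q p in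
         (λ pos → clo→set {x} (Clo-base jumpBaseB {w} {x} {w} {u} x≤w (jumpBase-from {w} {x} {w} {u} (inj₂ (subst (InW x) (sym u≡) (InW-pos {x} {s} pos)))))) ,
         (λ ng k → con₂ {w} {u} con (x , x≤w , subst (OutW x) (sym u≡) (OutW-from {x} {s} ng) , set→clo {x} k)))

    member : ∀ a k → InW a u → k ≡ 0 ⊎ ℓ ≡ 1 → XTh w (ngn (boxes e (suc k) a)) → boxes e k a ≤ w → JClo w (boxes e k a) w u
    member a zero    i l h p = Clo-base jumpBaseB {w} {a} {w} {u} p (jumpBase-from {w} {a} {w} {u} (inj₂ i))
    member a (suc k) i (inj₂ l) h p = Clo-box jumpBaseB {w} {boxes e (suc k) a} {w} {u} {k} {a} l p (jumpBase-from {w} {a} {w} {u} (inj₂ i))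
      (settled-It {w} a k (XTh-settled {w} h) (a≤ngn (suc k) a) (NP.≤-trans (NP.n≤1+n k) (k≤ngn (suc k) a)))

    absurd : ⊥
    absurd with trig-to {w} {u} (proj₁ (proj₂ (proj₂ (jmp-to {w} {u} (First-jmp {w} {u} f)))))
    ... | a , k , i , l , h = Prov-consistent {box e (boxes e k a)}
          (PrN n , sym (gn-PrN n) , T-ext _ (PrN-intro w n (body-from {w} {n} check (clo→set {n} (member a k i l h n≤w))))) (XTh-prov {w} h)
      where
      n : ℕ
      n = boxes e k a
      n≤w : n ≤ w
      n≤w = NP.≤-trans (NP.<⇒≤ (boxes<ngn k a)) (XTh-≤ {w} h)

  ¬Jmp : ∀ w u → ¬ Jmp w u
  ¬Jmp w u j with first-exists {w} {u} j
  ... | w' , u' , f = AtJump.absurd w' u' f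

  set→SClo : ∀ {b x} → InSet b x → SClo b x
  set→SClo {b} {x} h = [ (λ { (w , _ , u , _ , f , _) → ⊥-elim (¬Jmp w u (First-jmp {w} {u} f)) }) , proj₂ ]′ (set-to {b} {x} h)

  SClo→set : ∀ {b x} → SClo b x → InSet b x
  SClo→set {b} {x} h = set-from {b} {x} (inj₂ ((λ w _ u _ → ¬Jmp w u) , h))

  box-shrinks : ∀ {γ i} → γ ≢ ngn (boxes e i γ)
  box-shrinks {γ} {i} q = NP.<⇒≢ (NP.≤-<-trans (boxes-≥ᵃ e i γ) (ngn-> (boxes e i γ))) q

  -- No stage contains γ together with the negation of an iterated box of γ: by
  -- induction on the stage t, on γ and on the stage of the negation, otherwise
  -- there would be a jump to the world of γ.
  coherent : ℓ ≡ 1 → ∀ t γ w k → w ≤ t → XTh t γ → ¬ XTh w (ngn (boxes e (suc k) γ))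
  coherent l = NI.<-rec (λ t → ∀ γ w k → w ≤ t → XTh t γ → ¬ XTh w (ngn (boxes e (suc k) γ))) (λ t ih₁ →
    NI.<-rec (λ γ → ∀ w k → w ≤ t → XTh t γ → ¬ XTh w (ngn (boxes e (suc k) γ))) (λ γ ih₂ →
      NI.<-rec (λ w → ∀ k → w ≤ t → XTh t γ → ¬ XTh w (ngn (boxes e (suc k) γ))) (λ w ih₃ k p h n →
        no-conflict t γ w k p h n ih₁ ih₂ ih₃)))
    where
    no-conflict : ∀ t γ w k → w ≤ t → XTh t γ → XTh w (ngn (boxes e (suc k) γ)) →
             (∀ {t'} → t' < t → ∀ γ w k → w ≤ t' → XTh t' γ → ¬ XTh w (ngn (boxes e (suc k) γ))) →
             (∀ {γ'} → γ' < γ → ∀ w k → w ≤ t → XTh t γ' → ¬ XTh w (ngn (boxes e (suc k) γ'))) →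
             (∀ {w'} → w' < w → ∀ k → w' ≤ t → XTh t γ → ¬ XTh w' (ngn (boxes e (suc k) γ))) → ⊥
    no-conflict t γ w k p h n ih₁ ih₂ ih₃ = [ first , second ]′ (no-jump-conflict {w} {u} {γ} {k} (InW-odd γ) n (inj₂ l) u≤w
        (NoJunk-odd {γ} (λ s q → ¬Prov-junk {s} (subst Prov q Pγ))) (¬Jmp w u))
      where
      u : ℕ
      u = suc (γ N.+ γ)
      Pγ : Prov γ
      Pγ = XTh-prov {t} h
      u≤w : u ≤ w
      u≤w = NP.≤-trans (NP.≤-trans (s≤s (NP.+-mono-≤ (boxes-≥ᵃ e (suc k) γ) (boxes-≥ᵃ e (suc k) γ))) (ngn-≥-odd _)) (XTh-≤ {w} n)
      second : (∃ λ x → OutW x u × Closed (JumpBase w u) x) → ⊥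
      second (x , o , _) with OutW-to {x} {u} o
      ... | s , q , _ = double-odd s γ (sym q)
      prov-base : ∀ a → JumpBase w u a → Prov a
      prov-base a (inj₁ q) = Before-prov {w} {a} q
      prov-base a (inj₂ q) = subst Prov (sym (InW-odd-to {a} {γ} q)) Pγ
      first : (∃ λ x → Closed (JumpBase w u) x × JumpBase w u (ngn x)) → ⊥
      first (x , (zero , a , _ , q , refl) , z) = Prov-consistent {a} (prov-base a q) (prov-base (ngn a) z)
      -- Both theorems were proved before w, hence before t: the induction on t applies.
      first (x , (suc i , a , _ , inj₁ q , refl) , inj₁ z) with Before-to {w} {a} q | Before-to {w} {ngn (boxes e (suc i) a)} z
      ... | w₁ , l₁ , q₁ | w₂ , l₂ , z₂ = ih₁ {w₁ ⊔ w₂} (NP.<-≤-trans (NP.⊔-lub l₁ l₂) p) a w₂ i (NP.m≤n⊔m w₁ w₂) (XTh-mono {w₁} (NP.m≤m⊔n w₁ w₂) q₁) z₂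
      -- The negation is γ itself. Then γ plays the part of the negated box of the smaller number a,
      -- at stage t.
      first (x , (suc i , a , _ , inj₁ q , refl) , inj₂ z) with Before-to {w} {a} q | InW-odd-to {ngn (boxes e (suc i) a)} {γ} z
      ... | w₁ , l₁ , q₁ | refl = ih₂ (NP.≤-<-trans (boxes-≥ᵃ e (suc i) a) (ngn-> _)) t i NP.≤-refl (XTh-mono {w₁} (NP.≤-trans (NP.<⇒≤ l₁) p) q₁) h
      first (x , (suc i , a , _ , inj₂ q , refl) , z) with InW-odd-to {a} {γ} q
      -- The boxed number is γ and its negated box is an earlier theorem: the induction on w
      -- applies.
      first (x , (suc i , a , _ , inj₂ q , refl) , inj₁ z) | refl with Before-to {w} {ngn (boxes e (suc i) a)} z
      ... | w₂ , l₂ , z₂ = ih₃ l₂ i (NP.≤-trans (NP.<⇒≤ l₂) p) h z₂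
      first (x , (suc i , a , _ , inj₂ q , refl) , inj₂ z) | refl = box-shrinks {a} {suc i} (sym (InW-odd-to {ngn (boxes e (suc i) a)} {a} z))

  -- Without jumps each set is the closure of the theorems. The fourth and fifth check are then
  -- vacuous, and the second is the consistency of T or, for boxes, `coherent`.
  check-holds : ∀ b → Check b
  check-holds b = check-from {b}
    (λ t p x q h → SClo→set {b} {x} (grow t p x q (set→SClo {t} {x} h)))
    (λ x p q h h' → separate x (SClo-closed {b} {x} (set→SClo {b} {x} h))
       (Closed-ngn {XTh b} {x} (SClo-closed {b} {ngn x} (set→SClo {b} {ngn x} h'))))
    (λ t p x q v r l i s h → SClo→set {b} {v} (Clo-step stageBaseB {b} {x} {0} {0} {t} {v} l p r i s (set→SClo {b} {x} h)))
    (λ s p q h → ⊥-elim (¬Prov-junk {s} (XTh-prov {b} (Closed-junk {XTh b} {s} (SClo-closed {b} {junk s} (set→SClo {b} {junk s} h))))))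
    (λ s p h → ⊥-elim (no-jumped s (jumped-to {b} {s} h)))
    where
    no-jumped : ∀ s → (∃ λ w → w ≤ b × First w (s N.+ s)) → ⊥
    no-jumped s (w , _ , f) = ¬Jmp w (s N.+ s) (First-jmp {w} {s N.+ s} f)
    grow : ∀ t → t ≤ b → ∀ x → x ≤ b → SClo t x → SClo b x
    grow t p x q h with Clo-to stageBaseB {t} {x} {0} {0} h
    ... | _ , inj₁ k = Clo-base stageBaseB {b} {x} {0} {0} q (stageBase-from {b} {x} {0} {0} (XTh-mono {t} p (stageBase-to {t} {x} {0} {0} k)))
    ... | _ , inj₂ (l , a , i , k , j) = Clo-box stageBaseB {b} {x} {0} {0} {i} {a} l q
          (stageBase-from {b} {a} {0} {0} (XTh-mono {t} p (stageBase-to {t} {a} {0} {0} k))) (It-mono {t} p j)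
    separate : ∀ x → Closed (XTh b) x → XTh b (ngn x) → ⊥
    separate x (zero , a , _ , q , refl) z = Prov-consistent {a} (XTh-prov {b} q) (XTh-prov {b} z)
    separate x (suc i , a , inj₂ l , q , refl) z = coherent l b a b i NP.≤-refl q z

  Prov→body : ∀ {x} → Prov x → ∃ λ b → ⟦ bodyB ⟧ (b ∷ₛ x ∷ₛ e ∷ₛ c ∷ₛ ℓ ∷ₛ λ _ → 0)
  Prov→body {x} h with XTh-complete {x} h
  ... | b , k = b , body-from {b} {x} (check-holds b) (SClo→set {b} {x}
        (Clo-base stageBaseB {b} {x} {0} {0} (XTh-≤ {b} k) (stageBase-from {b} {x} {0} {0} k)))

  Prov→PrN : ∀ {x} → Prov x → PA ⊢ PrN x
  Prov→PrN {x} h = PrN-intro (proj₁ (Prov→body {x} h)) x (proj₂ (Prov→body {x} h))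

  Prov-box : ∀ {x} → Prov x → Prov (box e x)
  Prov-box {x} h = PrN x , sym (gn-PrN x) , T-ext _ (Prov→PrN {x} h)

  Prov-boxes : ∀ k {x} → Prov x → Prov (boxes e k x)
  Prov-boxes zero    h = h
  Prov-boxes (suc k) {x} h = Prov-box {boxes e k x} (Prov-boxes k {x} h)

  -- In ND4 a member may be an iterated box of a theorem; it is a theorem too, because PA proves the
  -- box of every theorem.
  body→Prov : ∀ {b x} → ⟦ bodyB ⟧ (b ∷ₛ x ∷ₛ e ∷ₛ c ∷ₛ ℓ ∷ₛ λ _ → 0) → Prov x
  body→Prov {b} {x} h with SClo-closed {b} {x} (set→SClo {b} {x} (body-to {b} {x} h))
  ... | i , a , _ , k , refl = Prov-boxes i {a} (XTh-prov {b} {a} k)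

  -- Since there is no jump to the world that forces α alone, this world conflicts with the
  -- theorems. If the conflict comes from an earlier refutation of an iterated box of α, induction
  -- on the stage applies; the other possible conflicts are the two alternatives.
  refuted-box : ∀ {α} → (∀ s → α ≢ junk s) → ∀ k → k ≡ 0 ⊎ ℓ ≡ 1 → Prov (ngn (boxes e (suc k) α)) →
                Prov (ngn α) ⊎ ∃ λ β → α ≡ ngn β × Prov β
  refuted-box {α} nj k l h with XTh-complete {ngn (boxes e (suc k) α)} h
  ... | w , n = NI.<-rec (λ w → ∀ k → k ≡ 0 ⊎ ℓ ≡ 1 → XTh w (ngn (boxes e (suc k) α)) → Goal) go w k l n
    where
    Goal : Set
    Goal = Prov (ngn α) ⊎ ∃ λ β → α ≡ ngn β × Prov β
    go : ∀ w → (∀ {w'} → w' < w → ∀ k → k ≡ 0 ⊎ ℓ ≡ 1 → XTh w' (ngn (boxes e (suc k) α)) → Goal) →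
         ∀ k → k ≡ 0 ⊎ ℓ ≡ 1 → XTh w (ngn (boxes e (suc k) α)) → Goal
    go w ih k l n = [ first , second ]′ (no-jump-conflict {w} {u} {α} {k} (InW-odd α) n l u≤w (NoJunk-odd {α} nj) (¬Jmp w u))
      where
      u : ℕ
      u = suc (α N.+ α)
      u≤w : u ≤ w
      u≤w = NP.≤-trans (NP.≤-trans (s≤s (NP.+-mono-≤ (boxes-≥ᵃ e (suc k) α) (boxes-≥ᵃ e (suc k) α))) (ngn-≥-odd _)) (XTh-≤ {w} n)
      second : (∃ λ x → OutW x u × Closed (JumpBase w u) x) → Goal
      second (x , o , _) with OutW-to {x} {u} o
      ... | s , q , _ = ⊥-elim (double-odd s α (sym q))
      first : (∃ λ x → Closed (JumpBase w u) x × JumpBase w u (ngn x)) → Goal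
      first (x , (i , a , _ , inj₁ q , refl) , inj₁ z) = ⊥-elim (Prov-consistent {boxes e i a}
        (Prov-boxes i {a} (Before-prov {w} {a} q)) (Before-prov {w} {ngn (boxes e i a)} z))
      first (x , (i , a , _ , inj₁ q , refl) , inj₂ z) =
        inj₂ (boxes e i a , sym (InW-odd-to {ngn (boxes e i a)} {α} z) , Prov-boxes i {a} (Before-prov {w} {a} q))
      first (x , (i , a , _ , inj₂ q , refl) , inj₂ z) with InW-odd-to {a} {α} q
      ... | refl = ⊥-elim (box-shrinks {a} {i} (sym (InW-odd-to {ngn (boxes e i a)} {a} z)))
      first (x , (i , a , m , inj₂ q , refl) , inj₁ z) with InW-odd-to {a} {α} q
      first (x , (zero  , a , m , inj₂ q , refl) , inj₁ z) | refl = inj₁ (Before-prov {w} {ngn a} z)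
      first (x , (suc i , a , inj₂ m , inj₂ q , refl) , inj₁ z) | refl with Before-to {w} {ngn (boxes e (suc i) a)} z
      ... | w' , l' , z' = ih l' i (inj₂ m) z'

  -- What is left of an incompatibility of the world 2s once the stages have been eliminated. In
  -- `blocked` each case turns out impossible or yields a refutation of the valuation in the logic.
  data Obstruction (s : ℕ) : Set where
    pos-ngn-prov : ∀ x → Prov x → Pos (ngn x) s → Obstruction s
    pos-refuted  : ∀ x → Pos x s → Prov (ngn x) → Obstruction s
    pos-pos      : ∀ x i → i ≡ 0 ⊎ ℓ ≡ 1 → Pos x s → Pos (ngn (boxes e i x)) s → Obstruction s
    pos-junk     : ∀ i → Pos (ngn (boxes e i (junk s))) s → Obstruction s
    neg-prov     : ∀ x → Prov x → Neg x s → Obstruction s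
    neg-pos      : ∀ x i → i ≡ 0 ⊎ ℓ ≡ 1 → Pos x s → Neg (boxes e i x) s → Obstruction s
    neg-junk     : ∀ i → Neg (boxes e i (junk s)) s → Obstruction s

  -- PrN (junk s) says that the world 2s has been chosen.
  refuted-world : ∀ s → (∀ t → ¬ Pos (junk t) s) → ∀ k → k ≡ 0 ⊎ ℓ ≡ 1 → Prov (ngn (boxes e (suc k) (junk s))) → Obstruction s
  refuted-world s nj k l h with XTh-complete {ngn (boxes e (suc k) (junk s))} h
  ... | w , n = NI.<-rec (λ w → ∀ k → k ≡ 0 ⊎ ℓ ≡ 1 → XTh w (ngn (boxes e (suc k) (junk s))) → Obstruction s) go w k l n
    where
    u : ℕ
    u = s N.+ s
    go : ∀ w → (∀ {w'} → w' < w → ∀ k → k ≡ 0 ⊎ ℓ ≡ 1 → XTh w' (ngn (boxes e (suc k) (junk s))) → Obstruction s) →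
         ∀ k → k ≡ 0 ⊎ ℓ ≡ 1 → XTh w (ngn (boxes e (suc k) (junk s))) → Obstruction s
    go w ih k l n = [ first , second ]′ (no-jump-conflict {w} {u} {junk s} {k} (InW-junk s) n l u≤w (NoJunk-even {s} nj) (¬Jmp w u))
      where
      u≤w : u ≤ w
      u≤w = NP.≤-trans (double≤junk s) (NP.≤-trans (a≤ngn k (junk s)) (XTh-≤ {w} n))
      base : ∀ {a} → JumpBase w u a → Prov a ⊎ Pos a s ⊎ a ≡ junk s
      base {a} (inj₁ q) = inj₁ (Before-prov {w} {a} q)
      base {a} (inj₂ q) = inj₂ (InW-even-to {a} {s} q)
      second : (∃ λ x → OutW x u × Closed (JumpBase w u) x) → Obstruction s
      second (x , o , i , a , m , q , r) with OutW-to {x} {u} o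
      ... | s' , d , ng with double-inj {s} {s'} d
      ...   | refl = out (base {a} q)
        where
        ng' : Neg (boxes e i a) s
        ng' = subst (λ y → Neg y s) r ng
        out : Prov a ⊎ Pos a s ⊎ a ≡ junk s → Obstruction s
        out (inj₁ p)           = neg-prov (boxes e i a) (Prov-boxes i {a} p) ng'
        out (inj₂ (inj₁ p))    = neg-pos a i m p ng'
        out (inj₂ (inj₂ refl)) = neg-junk i ng'
      first : (∃ λ x → Closed (JumpBase w u) x × JumpBase w u (ngn x)) → Obstruction s
      first (x , (i , a , m , q , refl) , z) = both i m (base {a} q) z
        where
        forced : ∀ {y} → JumpBase w u (ngn y) → Before w (ngn y) ⊎ Pos (ngn y) s
        forced (inj₁ z) = inj₁ z
        forced {y} (inj₂ z) = [ inj₂ , (λ j → ⊥-elim (ngn≢junk {y} {s} j)) ]′ (InW-even-to {ngn y} {s} z)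
        refuted : ∀ {i} → i ≡ 0 ⊎ ℓ ≡ 1 → Pos a s → Prov (ngn (boxes e i a)) → Obstruction s
        refuted {zero}  m p q = pos-refuted a p q
        -- A refuted iterated box is traced back to a itself, so no constructor has to mention it.
        refuted {suc i} (inj₂ m) p q = [ pos-refuted a p , (λ { (β , r , d) → pos-ngn-prov β d (subst (λ y → Pos y s) r p) }) ]′
          (refuted-box {a} (λ t j → nj t (subst (λ y → Pos y s) j p)) i (inj₂ m) q)
        both : ∀ i → i ≡ 0 ⊎ ℓ ≡ 1 → Prov a ⊎ Pos a s ⊎ a ≡ junk s → JumpBase w u (ngn (boxes e i a)) → Obstruction s
        both i m b z = combine b (forced {boxes e i a} z)
          where
          combine : Prov a ⊎ Pos a s ⊎ a ≡ junk s → Before w (ngn (boxes e i a)) ⊎ Pos (ngn (boxes e i a)) s → Obstruction s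
          combine (inj₁ p)           (inj₁ z) = ⊥-elim (Prov-consistent {boxes e i a} (Prov-boxes i {a} p) (Before-prov {w} {ngn (boxes e i a)} z))
          combine (inj₁ p)           (inj₂ z) = pos-ngn-prov (boxes e i a) (Prov-boxes i {a} p) z
          combine (inj₂ (inj₁ p))    (inj₁ z) = refuted m p (Before-prov {w} {ngn (boxes e i a)} z)
          combine (inj₂ (inj₁ p))    (inj₂ z) = pos-pos a i m p z
          -- The name is no formula, so its negation is no theorem. A refuted box of the name is the
          -- initial situation again, at an earlier stage.
          combine (inj₂ (inj₂ refl)) (inj₁ z) = named i m (Before-to {w} {ngn (boxes e i (junk s))} z)
            where
            named : ∀ i → i ≡ 0 ⊎ ℓ ≡ 1 → (∃ λ w' → w' < w × XTh w' (ngn (boxes e i (junk s)))) → Obstruction s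
            named zero    m (w' , _ , q) = ⊥-elim (¬Prov-ngn-0-0 {s N.+ s} (XTh-prov {w'} q))
            named (suc i) (inj₂ m) (w' , l' , q) = ih l' i (inj₂ m) q
          combine (inj₂ (inj₂ refl)) (inj₂ z) = pos-junk i z

-- Reasoning in PA about the provability predicate

sargs : (ℕ → Term) → List ℕ → ℕ → Term
sargs σ []       = λ _ → zer
sargs σ (i ∷ is) = σ i ∷ₛ sargs σ is

subF-args : ∀ σ is φ → subF σ (subF (args is) φ) ≡ subF (sargs σ is) φ
subF-args σ is φ = trans (subF-subF σ (args is) φ) (subF-ext (go is) φ)
  where
  go : ∀ is i → subT σ (args is i) ≡ sargs σ is i
  go []       i       = refl
  go (j ∷ is) zero    = refl
  go (j ∷ is) (suc i) = go is i

∀≤-at : ∀ σ i φ t → PA ⊢ subF σ (formula (∀≤ i φ)) ⇒ le t (σ i) ⇒ subF (t ∷ₛ σ) (formula φ)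
∀≤-at σ i φ t = ∀-at σ (le (var 0) (var (suc i)) ⇒ formula φ) t

leq⇒le : ∀ σ i j → PA ⊢ subF σ (formula (leq i j)) ⇒ le (σ i) (σ j)
leq⇒le σ i j = ∃-rule (⇒-trans (⇒-app (⇒-trans (∧-snd ⇒-refl) (≐-subst (shiftT (σ j) ∷ₛ var) (le (var 0) (var 1)) (var 0) (shiftT (σ i)))) (∧-fst ⇒-refl))
  (≡⇒ (sym (shiftF-le (σ i) (σ j)))))

le⇒leq : ∀ σ i j → PA ⊢ le (σ i) (σ j) ⇒ subF σ (formula (leq i j))
le⇒leq σ i j = ⇒-trans (∧-intro ⇒-refl (⇒-const (eq-refl (σ i)))) (∃-at σ (le (var 0) (var (suc j)) ∧' (var 0 ≐ var (suc i))) (σ i))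

module Predicate (c ℓ : ℕ) where

  -- The place where self-reference is prepared: variable 1 stands for the matrix number and is left
  -- free, so `e` can be defined as the number of `Ψ`. Variable 0 is the number said to be provable
  -- and variable 4 the stage.
  Ψ : Formula
  Ψ = (var 2 ≐ num c) ∧' ((var 3 ≐ num ℓ) ∧' subF (args (4 ∷ 0 ∷ 1 ∷ 2 ∷ 3 ∷ [])) (formula bodyB))

  e : ℕ
  e = gn Ψ

  matrix : Term → Formula
  matrix t = (var 0 ≐ t) ∧' ((var 1 ≐ num e) ∧' Ψ)

  Pr : Formula
  Pr = ∃' (∃' (∃' (∃' (∃' (matrix (var 5))))))

  -- The instance of `Pr` at a numeral, written without a substitution so that its number is
  -- `box e n` by computation.
  PrN : ℕ → Formula
  PrN n = ∃' (∃' (∃' (∃' (∃' (matrix (num n))))))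

  gn-box : ∀ n → gn (PrN n) ≡ box e n
  gn-box n = refl

  args-closed : ∀ i → ClosedT 5 (args (4 ∷ 0 ∷ 1 ∷ 2 ∷ 3 ∷ []) i)
  args-closed 0 = s≤s (s≤s (s≤s (s≤s (s≤s z≤n))))
  args-closed 1 = s≤s z≤n
  args-closed 2 = s≤s (s≤s z≤n)
  args-closed 3 = s≤s (s≤s (s≤s z≤n))
  args-closed 4 = s≤s (s≤s (s≤s (s≤s z≤n)))
  args-closed (suc (suc (suc (suc (suc i))))) = tt

  Ψ-closed : ClosedF 5 Ψ
  Ψ-closed = (s≤s (s≤s (s≤s z≤n)) , ClosedT-num {5} c) , (s≤s (s≤s (s≤s (s≤s z≤n))) , ClosedT-num {5} ℓ) ,
    ClosedF-subF {5} {args (4 ∷ 0 ∷ 1 ∷ 2 ∷ 3 ∷ [])} args-closed (formula bodyB)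

  Pr-closed : ClosedF 1 Pr
  Pr-closed = (s≤s z≤n , s≤s (s≤s (s≤s (s≤s (s≤s (s≤s z≤n)))))) , (s≤s (s≤s z≤n) , ClosedT-num {6} e) ,
    (s≤s (s≤s (s≤s z≤n)) , ClosedT-num {6} c) , (s≤s (s≤s (s≤s (s≤s z≤n))) , ClosedT-num {6} ℓ) ,
    ClosedF-subF {6} {args (4 ∷ 0 ∷ 1 ∷ 2 ∷ 3 ∷ [])} (λ i → weaken (args (4 ∷ 0 ∷ 1 ∷ 2 ∷ 3 ∷ []) i) (args-closed i)) (formula bodyB)
    where
    weaken : ∀ t → ClosedT 5 t → ClosedT 6 t
    weaken (var k)  p = NP.m≤n⇒m≤1+n p
    weaken zer      p = tt
    weaken (suc' t) p = weaken t p
    weaken (s +' t) (p , q) = weaken s p , weaken t q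
    weaken (s *' t) (p , q) = weaken s p , weaken t q

  PrN-closed : ∀ n → Sentence (PrN n)
  PrN-closed n = (s≤s z≤n , ClosedT-num {5} n) , (s≤s (s≤s z≤n) , ClosedT-num {5} e) , Ψ-closed

  Pr-Σ1 : Σ1 Pr
  Pr-Σ1 = ex (ex (ex (ex (ex (δ0 (conj (atom _ _) (conj (atom _ _) (conj (atom _ _) (conj (atom _ _)
    (Δ0-formula (args (4 ∷ 0 ∷ 1 ∷ 2 ∷ 3 ∷ [])) bodyB))))))))))

  Pr-num : ∀ n → Pr [ num n ] ≡ PrN n
  Pr-num n = cong (λ φ → ∃' (∃' (∃' (∃' (∃' φ))))) (cong₂ _∧'_ (cong (var 0 ≐_) shifts)
    (cong₂ _∧'_ (cong (var 1 ≐_) (subT-num _ e)) (subF-closed {5} fixes Ψ Ψ-closed)))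
    where
    shifts : shiftT (shiftT (shiftT (shiftT (shiftT (num n))))) ≡ num n
    shifts = trans (cong (shiftT ∘ shiftT ∘ shiftT ∘ shiftT) (shiftT-num n)) (trans (cong (shiftT ∘ shiftT ∘ shiftT) (shiftT-num n))
      (trans (cong (shiftT ∘ shiftT) (shiftT-num n)) (trans (cong shiftT (shiftT-num n)) (shiftT-num n))))
    fixes : ∀ i → i < 5 → liftS (liftS (liftS (liftS (liftS (single (num n)))))) i ≡ var i
    fixes = liftS-closed {4} (liftS-closed {3} (liftS-closed {2} (liftS-closed {1} (liftS-closed {0} (λ i ())))))

  envS : Term → Term → ℕ → Term
  envS B X = B ∷ₛ X ∷ₛ num e ∷ₛ num c ∷ₛ num ℓ ∷ₛ λ _ → zer

  envC : Term → ℕ → Term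
  envC B = B ∷ₛ num e ∷ₛ num c ∷ₛ num ℓ ∷ₛ λ _ → zer

  Body : Term → ℕ → Formula
  Body B n = subF (envS B (num n)) (formula bodyB)

  CheckF : Term → Formula
  CheckF B = subF (envC B) (formula checkB)

  SetF : Term → ℕ → Formula
  SetF B n = subF (envS B (num n)) (formula setB)

  opaque
    unfolding bodyB
    Body-eq : ∀ B n → Body B n ≡ CheckF B ∧' (subF (envS B (num n)) (formula (leq 1 0)) ∧' SetF B n)
    Body-eq B n = cong₂ _∧'_ (subF-args (envS B (num n)) (0 ∷ 2 ∷ 3 ∷ 4 ∷ []) (formula checkB))
      (cong₂ _∧'_ refl (subF-args (envS B (num n)) (0 ∷ 1 ∷ 2 ∷ 3 ∷ 4 ∷ []) (formula setB)))

  Body-check : ∀ B n → PA ⊢ Body B n ⇒ CheckF B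
  Body-check B n = ⇒-trans (≡⇒ (Body-eq B n)) (∧-fst ⇒-refl)

  Body-le : ∀ B n → PA ⊢ Body B n ⇒ le (num n) B
  Body-le B n = ⇒-trans (≡⇒ (Body-eq B n)) (⇒-trans (∧-fst (∧-snd ⇒-refl)) (leq⇒le (envS B (num n)) 1 0))

  Body-set : ∀ B n → PA ⊢ Body B n ⇒ SetF B n
  Body-set B n = ⇒-trans (≡⇒ (Body-eq B n)) (∧-snd (∧-snd ⇒-refl))

  Body-intro : ∀ {η} B n → PA ⊢ η ⇒ CheckF B → PA ⊢ η ⇒ le (num n) B → PA ⊢ η ⇒ SetF B n → PA ⊢ η ⇒ Body B n
  Body-intro B n p q r = ⇒-trans (∧-intro p (∧-intro (⇒-trans q (le⇒leq (envS B (num n)) 1 0)) r)) (≡⇒ (sym (Body-eq B n)))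

  opaque
    Body-PrN : ∀ B n → PA ⊢ Body B n ⇒ PrN n
    Body-PrN B n = ⇒-trans (⇒-trans all (≡⇒ (sym M-eq))) (⇒-trans (∃-at (num e ∷ₛ num c ∷ₛ num ℓ ∷ₛ B ∷ₛ var) M (num n))
      (⇒-trans (∃-at (num c ∷ₛ num ℓ ∷ₛ B ∷ₛ var) (∃' M) (num e)) (⇒-trans (∃-at (num ℓ ∷ₛ B ∷ₛ var) (∃' (∃' M)) (num c))
      (⇒-trans (∃-at (B ∷ₛ var) (∃' (∃' (∃' M))) (num ℓ)) (⇒-trans (∃-at var (∃' (∃' (∃' (∃' M)))) B) (≡⇒ (subF-var (PrN n))))))))
      where
      M : Formula
      M = matrix (num n)
      σ : ℕ → Term
      σ = num n ∷ₛ num e ∷ₛ num c ∷ₛ num ℓ ∷ₛ B ∷ₛ var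
      M-eq : subF σ M ≡ (num n ≐ num n) ∧' ((num e ≐ num e) ∧' ((num c ≐ num c) ∧' ((num ℓ ≐ num ℓ) ∧' Body B n)))
      M-eq = cong₂ _∧'_ (cong (num n ≐_) (subT-num σ n)) (cong₂ _∧'_ (cong (num e ≐_) (subT-num σ e))
        (cong₂ _∧'_ (cong (num c ≐_) (subT-num σ c)) (cong₂ _∧'_ (cong (num ℓ ≐_) (subT-num σ ℓ))
          (subF-args σ (4 ∷ 0 ∷ 1 ∷ 2 ∷ 3 ∷ []) (formula bodyB)))))
      all : PA ⊢ Body B n ⇒ (num n ≐ num n) ∧' ((num e ≐ num e) ∧' ((num c ≐ num c) ∧' ((num ℓ ≐ num ℓ) ∧' Body B n)))
      all = ∧-intro (⇒-const (eq-refl _)) (∧-intro (⇒-const (eq-refl _)) (∧-intro (⇒-const (eq-refl _))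
              (∧-intro (⇒-const (eq-refl _)) ⇒-refl)))

  -- One argument is exchanged at a time, as the equality axiom replaces a single variable; `args`
  -- moves the argument in question to position 0.
  replace : ∀ φ B (x₁ x₂ x₃ x₄ y₁ y₂ y₃ y₄ : Term) →
            PA ⊢ x₁ ≐ y₁ ⇒ x₂ ≐ y₂ ⇒ x₃ ≐ y₃ ⇒ x₄ ≐ y₄ ⇒
              subF (B ∷ₛ x₁ ∷ₛ x₂ ∷ₛ x₃ ∷ₛ x₄ ∷ₛ λ _ → zer) φ ⇒ subF (B ∷ₛ y₁ ∷ₛ y₂ ∷ₛ y₃ ∷ₛ y₄ ∷ₛ λ _ → zer) φ
  replace φ B x₁ x₂ x₃ x₄ y₁ y₂ y₃ y₄ = mp (mp (mp (mp (prop₄ _ _ _ _ _ _ _ _ _)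
      (at-1 x₁ y₁ x₂ x₃ x₄)) (at-2 y₁ x₂ y₂ x₃ x₄)) (at-3 y₁ y₂ x₃ y₃ x₄)) (at-4 y₁ y₂ y₃ x₄ y₄)
    where
    prop₄ : ∀ a b c d p q r s t → PA ⊢ (a ⇒ p ⇒ q) ⇒ (b ⇒ q ⇒ r) ⇒ (c ⇒ r ⇒ s) ⇒ (d ⇒ s ⇒ t) ⇒ a ⇒ b ⇒ c ⇒ d ⇒ p ⇒ t
    prop₄ a b c d p q r s t = prop ((P0 ⇒ₚ P4 ⇒ₚ P5) ⇒ₚ (P1 ⇒ₚ P5 ⇒ₚ P6) ⇒ₚ (P2 ⇒ₚ P6 ⇒ₚ P7) ⇒ₚ (P3 ⇒ₚ P7 ⇒ₚ P8) ⇒ₚ P0 ⇒ₚ P1 ⇒ₚ P2 ⇒ₚ P3 ⇒ₚ P4 ⇒ₚ P8)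
      (a ∷ b ∷ c ∷ d ∷ p ∷ q ∷ r ∷ s ∷ t ∷ [])
      where
      P0 P1 P2 P3 P4 P5 P6 P7 P8 : Prop 9
      P0 = at (# 0)
      P1 = at (# 1)
      P2 = at (# 2)
      P3 = at (# 3)
      P4 = at (# 4)
      P5 = at (# 5)
      P6 = at (# 6)
      P7 = at (# 7)
      P8 = at (# 8)
    tuple : Term → Term → Term → Term → ℕ → Term
    tuple a b c d = B ∷ₛ a ∷ₛ b ∷ₛ c ∷ₛ d ∷ₛ λ _ → zer
    at-1 : ∀ s t b c d → PA ⊢ s ≐ t ⇒ subF (tuple s b c d) φ ⇒ subF (tuple t b c d) φ
    at-1 s t b c d = ⇒-trans (≐-subst (tuple s b c d) (subF (args (1 ∷ 0 ∷ 3 ∷ 4 ∷ 5 ∷ [])) φ) s t)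
      (≡⇒ (cong₂ _⇒_ (subF-args _ (1 ∷ 0 ∷ 3 ∷ 4 ∷ 5 ∷ []) φ) (subF-args _ (1 ∷ 0 ∷ 3 ∷ 4 ∷ 5 ∷ []) φ)))
    at-2 : ∀ a s t c d → PA ⊢ s ≐ t ⇒ subF (tuple a s c d) φ ⇒ subF (tuple a t c d) φ
    at-2 a s t c d = ⇒-trans (≐-subst (tuple a s c d) (subF (args (1 ∷ 2 ∷ 0 ∷ 4 ∷ 5 ∷ [])) φ) s t)
      (≡⇒ (cong₂ _⇒_ (subF-args _ (1 ∷ 2 ∷ 0 ∷ 4 ∷ 5 ∷ []) φ) (subF-args _ (1 ∷ 2 ∷ 0 ∷ 4 ∷ 5 ∷ []) φ)))
    at-3 : ∀ a b s t d → PA ⊢ s ≐ t ⇒ subF (tuple a b s d) φ ⇒ subF (tuple a b t d) φ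
    at-3 a b s t d = ⇒-trans (≐-subst (tuple a b s d) (subF (args (1 ∷ 2 ∷ 3 ∷ 0 ∷ 5 ∷ [])) φ) s t)
      (≡⇒ (cong₂ _⇒_ (subF-args _ (1 ∷ 2 ∷ 3 ∷ 0 ∷ 5 ∷ []) φ) (subF-args _ (1 ∷ 2 ∷ 3 ∷ 0 ∷ 5 ∷ []) φ)))
    at-4 : ∀ a b c s t → PA ⊢ s ≐ t ⇒ subF (tuple a b c s) φ ⇒ subF (tuple a b c t) φ
    at-4 a b c s t = ⇒-trans (≐-subst (tuple a b c s) (subF (args (1 ∷ 2 ∷ 3 ∷ 4 ∷ 0 ∷ [])) φ) s t)
      (≡⇒ (cong₂ _⇒_ (subF-args _ (1 ∷ 2 ∷ 3 ∷ 4 ∷ 0 ∷ []) φ) (subF-args _ (1 ∷ 2 ∷ 3 ∷ 4 ∷ 0 ∷ []) φ)))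

  shiftF-Body : ∀ B n → shiftF (Body B n) ≡ Body (shiftT B) n
  shiftF-Body B n = trans (shiftF-subF (envS B (num n)) (formula bodyB)) (subF-ext go (formula bodyB))
    where
    go : ∀ i → shiftT (envS B (num n) i) ≡ envS (shiftT B) (num n) i
    go 0 = refl
    go 1 = shiftT-num n
    go 2 = shiftT-num e
    go 3 = shiftT-num c
    go 4 = shiftT-num ℓ
    go (suc (suc (suc (suc (suc i))))) = refl

  single-Body : ∀ B n → Body (var 0) n [ B ] ≡ Body B n
  single-Body B n = trans (subF-subF (single B) (envS (var 0) (num n)) (formula bodyB)) (subF-ext go (formula bodyB))
    where
    go : ∀ i → subT (single B) (envS (var 0) (num n) i) ≡ envS B (num n) i
    go 0 = refl
    go 1 = subT-num _ n
    go 2 = subT-num _ e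
    go 3 = subT-num _ c
    go 4 = subT-num _ ℓ
    go (suc (suc (suc (suc (suc i))))) = refl

  envS-closed : ∀ n i → ClosedT 1 (envS (var 0) (num n) i)
  envS-closed n 0 = s≤s z≤n
  envS-closed n 1 = ClosedT-num n
  envS-closed n 2 = ClosedT-num e
  envS-closed n 3 = ClosedT-num c
  envS-closed n 4 = ClosedT-num ℓ
  envS-closed n (suc (suc (suc (suc (suc i))))) = tt

  -- Four of the five quantifiers are tied to numerals by equations. Once these are used, the stage
  -- is the only genuine witness.
  PrN-elim : ∀ {χ} n → PA ⊢ Body (var 0) n ⇒ shiftF χ → PA ⊢ PrN n ⇒ χ
  PrN-elim n d = ⇒-trans (up (up (up (up (up inner))))) (∃-rule d)
    where
    some : Formula
    some = ∃' (Body (var 0) n)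
    some-closed : Sentence some
    some-closed = ClosedF-subF {1} {envS (var 0) (num n)} (envS-closed n) (formula bodyB)
    up : ∀ {φ} → PA ⊢ φ ⇒ some → PA ⊢ ∃' φ ⇒ some
    up d = ∃-rule (⇒-trans d (≡⇒ (sym (shiftF-sentence some some-closed))))
    inner : PA ⊢ matrix (num n) ⇒ some
    inner = ⇒-trans (⇒-app (⇒-app (⇒-app (⇒-app (⇒-app
        (⇒-const (replace (formula bodyB) (var 4) (var 0) (var 1) (var 2) (var 3) (num n) (num e) (num c) (num ℓ)))
        (∧-fst ⇒-refl)) (∧-fst (∧-snd ⇒-refl))) (∧-fst (∧-snd (∧-snd ⇒-refl)))) (∧-fst (∧-snd (∧-snd (∧-snd ⇒-refl)))))
        (∧-snd (∧-snd (∧-snd (∧-snd ⇒-refl)))))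
      (⇒-trans (≡⇒ (sym (single-Body (var 4) n))) (∃-intr (Body (var 0) n) (var 4)))

  tenv : List ℕ → ℕ → Term
  tenv []       = λ _ → zer
  tenv (x ∷ xs) = num x ∷ₛ tenv xs

  lenv : List ℕ → ℕ → ℕ
  lenv []       = λ _ → 0
  lenv (x ∷ xs) = x ∷ₛ lenv xs

  tenv-num : ∀ xs i → num (lenv xs i) ≡ tenv xs i
  tenv-num []       i       = refl
  tenv-num (x ∷ xs) zero    = refl
  tenv-num (x ∷ xs) (suc i) = tenv-num xs i

  proveL : ∀ φ xs → ⟦ φ ⟧ (lenv xs) → PA ⊢ subF (tenv xs) (formula φ)
  proveL φ xs h = conv (subF-ext (tenv-num xs) (formula φ)) (prove φ (lenv xs) h)

  refuteL : ∀ φ xs → ¬ ⟦ φ ⟧ (lenv xs) → PA ⊢ ¬' subF (tenv xs) (formula φ)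
  refuteL φ xs h = conv (cong ¬'_ (subF-ext (tenv-num xs) (formula φ))) (refute φ (lenv xs) h)

  Holds : ℕ → ℕ → Set
  Holds b n = ⟦ bodyB ⟧ (b ∷ₛ n ∷ₛ e ∷ₛ c ∷ₛ ℓ ∷ₛ λ _ → 0)

  Body-num : ∀ b n → Holds b n → PA ⊢ Body (num b) n
  Body-num b n = proveL bodyB (b ∷ n ∷ e ∷ c ∷ ℓ ∷ [])

  ¬Body-num : ∀ b n → ¬ Holds b n → PA ⊢ ¬' Body (num b) n
  ¬Body-num b n = refuteL bodyB (b ∷ n ∷ e ∷ c ∷ ℓ ∷ [])

  Holds? : ∀ b n → Dec (Holds b n)
  Holds? b n = ⟦ bodyB ⟧? (b ∷ₛ n ∷ₛ e ∷ₛ c ∷ₛ ℓ ∷ₛ λ _ → 0)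

  PrN-intro : ∀ b n → Holds b n → PA ⊢ PrN n
  PrN-intro b n h = mp (Body-PrN (num b) n) (Body-num b n h)

  -- The term B may denote a nonstandard stage; η collects the hypotheses under which it passes its
  -- checks.
  module _ {η : Formula} (B : Term) (chk : PA ⊢ η ⇒ CheckF B) where
    σ : ℕ → Term
    σ = envC B

    JumpedF : ℕ → Formula
    JumpedF s = subF (B ∷ₛ num s ∷ₛ num e ∷ₛ num c ∷ₛ num ℓ ∷ₛ λ _ → zer) (formula jumpedB)

    opaque
      unfolding checkB
      use₁ : PA ⊢ η ⇒ subF σ (formula check₁)
      use₁ = ∧-fst chk

      use₂ : PA ⊢ η ⇒ subF σ (formula check₂)
      use₂ = ∧-fst (∧-snd chk)

      use₃ : PA ⊢ η ⇒ subF σ (formula check₃)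
      use₃ = ∧-fst (∧-snd (∧-snd chk))

      use₄ : PA ⊢ η ⇒ subF σ (formula check₄)
      use₄ = ∧-fst (∧-snd (∧-snd (∧-snd chk)))

      use₅ : PA ⊢ η ⇒ subF σ (formula check₅)
      use₅ = ∧-snd (∧-snd (∧-snd (∧-snd chk)))

    bounded-at : ∀ τ i φ t → PA ⊢ η ⇒ subF τ (formula (∀≤ i φ)) → PA ⊢ η ⇒ le t (τ i) → PA ⊢ η ⇒ subF (t ∷ₛ τ) (formula φ)
    bounded-at τ i φ t d l = ⇒-app (⇒-trans d (∀≤-at τ i φ t)) l

    call-to : ∀ τ φ is → PA ⊢ η ⇒ subF τ (formula (call φ is)) → PA ⊢ η ⇒ subF (sargs τ is) (formula φ)
    call-to τ φ is d = ⇒-trans d (≡⇒ (subF-args τ is (formula φ)))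

    call-from : ∀ τ φ is → PA ⊢ η ⇒ subF (sargs τ is) (formula φ) → PA ⊢ η ⇒ subF τ (formula (call φ is))
    call-from τ φ is d = ⇒-trans d (≡⇒ (sym (subF-args τ is (formula φ))))

    set-grows : ∀ t n → PA ⊢ η ⇒ le t B → PA ⊢ η ⇒ le (num n) t → PA ⊢ η ⇒ SetF t n → PA ⊢ η ⇒ le (num n) B ∧' SetF B n
    set-grows t n l m d = ∧-intro (⇒-trans (∧-fst both) (leq⇒le τ 0 2)) (call-to τ setB (2 ∷ 0 ∷ 3 ∷ 4 ∷ 5 ∷ []) (∧-snd both))
      where
      τ : ℕ → Term
      τ = num n ∷ₛ t ∷ₛ σ
      both : PA ⊢ η ⇒ subF τ (formula (leq 0 2 ∧ᵇ call setB (2 ∷ 0 ∷ 3 ∷ 4 ∷ 5 ∷ [])))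
      both = ⇒-app (bounded-at (t ∷ₛ σ) 0 (call setB (1 ∷ 0 ∷ 3 ∷ 4 ∷ 5 ∷ []) ⇒ᵇ leq 0 2 ∧ᵇ call setB (2 ∷ 0 ∷ 3 ∷ 4 ∷ 5 ∷ [])) (num n)
        (bounded-at σ 0 (∀≤ 0 (call setB (1 ∷ 0 ∷ 3 ∷ 4 ∷ 5 ∷ []) ⇒ᵇ leq 0 2 ∧ᵇ call setB (2 ∷ 0 ∷ 3 ∷ 4 ∷ 5 ∷ []))) t use₁ l) m)
        (call-from τ setB (1 ∷ 0 ∷ 3 ∷ 4 ∷ 5 ∷ []) d)

    set-consistent : ∀ n → PA ⊢ η ⇒ le (num n) B → PA ⊢ η ⇒ le (num (ngn n)) B → PA ⊢ η ⇒ SetF B n → PA ⊢ η ⇒ ¬' SetF B (ngn n)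
    set-consistent n l m d = ⇒-trans (⇒-app (⇒-app (bounded-at (num n ∷ₛ σ) 1 ψ (num (ngn n)) (bounded-at σ 0 (∀≤ 1 ψ) (num n) use₂ l) m)
        (⇒-const (proveL (var 0 ≐ᵇ negᵗ (var 1)) (ngn n ∷ n ∷ []) (sym (neg-eval n)))))
        (call-from τ setB (2 ∷ 1 ∷ 3 ∷ 4 ∷ 5 ∷ []) d)) (≡⇒ (cong ¬'_ (subF-args τ (2 ∷ 0 ∷ 3 ∷ 4 ∷ 5 ∷ []) (formula setB))))
      where
      ψ : BF
      ψ = var 0 ≐ᵇ negᵗ (var 1) ⇒ᵇ call setB (2 ∷ 1 ∷ 3 ∷ 4 ∷ 5 ∷ []) ⇒ᵇ ¬ᵇ call setB (2 ∷ 0 ∷ 3 ∷ 4 ∷ 5 ∷ [])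
      τ : ℕ → Term
      τ = num (ngn n) ∷ₛ num n ∷ₛ σ

    set-step : ∀ t n v → ℓ ≡ 1 → n ≤ t → v ≤ t → It t e 0 n v → ⟦ settledB ⟧ (t ∷ₛ v ∷ₛ e ∷ₛ λ _ → 0) →
               PA ⊢ η ⇒ le (num t) B → PA ⊢ η ⇒ SetF B n → PA ⊢ η ⇒ SetF B v
    set-step t n v ℓ≡1 p q it st l d = call-to τ setB (3 ∷ 0 ∷ 4 ∷ 5 ∷ 6 ∷ []) (⇒-app (⇒-app (⇒-app (⇒-app
        (bounded-at (num n ∷ₛ num t ∷ₛ σ) 1 ψ (num v) (bounded-at (num t ∷ₛ σ) 0 (∀≤ 1 ψ) (num n) (bounded-at σ 0 (∀≤ 0 (∀≤ 1 ψ)) (num t) use₃ l)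
          (⇒-const (num-≤ p))) (⇒-const (num-≤ q)))
        (⇒-const (proveL (var 0 ≐ᵇ suc' zer) (ℓ ∷ []) ℓ≡1)))
        (call-from τ itB (2 ∷ 4 ∷ 7 ∷ 1 ∷ 0 ∷ []) (⇒-const (proveL itB (t ∷ e ∷ 0 ∷ n ∷ v ∷ []) it))))
        (call-from τ settledB (2 ∷ 0 ∷ 4 ∷ []) (⇒-const (proveL settledB (t ∷ v ∷ e ∷ []) st))))
        (call-from τ setB (3 ∷ 1 ∷ 4 ∷ 5 ∷ 6 ∷ []) d))
      where
      ψ : BF
      ψ = var 6 ≐ᵇ suc' zer ⇒ᵇ call itB (2 ∷ 4 ∷ 7 ∷ 1 ∷ 0 ∷ []) ⇒ᵇ call settledB (2 ∷ 0 ∷ 4 ∷ []) ⇒ᵇ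
            call setB (3 ∷ 1 ∷ 4 ∷ 5 ∷ 6 ∷ []) ⇒ᵇ call setB (3 ∷ 0 ∷ 4 ∷ 5 ∷ 6 ∷ [])
      τ : ℕ → Term
      τ = num v ∷ₛ num n ∷ₛ num t ∷ₛ σ

    jumped : ∀ s → PA ⊢ η ⇒ le (num (junk s)) B → PA ⊢ η ⇒ SetF B (junk s) → PA ⊢ η ⇒ JumpedF s
    jumped s l d = call-to τ jumpedB (2 ∷ 1 ∷ 3 ∷ 4 ∷ 5 ∷ []) (⇒-app (⇒-app (bounded-at (num s ∷ₛ σ) 1 ψ (num (junk s))
        (bounded-at σ 0 (∀≤ 1 ψ) (num s) use₄ (⇒-trans l (le-num-mono B (≤junk s)))) l)
        (⇒-const (proveL (var 0 ≐ᵇ junkᵗ (var 1)) (junk s ∷ s ∷ []) (sym (junk-eval s)))))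
        (call-from τ setB (2 ∷ 0 ∷ 3 ∷ 4 ∷ 5 ∷ []) d))
      where
      ψ : BF
      ψ = var 0 ≐ᵇ junkᵗ (var 1) ⇒ᵇ call setB (2 ∷ 0 ∷ 3 ∷ 4 ∷ 5 ∷ []) ⇒ᵇ call jumpedB (2 ∷ 1 ∷ 3 ∷ 4 ∷ 5 ∷ [])
      τ : ℕ → Term
      τ = num (junk s) ∷ₛ num s ∷ₛ σ

    module _ (s x : ℕ) (x≤s : x ≤ s) (l : PA ⊢ η ⇒ le (num (junk s)) B) (d : PA ⊢ η ⇒ SetF B (junk s)) where
      τ : ℕ → Term
      τ = num x ∷ₛ num s ∷ₛ σ

      ψ : BF
      ψ = (call posB (0 ∷ 1 ∷ []) ⇒ᵇ call setB (2 ∷ 0 ∷ 3 ∷ 4 ∷ 5 ∷ [])) ∧ᵇ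
          (call negB (0 ∷ 1 ∷ []) ⇒ᵇ ¬ᵇ call setB (2 ∷ 0 ∷ 3 ∷ 4 ∷ 5 ∷ []))

      forces : PA ⊢ η ⇒ subF τ (formula ψ)
      forces = bounded-at (num s ∷ₛ σ) 0 ψ (num x) (⇒-app (bounded-at σ 0 (call jumpedB (1 ∷ 0 ∷ 2 ∷ 3 ∷ 4 ∷ []) ⇒ᵇ ∀≤ 0 ψ) (num s) use₅
          (⇒-trans l (le-num-mono B (≤junk s))))
          (call-from (num s ∷ₛ σ) jumpedB (1 ∷ 0 ∷ 2 ∷ 3 ∷ 4 ∷ []) (jumped s l d))) (⇒-const (num-≤ x≤s))

      forces-pos : ⟦ posB ⟧ (x ∷ₛ s ∷ₛ λ _ → 0) → PA ⊢ η ⇒ SetF B x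
      forces-pos h = call-to τ setB (2 ∷ 0 ∷ 3 ∷ 4 ∷ 5 ∷ []) (⇒-app (∧-fst forces)
        (call-from τ posB (0 ∷ 1 ∷ []) (⇒-const (proveL posB (x ∷ s ∷ []) h))))

      forces-neg : ⟦ negB ⟧ (x ∷ₛ s ∷ₛ λ _ → 0) → PA ⊢ η ⇒ ¬' SetF B x
      forces-neg h = ⇒-trans (⇒-app (∧-snd forces)
        (call-from τ negB (0 ∷ 1 ∷ []) (⇒-const (proveL negB (x ∷ s ∷ []) h))))
        (≡⇒ (cong ¬'_ (subF-args τ (2 ∷ 0 ∷ 3 ∷ 4 ∷ 5 ∷ []) (formula setB))))

  ⇒-falsum : ∀ {η φ} → PA ⊢ η ⇒ φ → PA ⊢ η ⇒ ¬' φ → PA ⊢ η ⇒ falsum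
  ⇒-falsum {η} {φ} = mp₂ (prop ((A₀ ⇒ₚ A₁) ⇒ₚ (A₀ ⇒ₚ ¬ₚ A₁) ⇒ₚ A₀ ⇒ₚ A₂) (η ∷ φ ∷ falsum ∷ []))

  -- By the first check, two provable numbers belong to the set of the later stage.
  common-stage : ∀ n m →
    (∀ {η} B → PA ⊢ η ⇒ CheckF B → PA ⊢ η ⇒ le (num n) B → PA ⊢ η ⇒ SetF B n → PA ⊢ η ⇒ le (num m) B → PA ⊢ η ⇒ SetF B m → PA ⊢ η ⇒ falsum) →
    PA ⊢ PrN n ⇒ PrN m ⇒ falsum
  common-stage n m g = PrN-elim n (⇒-trans (⇒-swap (PrN-elim m (⇒-trans (∧-curry (mp (∨-elim (⇒-swap (∧-curry first)) (⇒-swap (∧-curry second))) (le-lin (var 0) (var 1))))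
      (≡⇒ (cong₂ _⇒_ (sym (shiftF-Body (var 0) n)) refl)))))
      (≡⇒ (cong₂ _⇒_ (sym (shiftF-sentence (PrN m) (PrN-closed m))) refl)))
    where
    b₀ b₁ : Term
    b₀ = var 0
    b₁ = var 1
    both : Formula
    both = Body b₀ m ∧' Body b₁ n
    first : PA ⊢ both ∧' le b₀ b₁ ⇒ falsum
    first = g b₁ chk (⇒-trans bn (Body-le b₁ n)) (⇒-trans bn (Body-set b₁ n)) (∧-fst grown) (∧-snd grown)
      where
      bn : PA ⊢ both ∧' le b₀ b₁ ⇒ Body b₁ n
      bn = ∧-snd (∧-fst ⇒-refl)
      bm : PA ⊢ both ∧' le b₀ b₁ ⇒ Body b₀ m
      bm = ∧-fst (∧-fst ⇒-refl)
      chk : PA ⊢ both ∧' le b₀ b₁ ⇒ CheckF b₁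
      chk = ⇒-trans bn (Body-check b₁ n)
      grown : PA ⊢ both ∧' le b₀ b₁ ⇒ le (num m) b₁ ∧' SetF b₁ m
      grown = set-grows b₁ chk b₀ m (∧-snd ⇒-refl) (⇒-trans bm (Body-le b₀ m)) (⇒-trans bm (Body-set b₀ m))
    second : PA ⊢ both ∧' le b₁ b₀ ⇒ falsum
    second = g b₀ chk (∧-fst grown) (∧-snd grown) (⇒-trans bm (Body-le b₀ m)) (⇒-trans bm (Body-set b₀ m))
      where
      bn : PA ⊢ both ∧' le b₁ b₀ ⇒ Body b₁ n
      bn = ∧-snd (∧-fst ⇒-refl)
      bm : PA ⊢ both ∧' le b₁ b₀ ⇒ Body b₀ m
      bm = ∧-fst (∧-fst ⇒-refl)
      chk : PA ⊢ both ∧' le b₁ b₀ ⇒ CheckF b₀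
      chk = ⇒-trans bm (Body-check b₀ m)
      grown : PA ⊢ both ∧' le b₁ b₀ ⇒ le (num n) b₀ ∧' SetF b₀ n
      grown = set-grows b₀ chk b₁ n (∧-snd ⇒-refl) (⇒-trans bn (Body-le b₁ n)) (⇒-trans bn (Body-set b₁ n))

  PrN-consistent : ∀ n → PA ⊢ PrN n ⇒ PrN (ngn n) ⇒ falsum
  PrN-consistent n = common-stage n (ngn n) (λ B chk l d m d' → ⇒-falsum d' (set-consistent B chk n l m d))

  world-neg : ∀ s x → x ≤ s → ⟦ negB ⟧ (x ∷ₛ s ∷ₛ λ _ → 0) → PA ⊢ PrN (junk s) ⇒ PrN x ⇒ falsum
  world-neg s x p h = common-stage (junk s) x (λ B chk l d m d' → ⇒-falsum d' (forces-neg B chk s x p l d h))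

  world-pos : ∀ s x → x ≤ s → ⟦ posB ⟧ (x ∷ₛ s ∷ₛ λ _ → 0) → PA ⊢ PrN (junk s) ⇒ PrN x
  world-pos s x p h = PrN-elim (junk s) (⇒-trans
      (Body-intro (var 0) x chk (⇒-trans l (le-num-mono (var 0) (NP.≤-trans p (≤junk s))))
        (forces-pos (var 0) chk s x p l (Body-set (var 0) (junk s)) h))
      (⇒-trans (Body-PrN (var 0) x) (≡⇒ (sym (shiftF-sentence (PrN x) (PrN-closed x))))))
    where
    chk : PA ⊢ Body (var 0) (junk s) ⇒ CheckF (var 0)
    chk = Body-check (var 0) (junk s)
    l : PA ⊢ Body (var 0) (junk s) ⇒ le (num (junk s)) (var 0)
    l = Body-le (var 0) (junk s)

  -- For each stage below the numeral t PA decides whether n is provable there, and if so `truth`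
  -- gives the conclusion outright. At a later stage the third check is applied with t, where the
  -- computation of v from n is a decided fact. So PA never computes a box at a nonstandard stage.
  PrN-box : ∀ t n v → ℓ ≡ 1 → n ≤ t → v ≤ t → It t e 0 n v → ⟦ settledB ⟧ (t ∷ₛ v ∷ₛ e ∷ₛ λ _ → 0) →
            (∀ b → Holds b n → PA ⊢ PrN v) → PA ⊢ PrN n ⇒ PrN v
  PrN-box t n v ℓ≡1 p q it st truth = PrN-elim n (conv (cong₂ _⇒_ refl (trans (sub-closed (var 0)) (sym (shiftF-sentence (PrN v) (PrN-closed v)))))
      (below-cases (envT) (formula bodyB ⇒ PrN v) t small large))
    where
    envT : ℕ → Term
    envT = num n ∷ₛ num e ∷ₛ num c ∷ₛ num ℓ ∷ₛ λ _ → zer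
    sub-closed : ∀ B → subF (envS B (num n)) (PrN v) ≡ PrN v
    sub-closed B = subF-closed {0} (λ i ()) (PrN v) (PrN-closed v)
    small : ∀ k → k < t → PA ⊢ subF (num k ∷ₛ envT) (formula bodyB ⇒ PrN v)
    small k _ with Holds? k n
    ... | yes h = ⇒-const (conv (sym (sub-closed (num k))) (truth k h))
    ... | no ¬h = explode (¬Body-num k n ¬h)
    large : PA ⊢ le (num t) (var 0) ⇒ subF (var 0 ∷ₛ envT) (formula bodyB ⇒ PrN v)
    large = ⇒-trans (∧-curry (⇒-trans
        (Body-intro (var 0) v chk (⇒-trans (∧-fst ⇒-refl) (le-num-mono (var 0) q))
          (set-step (var 0) chk t n v ℓ≡1 p q it st (∧-fst ⇒-refl) (⇒-trans (∧-snd ⇒-refl) (Body-set (var 0) n))))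
        (Body-PrN (var 0) v))) (≡⇒ (cong₂ _⇒_ refl (sym (sub-closed (var 0)))))
      where
      chk : PA ⊢ le (num t) (var 0) ∧' Body (var 0) n ⇒ CheckF (var 0)
      chk = ⇒-trans (∧-snd ⇒-refl) (Body-check (var 0) n)

-- Modal formulas

depth : MForm → ℕ
depth (mvar p) = 0
depth m⊥       = 0
depth (m¬ A)   = depth A
depth (A m∧ B) = depth A ⊔ depth B
depth (A m∨ B) = depth A ⊔ depth B
depth (A m⇒ B) = depth A ⊔ depth B
depth (□ A)    = suc (depth A)

□^ : ℕ → MForm → MForm
□^ zero    A = A
□^ (suc i) A = □ (□^ i A)

mprimes : MForm → List MForm
mprimes (mvar p) = mvar p ∷ []
mprimes m⊥       = []
mprimes (m¬ A)   = mprimes A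
mprimes (A m∧ B) = mprimes A ++ mprimes B
mprimes (A m∨ B) = mprimes A ++ mprimes B
mprimes (A m⇒ B) = mprimes A ++ mprimes B
mprimes (□ A)    = □ A ∷ []

data MPrime (d : ℕ) : MForm → Set where
  is-var : ∀ p → MPrime d (mvar p)
  is-box : ∀ C → depth C < d → MPrime d (□ C)

MPrime-mono : ∀ {d d' q} → d ≤ d' → MPrime d q → MPrime d' q
MPrime-mono p (is-var v)   = is-var v
MPrime-mono p (is-box C l) = is-box C (NP.≤-trans l p)

mprime    : ∀ A {q} → q ∈ mprimes A → MPrime (depth A) q
mprime-++ : ∀ A B {q} → q ∈ mprimes A ++ mprimes B → MPrime (depth A ⊔ depth B) q
mprime (mvar p) (here refl) = is-var p
mprime (m¬ A)   m = mprime A m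
mprime (A m∧ B) m = mprime-++ A B m
mprime (A m∨ B) m = mprime-++ A B m
mprime (A m⇒ B) m = mprime-++ A B m
mprime (□ A)    (here refl) = is-box A NP.≤-refl
mprime-++ A B m = [ MPrime-mono (NP.m≤m⊔n _ _) ∘ mprime A , MPrime-mono (NP.m≤n⊔m (depth A) _) ∘ mprime B ]′ (∈-++⁻ (mprimes A) m)

evalM-agree : ∀ {W ν} A → (∀ q → q ∈ mprimes A → evalM W q ≡ ν q) → evalM W A ≡ evalM ν A
evalM-agree (mvar p) h = h _ (here refl)
evalM-agree m⊥       h = refl
evalM-agree (m¬ A)   h = cong not (evalM-agree A h)
evalM-agree (A m∧ B) h = cong₂ _∧_ (evalM-agree A (λ q → h q ∘ ∈-++⁺ˡ)) (evalM-agree B (λ q → h q ∘ ∈-++⁺ʳ (mprimes A)))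
evalM-agree (A m∨ B) h = cong₂ _∨_ (evalM-agree A (λ q → h q ∘ ∈-++⁺ˡ)) (evalM-agree B (λ q → h q ∘ ∈-++⁺ʳ (mprimes A)))
evalM-agree (A m⇒ B) h = cong₂ (λ a b → not a ∨ b) (evalM-agree A (λ q → h q ∘ ∈-++⁺ˡ)) (evalM-agree B (λ q → h q ∘ ∈-++⁺ʳ (mprimes A)))
evalM-agree (□ A)    h = h _ (here refl)

four : Logic → ℕ
four ND  = 0
four ND4 = 1

□-chain : ∀ L i C → i ≡ 0 ⊎ four L ≡ 1 → L ⊢ₘ □ C m⇒ □ (□^ i C)
□-chain L   zero    C _         = taut (λ ν → lem (ν (□ C)))
  where
  lem : ∀ b → not b ∨ b ≡ true
  lem true  = refl
  lem false = refl
□-chain ND4 (suc i) C (inj₂ l) = mp (mp (taut (λ ν → lem (ν (□ C)) (ν (□ (□^ i C))) (ν (□ (□ (□^ i C)))))) (□-chain ND4 i C (inj₂ l))) (ax4 (□^ i C))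
  where
  lem : ∀ a b c → not (not a ∨ b) ∨ (not (not b ∨ c) ∨ (not a ∨ c)) ≡ true
  lem true  true  true  = refl
  lem true  true  false = refl
  lem true  false c     = refl
  lem false true  true  = refl
  lem false true  false = refl
  lem false false c     = refl

-- Arithmetical soundness and completeness

module Arithmetic (T : Theory) (χ : PR 1) (χ-spec : ∀ φ → (T φ → evalPR χ (code φ ∷ []) ≡ 1) × (evalPR χ (code φ ∷ []) ≡ 1 → T φ))
                  (T-ext : Extends T PA) (T-con : Consistent T) (L : Logic) where

  open Predicate (codePR χ) (four L)
  open Truth T χ (λ φ h → proj₂ (χ-spec φ) (subst (λ k → evalPR χ (k ∷ []) ≡ 1) (gn≡code φ) h))
    (λ φ a → subst (λ k → evalPR χ (k ∷ []) ≡ 1) (sym (gn≡code φ)) (proj₁ (χ-spec φ) a)) T-ext T-con e (four L) PrN gn-box PrN-intro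
    hiding (c)

  Pr-code : ∀ φ → Pr ⟨ φ ⟩ ≡ PrN (gn φ)
  Pr-code φ = trans (Pr-num (code φ)) (cong PrN (sym (gn≡code φ)))

  Pr-intro : ∀ {φ} → T ⊢ φ → PA ⊢ Pr ⟨ φ ⟩
  Pr-intro {φ} d = conv (sym (Pr-code φ)) (Prov→PrN {gn φ} (φ , refl , d))

  -- Friedman's translation with `Prov n` for `R`. A proposed witness either satisfies the body, and
  -- `body→Prov` applies, or fails it, and then the translated body itself gives R.
  PrN-sound : ∀ n → PA ⊢ PrN n → Prov n
  PrN-sound n d = sound d (λ _ → 0) (λ b h → h (λ l h → h (λ k h → h (λ i h → h (λ { y (e₁ , e₂ , e₃ , e₄ , body) →
      e₁ (λ q₁ → e₂ (λ q₂ → e₃ (λ q₃ → e₄ (λ q₄ → decide b l k i y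
        (trans q₁ (evalT-num _ n)) (trans q₂ (evalT-num _ e)) (trans q₃ (evalT-num _ (codePR χ))) (trans q₄ (evalT-num _ (four L))) body)))) })))))
    where
    open Friedman (Prov n) hiding (decide)
    decide : ∀ b l k i y → y ≡ n → i ≡ e → k ≡ codePR χ → l ≡ four L →
             holds (subF (args (4 ∷ 0 ∷ 1 ∷ 2 ∷ 3 ∷ [])) (formula bodyB)) (y ∷ₛ i ∷ₛ k ∷ₛ l ∷ₛ b ∷ₛ λ _ → 0) → Prov n
    decide b _ _ _ _ refl refl refl refl h = cases (Holds? b n)
      where
      ρ : ℕ → ℕ
      ρ = n ∷ₛ e ∷ₛ codePR χ ∷ₛ four L ∷ₛ b ∷ₛ λ _ → 0
      cases : Dec (Holds b n) → Prov n
      cases (yes t) = body→Prov {b} {n} t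
      cases (no ¬t) = bounded-false bodyB (vals ρ (4 ∷ 0 ∷ 1 ∷ 2 ∷ 3 ∷ [])) ¬t
        (sub-to (formula bodyB) {args (4 ∷ 0 ∷ 1 ∷ 2 ∷ 3 ∷ [])} {ρ} (evalT-args ρ (4 ∷ 0 ∷ 1 ∷ 2 ∷ 3 ∷ [])) h)

  Pr-provability : IsProvPred T Pr
  Pr-provability = Pr-closed , λ φ → Pr-intro , λ d → prov (PrN-sound (gn φ) (conv (Pr-code φ) d))

  evalP-interp : ∀ f ν → ν falsum ≡ false → ∀ A → evalP ν (interp Pr f A) ≡ evalM (λ B → evalP ν (interp Pr f B)) A
  evalP-interp f ν h (mvar p) = refl
  evalP-interp f ν h m⊥       = h
  evalP-interp f ν h (m¬ A)   = cong not (evalP-interp f ν h A)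
  evalP-interp f ν h (A m∧ B) = cong₂ _∧_ (evalP-interp f ν h A) (evalP-interp f ν h B)
  evalP-interp f ν h (A m∨ B) = cong₂ _∨_ (evalP-interp f ν h A) (evalP-interp f ν h B)
  evalP-interp f ν h (A m⇒ B) = cong₂ (λ a b → not a ∨ b) (evalP-interp f ν h A) (evalP-interp f ν h B)
  evalP-interp f ν h (□ A)    = refl

  -- A valuation may make the equation `falsum` true, so the interpretation of a modal tautology is
  -- a propositional one only under the hypothesis that `falsum` is false.
  interp-taut : ∀ f A → MTautology A → PA ⊢ interp Pr f A
  interp-taut f A t = mp (taut (λ ν → cases ν (ν falsum) refl)) not-falsum
    where
    cases : ∀ ν b → ν falsum ≡ b → not (not b) ∨ evalP ν (interp Pr f A) ≡ true
    cases ν true  h = refl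
    cases ν false h = trans (evalP-interp f ν h A) (t _)

  Pr-code-≡ : ∀ φ {n} → gn φ ≡ n → Pr ⟨ φ ⟩ ≡ PrN n
  Pr-code-≡ φ h = trans (Pr-code φ) (cong PrN h)

  -- In Pr-D and Pr-4 the formula ψ is a variable, so that its code does not unfold.
  Pr-D : ∀ φ ψ → ψ ≡ ¬' φ → PA ⊢ ¬' (Pr ⟨ φ ⟩ ∧' Pr ⟨ ψ ⟩)
  Pr-D φ ψ q = conv (cong₂ (λ a b → ¬' (a ∧' b)) (sym (Pr-code φ)) (sym (Pr-code-≡ ψ (cong gn q))))
    (mp₂ (prop ((A₀ ⇒ₚ A₁ ⇒ₚ A₂) ⇒ₚ ¬ₚ A₂ ⇒ₚ ¬ₚ (A₀ ∧ₚ A₁)) (PrN (gn φ) ∷ PrN (ngn (gn φ)) ∷ falsum ∷ []))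
      (PrN-consistent (gn φ)) not-falsum)

  Pr-4 : four L ≡ 1 → ∀ φ ψ → ψ ≡ Pr ⟨ φ ⟩ → PA ⊢ Pr ⟨ φ ⟩ ⇒ Pr ⟨ ψ ⟩
  Pr-4 l φ ψ q = conv (cong₂ _⇒_ (sym (Pr-code φ)) (sym (Pr-code-≡ ψ (trans (cong gn (trans q (Pr-code φ))) (gn-box (gn φ))))))
    (PrN-box t n v l n≤t v≤t (It-mono {proj₁ it} {t} {e} {0} {n} {v} (NP.≤-trans (NP.m≤m⊔n (proj₁ it) _) (NP.m≤n⊔m v _)) (proj₂ it))
      (settled-mono {proj₁ st} {t} {v} (NP.≤-trans (NP.m≤n⊔m (proj₁ it) _) (NP.m≤n⊔m v _)) (proj₂ st))
      (λ b h → Prov→PrN {v} (Prov-box {n} (body→Prov {b} {n} h))))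
    where
    n v t : ℕ
    n = gn φ
    v = box e n
    it : ∃ λ b → It b e 0 n v
    it = It-complete e 0 n
    st : ∃ λ b → Settled b v
    st = settled-complete v
    t = v ⊔ (proj₁ it ⊔ proj₁ st)
    v≤t : v ≤ t
    v≤t = NP.m≤m⊔n v _
    n≤t : n ≤ t
    n≤t = NP.≤-trans (NP.<⇒≤ (box-> e n)) v≤t

  four-ND4 : L ≡ ND4 → four L ≡ 1
  four-ND4 refl = refl

  interp-□ : ∀ f A → interp Pr f (□ A) ≡ Pr ⟨ interp Pr f A ⟩
  interp-□ f A = refl

  interp-4 : ∀ f A B → four L ≡ 1 → B ≡ □ A → PA ⊢ interp Pr f (□ A m⇒ □ B)
  interp-4 f A B l q = Pr-4 l (interp Pr f A) (interp Pr f B) (trans (cong (interp Pr f) q) (interp-□ f A))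

  interp-sound : ∀ {A} (f : Realization) → L ⊢ₘ A → PA ⊢ interp Pr f A
  interp-sound f d = go d refl
    where
    -- The logic is generalised with an equation, because the fixed L cannot be matched against the
    -- index ND4 of `ax4`.
    go : ∀ {L' A} → L' ⊢ₘ A → L ≡ L' → PA ⊢ interp Pr f A
    go (taut {A = A} t) q = interp-taut f A t
    go (mp d d')        q = mp (go d q) (go d' q)
    go (nec {A = A} d)  q = Pr-intro {interp Pr f A} (T-ext _ (go d q))
    go (axD A)          q = Pr-D (interp Pr f A) (interp Pr f (m¬ A)) refl
    go (ax4 A)          q = interp-4 f A (□ A) (four-ND4 q) refl

  -- The numbers of the variables are not numbers of formulas, and each variable
  -- is interpreted by a conjunction, so that it is not a box either.
  varCode : ℕ → ℕ
  varCode p = node 0 (node 0 (suc (p N.+ p)))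

  F₀ : Realization
  F₀ = record { val = λ p → PrN (varCode p) ∧' PrN (varCode p) ; closed = λ p → PrN-closed (varCode p) , PrN-closed (varCode p) }

  F : MForm → Formula
  F = interp Pr F₀

  PrN-inj : ∀ {n m} → PrN n ≡ PrN m → n ≡ m
  PrN-inj {n} {m} h = trans (sym (evalT-num (λ _ → 0) n)) (trans (cong (evalT (λ _ → 0)) (cong pick h)) (evalT-num (λ _ → 0) m))
    where
    pick : Formula → Term
    pick (∃' (∃' (∃' (∃' (∃' ((_ ≐ t) ∧' _)))))) = t
    pick _ = zer

  gn-PrN-inv : ∀ φ u → gn φ ≡ box e u → φ ≡ PrN u
  gn-PrN-inv φ u h = gn-inj φ (PrN u) h

  F-□ : ∀ A n → F A ≡ PrN n → ∃ λ C → A ≡ □ C × gn (F C) ≡ n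
  F-□ (□ C) n h = C , refl , PrN-inj (trans (sym (Pr-code (F C))) h)

  varCode-inj : ∀ {p q} → varCode p ≡ varCode q → p ≡ q
  varCode-inj h = double-inj (NP.suc-injective (proj₂ (node-inj 0 0 (proj₂ (node-inj 0 0 h)))))

  varCode≢ngn : ∀ {p x} → varCode p ≢ ngn x
  varCode≢ngn h with proj₁ (node-inj 0 1 h)
  ... | ()

  F≢var : ∀ A {n b} → F A ≡ PrN n → n ≢ node 0 (node 0 b)
  F≢var A {n} h q with F-□ A n h
  ... | C , _ , r = gn≢0-0 (F C) (trans r q)

  ∧-left ∧-right : Formula → Formula
  ∧-left (φ ∧' ψ) = φ
  ∧-left φ        = φ
  ∧-right (φ ∧' ψ) = ψ
  ∧-right φ        = φ

  -- The sentences for the variables were chosen for this: they are conjunctions whose halves are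
  -- boxes of numbers of no formula, so a variable cannot be confused with a modal conjunction.
  F-inj : ∀ A B → F A ≡ F B → A ≡ B
  F-inj (mvar p) (mvar q) h = cong mvar (varCode-inj (PrN-inj (cong ∧-left h)))
  F-inj (mvar p) (B m∧ C) h = ⊥-elim (F≢var B {varCode p} (sym (cong ∧-left h)) refl)
  F-inj (A m∧ B) (mvar q) h = ⊥-elim (F≢var A {varCode q} (cong ∧-left h) refl)
  F-inj m⊥ m⊥ h = refl
  F-inj (m¬ A) (m¬ B) h = cong m¬ (F-inj A B (cong (λ { (¬' φ) → φ ; φ → φ }) h))
  F-inj (A m∧ B) (C m∧ D) h = cong₂ _m∧_ (F-inj A C (cong ∧-left h)) (F-inj B D (cong ∧-right h))
  F-inj (A m∨ B) (C m∨ D) h = cong₂ _m∨_ (F-inj A C (cong (λ { (φ ∨' ψ) → φ ; φ → φ }) h)) (F-inj B D (cong (λ { (φ ∨' ψ) → ψ ; φ → φ }) h))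
  F-inj (A m⇒ B) (C m⇒ D) h = cong₂ _m⇒_ (F-inj A C (cong (λ { (φ ⇒ ψ) → φ ; φ → φ }) h)) (F-inj B D (cong (λ { (φ ⇒ ψ) → ψ ; φ → φ }) h))
  F-inj (□ A) (□ B) h = cong □ (F-inj A B (gn-inj (F A) (F B) (PrN-inj (trans (sym (Pr-code (F A))) (trans h (Pr-code (F B)))))))

  gnF-inj : ∀ A B → gn (F A) ≡ gn (F B) → A ≡ B
  gnF-inj A B h = F-inj A B (gn-inj (F A) (F B) h)

  -- Carries the boxes added by the closure in ND4 back to modal formulas, to which the axiom 4
  -- applies.
  gnF-boxes : ∀ i D C → gn (F D) ≡ boxes e i (gn (F C)) → D ≡ □^ i C
  gnF-boxes zero    D C h = gnF-inj D C h
  gnF-boxes (suc i) D C h with F-□ D (boxes e i (gn (F C))) (gn-PrN-inv (F D) (boxes e i (gn (F C))) h)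
  ... | D' , refl , q = cong □ (gnF-boxes i D' C q)

  gnF≢boxes : ∀ i D {b} → gn (F D) ≢ boxes e i (node 0 (node 0 b))
  gnF≢boxes zero    D h = gn≢0-0 (F D) h
  gnF≢boxes (suc i) D {b} h with F-□ D (boxes e i (node 0 (node 0 b))) (gn-PrN-inv (F D) (boxes e i (node 0 (node 0 b))) h)
  ... | D' , refl , q = gnF≢boxes i D' q

  gnF-ngn : ∀ C {x} → gn (F C) ≡ ngn x → ∃ λ D → C ≡ m¬ D × gn (F D) ≡ x
  gnF-ngn C {x} h with view-¬ (F C) {x} (sym h)
  gnF-ngn (m¬ D) h | φ , q , r = D , refl , trans (cong gn (cong (λ { (¬' φ) → φ ; φ → φ }) q)) (sym r)

  Completes : MForm → Set
  Completes A = T ⊢ F A → L ⊢ₘ A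

  -- One branch of the case distinction: γ forces the valuation ν on the prime parts of A, and the
  -- world 2s is to make provable those that ν makes true and unprovable the others.
  module Leaf (A : MForm) (A-prov : T ⊢ F A) (ih : ∀ D → depth D < depth A → Completes D) (ν : MForm → Bool) (γ : MForm)
              (γ-decides : ∀ W → evalM W γ ≡ true → ∀ q → q ∈ mprimes A → evalM W q ≡ ν q) where

    atomNumber : MForm → ℕ
    atomNumber (mvar p) = varCode p
    atomNumber (□ C)    = gn (F C)
    -- A dummy value: prime parts are variables or boxes.
    atomNumber _        = 0

    entryM : MForm → ℕ
    entryM q = if ν q then atomNumber q N.+ atomNumber q else suc (atomNumber q N.+ atomNumber q)

    numbers : List ℕ
    numbers = map entryM (mprimes A)

    s : ℕ
    s = setCode (proj₁ (maxL numbers)) numbers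

    Pos-in : ∀ {q} → q ∈ mprimes A → ν q ≡ true → Pos (atomNumber q) s
    Pos-in {q} m v = Pos-from {atomNumber q} {s} (Mem-setCode _ numbers _ (proj₂ (maxL numbers))
      (subst (_∈ numbers) (cong (λ b → if b then atomNumber q N.+ atomNumber q else suc (atomNumber q N.+ atomNumber q)) v) (∈-map⁺ entryM m)))

    Neg-in : ∀ {q} → q ∈ mprimes A → ν q ≡ false → Neg (atomNumber q) s
    Neg-in {q} m v = Neg-from {atomNumber q} {s} (Mem-setCode _ numbers _ (proj₂ (maxL numbers))
      (subst (_∈ numbers) (cong (λ b → if b then atomNumber q N.+ atomNumber q else suc (atomNumber q N.+ atomNumber q)) v) (∈-map⁺ entryM m)))

    Pos-out : ∀ {x} → Pos x s → ∃ λ q → q ∈ mprimes A × ν q ≡ true × atomNumber q ≡ x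
    Pos-out {x} h with ∈-map⁻ entryM (setCode-Mem _ numbers _ (proj₂ (maxL numbers)) (Pos-to {x} {s} h))
    ... | q , m , r = q , m , go (ν q) refl r
      where
      go : ∀ b → ν q ≡ b → x N.+ x ≡ (if b then atomNumber q N.+ atomNumber q else suc (atomNumber q N.+ atomNumber q)) → ν q ≡ true × atomNumber q ≡ x
      go true  v r = v , double-inj (sym r)
      go false v r = ⊥-elim (double-odd x (atomNumber q) r)

    Neg-out : ∀ {x} → Neg x s → ∃ λ q → q ∈ mprimes A × ν q ≡ false × atomNumber q ≡ x
    Neg-out {x} h with ∈-map⁻ entryM (setCode-Mem _ numbers _ (proj₂ (maxL numbers)) (Neg-to {x} {s} h))
    ... | q , m , r = q , m , go (ν q) refl r
      where
      go : ∀ b → ν q ≡ b → suc (x N.+ x) ≡ (if b then atomNumber q N.+ atomNumber q else suc (atomNumber q N.+ atomNumber q)) → ν q ≡ false × atomNumber q ≡ x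
      go false v r = v , double-inj (sym (NP.suc-injective r))
      go true  v r = ⊥-elim (double-odd (atomNumber q) x (sym r))

    H : Formula
    H = PrN (junk s)

    signed : Bool → Formula → Formula
    signed b φ = if b then φ else ¬' φ

    atom-value : ∀ q → q ∈ mprimes A → PA ⊢ H ⇒ signed (ν q) (PrN (atomNumber q))
    atom-value q m = go (ν q) refl
      where
      go : ∀ b → ν q ≡ b → PA ⊢ H ⇒ signed b (PrN (atomNumber q))
      go true  v = world-pos s (atomNumber q) (Pos-≤ {atomNumber q} {s} (Pos-in m v)) (Pos-in m v)
      go false v = mp₂ (prop ((A₀ ⇒ₚ A₁ ⇒ₚ A₂) ⇒ₚ ¬ₚ A₂ ⇒ₚ A₀ ⇒ₚ ¬ₚ A₁) (H ∷ PrN (atomNumber q) ∷ falsum ∷ []))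
        (world-neg s (atomNumber q) (Neg-≤ {atomNumber q} {s} (Neg-in m v)) (Neg-in m v)) not-falsum

    signed-¬ : ∀ b {φ} → PA ⊢ H ⇒ signed b φ → PA ⊢ H ⇒ signed (not b) (¬' φ)
    signed-¬ true  d = ⇒-trans d (prop (A₀ ⇒ₚ ¬ₚ ¬ₚ A₀) (_ ∷ []))
    signed-¬ false d = d

    signed-∧ : ∀ a b {φ ψ} → PA ⊢ H ⇒ signed a φ → PA ⊢ H ⇒ signed b ψ → PA ⊢ H ⇒ signed (a ∧ b) (φ ∧' ψ)
    signed-∧ true  true  d d' = ∧-intro d d'
    signed-∧ true  false d d' = ⇒-trans d' (contrapose (∧-snd ⇒-refl))
    signed-∧ false b     d d' = ⇒-trans d (contrapose (∧-fst ⇒-refl))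

    signed-∨ : ∀ a b {φ ψ} → PA ⊢ H ⇒ signed a φ → PA ⊢ H ⇒ signed b ψ → PA ⊢ H ⇒ signed (a ∨ b) (φ ∨' ψ)
    signed-∨ true  b     d d' = ⇒-trans d ∨-inl
    signed-∨ false true  d d' = ⇒-trans d' ∨-inr
    signed-∨ false false d d' = mp₂ (prop ((A₀ ⇒ₚ ¬ₚ A₁) ⇒ₚ (A₀ ⇒ₚ ¬ₚ A₂) ⇒ₚ A₀ ⇒ₚ ¬ₚ (A₁ ∨ₚ A₂)) (_ ∷ _ ∷ _ ∷ [])) d d'

    signed-⇒ : ∀ a b {φ ψ} → PA ⊢ H ⇒ signed a φ → PA ⊢ H ⇒ signed b ψ → PA ⊢ H ⇒ signed (not a ∨ b) (φ ⇒ ψ)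
    signed-⇒ true  true  d d' = ⇒-trans d' (prop (A₀ ⇒ₚ A₁ ⇒ₚ A₀) (_ ∷ _ ∷ []))
    signed-⇒ true  false d d' = mp₂ (prop ((A₀ ⇒ₚ A₁) ⇒ₚ (A₀ ⇒ₚ ¬ₚ A₂) ⇒ₚ A₀ ⇒ₚ ¬ₚ (A₁ ⇒ₚ A₂)) (_ ∷ _ ∷ _ ∷ [])) d d'
    signed-⇒ false b     d d' = ⇒-trans d (prop (¬ₚ A₀ ⇒ₚ A₀ ⇒ₚ A₁) (_ ∷ _ ∷ []))

    signed-double : ∀ b {φ} → PA ⊢ H ⇒ signed b φ → PA ⊢ H ⇒ signed b (φ ∧' φ)
    signed-double true  d = ∧-intro d d
    signed-double false d = ⇒-trans d (contrapose (∧-fst ⇒-refl))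

    value : ∀ B → (∀ q → q ∈ mprimes B → q ∈ mprimes A) → PA ⊢ H ⇒ signed (evalM ν B) (F B)
    value (mvar p) i = signed-double (ν (mvar p)) {PrN (varCode p)} (atom-value (mvar p) (i _ (here refl)))
    value m⊥       i = ⇒-const not-falsum
    value (m¬ B)   i = signed-¬ (evalM ν B) {F B} (value B i)
    value (B m∧ C) i = signed-∧ (evalM ν B) (evalM ν C) {F B} {F C} (value B (λ q → i q ∘ ∈-++⁺ˡ)) (value C (λ q → i q ∘ ∈-++⁺ʳ (mprimes B)))
    value (B m∨ C) i = signed-∨ (evalM ν B) (evalM ν C) {F B} {F C} (value B (λ q → i q ∘ ∈-++⁺ˡ)) (value C (λ q → i q ∘ ∈-++⁺ʳ (mprimes B)))
    value (B m⇒ C) i = signed-⇒ (evalM ν B) (evalM ν C) {F B} {F C} (value B (λ q → i q ∘ ∈-++⁺ˡ)) (value C (λ q → i q ∘ ∈-++⁺ʳ (mprimes B)))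
    value (□ C)    i = conv (cong (λ φ → H ⇒ signed (ν (□ C)) φ) (sym (Pr-code (F C)))) (atom-value (□ C) (i _ (here refl)))

    no-junk : ∀ t → ¬ Pos (junk t) s
    no-junk t h with Pos-out {junk t} h
    ... | q , m , _ , r with mprime A m
    ...   | is-var p   = double-odd t p (sym (proj₂ (node-inj 0 0 (proj₂ (node-inj 0 0 r)))))
    ...   | is-box C _ = gn≢0-0 (F C) r

    obstruction : evalM ν A ≡ false → Obstruction s
    -- As H is the box of the name, the number of `¬' H` is that of a negated box with k = 0.
    obstruction v = refuted-world s no-junk 0 (inj₁ refl) (¬' H , refl ,
      mp₂ (prop ((A₀ ⇒ₚ ¬ₚ A₁) ⇒ₚ A₁ ⇒ₚ ¬ₚ A₀) (H ∷ F A ∷ []))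
        (T-ext _ (subst (λ b → PA ⊢ H ⇒ signed b (F A)) v (value A (λ q m → m)))) A-prov)

    from₁ : ∀ {X} → L ⊢ₘ X → (∀ W → evalM W X ≡ true → evalM W γ ≡ true → ⊥) → L ⊢ₘ γ m⇒ A
    from₁ {X} d h = mp (taut (λ W → cases W (evalM W X) (evalM W γ) refl refl)) d
      where
      cases : ∀ W x g → evalM W X ≡ x → evalM W γ ≡ g → not x ∨ (not g ∨ evalM W A) ≡ true
      cases W false g     p q = refl
      cases W true  false p q = refl
      cases W true  true  p q = ⊥-elim (h W p q)

    from₂ : ∀ {X Y} → L ⊢ₘ X → L ⊢ₘ Y → (∀ W → evalM W X ≡ true → evalM W Y ≡ true → evalM W γ ≡ true → ⊥) → L ⊢ₘ γ m⇒ A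
    from₂ {X} {Y} d d' h = from₁ {X m∧ Y} (mp (mp (taut (λ W → conj-taut (evalM W X) (evalM W Y))) d) d')
      (λ W p → spsigned W (evalM W X) (evalM W Y) refl refl p)
      where
      conj-taut : ∀ a b → not a ∨ (not b ∨ (a ∧ b)) ≡ true
      conj-taut true  true  = refl
      conj-taut true  false = refl
      conj-taut false b     = refl
      spsigned : ∀ W a b → evalM W X ≡ a → evalM W Y ≡ b → a ∧ b ≡ true → evalM W γ ≡ true → ⊥
      spsigned W true true p q _ = h W p q

    contradiction-D : ∀ W C → evalM W (m¬ (□ C m∧ □ (m¬ C))) ≡ true → W (□ C) ≡ true → W (□ (m¬ C)) ≡ true → ⊥
    contradiction-D W C h p q with W (□ C) | W (□ (m¬ C))
    contradiction-D W C () p q | true | true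

    step-true : ∀ W X Y → evalM W (X m⇒ Y) ≡ true → evalM W X ≡ true → evalM W Y ≡ true
    step-true W X Y h p with evalM W X | evalM W Y
    step-true W X Y h p | true | true = refl

    L-decides : ∀ {b} → ∀ W → evalM W γ ≡ true → ∀ q → q ∈ mprimes A → ν q ≡ b → evalM W q ≡ b
    L-decides W g q m v = trans (γ-decides W g q m) v

    clash : ∀ {b} → b ≡ true → b ≡ false → ⊥
    clash refl ()

    -- A theorem of T that interferes is the interpretation of a formula of smaller depth, so the
    -- induction hypothesis makes it a theorem of the logic. Necessitation with D, or iterated use
    -- of 4, then refutes γ. The numbers of variables and the name match no interpreted formula, so
    -- cases that confuse them are empty.
    blocked : Obstruction s → L ⊢ₘ γ m⇒ A
    blocked (pos-ngn-prov x px h) with Pos-out {ngn x} h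
    ... | q , m , v , r with mprime A m
    ...   | is-var p = ⊥-elim (varCode≢ngn {p} {x} r)
    ...   | is-box C l with gnF-ngn C {x} r
    ...     | D , refl , refl = from₂ (nec (ih D l (prov px))) (axD D)
                (λ W p p' g → contradiction-D W D p' p (L-decides W g (□ (m¬ D)) m v))
    blocked (pos-refuted x h px) with Pos-out {x} h
    ... | q , m , v , r with mprime A m
    ...   | is-var p = ⊥-elim (¬Prov-ngn-0-0 (subst (Prov ∘ ngn) (sym r) px))
    ...   | is-box C l = from₂ (nec (ih (m¬ C) l (prov (subst (Prov ∘ ngn) (sym r) px)))) (axD C)
                (λ W p p' g → contradiction-D W C p' (L-decides W g (□ C) m v) p)
    blocked (pos-pos x i c h h') with Pos-out {x} h | Pos-out {ngn (boxes e i x)} h'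
    ... | q , m , v , r | q' , m' , v' , r' with mprime A m | mprime A m'
    ...   | _ | is-var p = ⊥-elim (varCode≢ngn {p} {boxes e i x} r')
    ...   | b | is-box C' _ with gnF-ngn C' {boxes e i x} r'
    blocked (pos-pos x i c h h') | q , m , v , r | q' , m' , v' , r' | is-var p | is-box C' _ | D , refl , z =
      ⊥-elim (gnF≢boxes i D (trans z (cong (boxes e i) (sym r))))
    blocked (pos-pos x i c h h') | q , m , v , r | q' , m' , v' , r' | is-box C _ | is-box C' _ | D , refl , z
      with gnF-boxes i D C (trans z (cong (boxes e i) (sym r)))
    ... | refl = from₂ (□-chain L i C c) (axD (□^ i C))
          (λ W p p' g → contradiction-D W (□^ i C) p' (step-true W (□ C) (□ (□^ i C)) p (L-decides W g (□ C) m v))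
            (L-decides W g (□ (m¬ (□^ i C))) m' v'))
    blocked (pos-junk i h) with Pos-out {ngn (boxes e i (junk s))} h
    ... | q , m , v , r with mprime A m
    ...   | is-var p = ⊥-elim (varCode≢ngn {p} {boxes e i (junk s)} r)
    ...   | is-box C _ with gnF-ngn C {boxes e i (junk s)} r
    ...     | D , refl , z = ⊥-elim (gnF≢boxes i D z)
    blocked (neg-prov x px h) with Neg-out {x} h
    ... | q , m , v , r with mprime A m
    ...   | is-var p = ⊥-elim (¬Prov-0-0 (subst Prov (sym r) px))
    ...   | is-box C l = from₁ (nec (ih C l (prov (subst Prov (sym r) px)))) (λ W p g → clash p (L-decides W g (□ C) m v))
    blocked (neg-pos x i c h h') with Pos-out {x} h | Neg-out {boxes e i x} h'
    ... | q , m , v , r | q' , m' , v' , r' with mprime A m | mprime A m'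
    ...   | is-box C _ | is-box C' _ with gnF-boxes i C' C (trans r' (cong (boxes e i) (sym r)))
    ...     | refl = from₁ (□-chain L i C c) (λ W p g → clash (step-true W (□ C) (□ (□^ i C)) p (L-decides W g (□ C) m v))
                       (L-decides W g (□ (□^ i C)) m' v'))
    blocked (neg-pos x i c h h') | q , m , v , r | q' , m' , v' , r' | is-var p | is-box C' _ =
      ⊥-elim (gnF≢boxes i C' (trans r' (cong (boxes e i) (sym r))))
    blocked (neg-pos x zero c h h') | q , m , v , r | q' , m' , v' , r' | is-var p | is-var p' with varCode-inj {p'} {p} (trans r' (sym r))
    ... | refl = ⊥-elim (clash v v')
    blocked (neg-pos x (suc i) c h h') | q , m , v , r | q' , m' , v' , r' | _ | is-var p' with proj₁ (node-inj 0 6 r')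
    ... | ()
    blocked (neg-pos x zero c h h') | q , m , v , r | q' , m' , v' , r' | is-box C _ | is-var p' = ⊥-elim (gn≢0-0 (F C) (trans r (sym r')))
    blocked (neg-junk i h) with Neg-out {boxes e i (junk s)} h
    ... | q , m , v , r with mprime A m
    ...   | is-box C _ = ⊥-elim (gnF≢boxes i C r)
    blocked (neg-junk zero h) | q , m , v , r | is-var p =
      ⊥-elim (double-odd s p (sym (proj₂ (node-inj 0 0 (proj₂ (node-inj 0 0 r))))))
    blocked (neg-junk (suc i) h) | q , m , v , r | is-var p with proj₁ (node-inj 0 6 r)
    ... | ()

    leaf : L ⊢ₘ γ m⇒ A
    leaf = go (evalM ν A) refl
      where
      go : ∀ b → evalM ν A ≡ b → L ⊢ₘ γ m⇒ A
      go false v = blocked (obstruction v)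
      go true  v = taut (λ W → cases W (evalM W γ) refl)
        where
        cases : ∀ W g → evalM W γ ≡ g → not g ∨ evalM W A ≡ true
        cases W false p = refl
        cases W true  p = trans (evalM-agree A (γ-decides W p)) v

  module _ (A : MForm) (A-prov : T ⊢ F A) (ih : ∀ D → depth D < depth A → Completes D) where
    -- A table on the numbers of interpretations: equality of numbers is decidable, and `gnF-inj`
    -- keeps different modal formulas apart.
    valuation : (ℕ → Bool) → MForm → Bool
    valuation v B = v (gn (F B))

    PendingM : List MForm → MForm → (ℕ → Bool) → Set
    PendingM qs γ v = ∀ q → q ∈ mprimes A → q ∈ qs ⊎ (∀ W → evalM W γ ≡ true → evalM W q ≡ valuation v q)

    litM : Bool → MForm → MForm
    litM b q = if b then q else m¬ q

    litM-true : ∀ W b q → evalM W (litM b q) ≡ true → evalM W q ≡ b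
    litM-true W true  q h = h
    litM-true W false q h with evalM W q
    ... | false = refl

    ∧-both : ∀ a b → a ∧ b ≡ true → a ≡ true × b ≡ true
    ∧-both true true h = refl , refl

    extend : ∀ q b qs γ v → PendingM (q ∷ qs) γ v → PendingM qs (litM b q m∧ γ) (update v (gn (F q)) b)
    extend q b qs γ v p r m with p r m
    ... | inj₁ (there k) = inj₁ k
    ... | inj₁ (here refl) = inj₂ λ W h → trans (litM-true W b q (proj₁ (∧-both _ _ h))) (hit (gn (F q)))
      where
      hit : ∀ n → b ≡ update v n b n
      hit n with n NP.≟ n
      ... | yes _ = refl
      ... | no ¬e = ⊥-elim (¬e refl)
    ... | inj₂ d with gn (F r) NP.≟ gn (F q)
    ...   | no _  = inj₂ λ W h → d W (proj₂ (∧-both _ _ h))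
    ...   | yes k with gnF-inj r q k
    ...     | refl = inj₂ λ W h → litM-true W b q (proj₁ (∧-both _ _ h))

    splitM : ∀ qs γ v → PendingM qs γ v → L ⊢ₘ γ m⇒ A
    splitM [] γ v p = Leaf.leaf A A-prov ih (valuation v) γ (λ W h q m → [ (λ ()) , (λ d → d W h) ]′ (p q m))
    splitM (q ∷ qs) γ v p = mp (mp (taut (λ W → lem (evalM W q) (evalM W γ) (evalM W A)))
      (splitM qs (q m∧ γ) (update v (gn (F q)) true) (extend q true qs γ v p)))
      (splitM qs (m¬ q m∧ γ) (update v (gn (F q)) false) (extend q false qs γ v p))
      where
      lem : ∀ q g a → not (not (q ∧ g) ∨ a) ∨ (not (not (not q ∧ g) ∨ a) ∨ (not g ∨ a)) ≡ true
      lem true  true  true  = refl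
      lem true  true  false = refl
      lem true  false true  = refl
      lem true  false false = refl
      lem false true  true  = refl
      lem false true  false = refl
      lem false false true  = refl
      lem false false false = refl

    completes : L ⊢ₘ A
    -- The branching starts with every prime part pending and the trivially true ¬ ⊥ as the empty
    -- conjunction.
    completes = mp (splitM (mprimes A) (m¬ m⊥) (λ _ → false) (λ q → inj₁)) (taut (λ _ → refl))

  -- Induction on the modal depth, because a leaf appeals to completeness for formulas standing
  -- under a box in A.
  complete : ∀ A → Completes A
  complete A = go (depth A) A refl
    where
    go : ∀ d A → depth A ≡ d → Completes A
    go = NI.<-rec (λ d → ∀ A → depth A ≡ d → Completes A)
      (λ { _ ih A refl t → completes A t (λ D l → ih l D refl) })

theorem4p1 : (T : Theory) → PrimRecAxiomatized T → Extends T PA → Consistent T →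
    (L : Logic) →
    Σ Formula λ Pr → Σ1 Pr × IsProvPred T Pr
    × (∀ (A : MForm) (f : Realization) → L ⊢ₘ A → PA ⊢ interp Pr f A)
    × Σ Realization λ f → ∀ (A : MForm) →
    (L ⊢ₘ A → T ⊢ interp Pr f A) × (T ⊢ interp Pr f A → L ⊢ₘ A)
theorem4p1 T (χ , χ-spec) T-ext T-con L =
  Pr , Pr-Σ1 , Pr-provability , (λ A f → interp-sound f) ,
  F₀ , (λ A → (λ d → T-ext _ (interp-sound F₀ d)) , complete A)
  where
  open Predicate (codePR χ) (four L) using (Pr; Pr-Σ1)
  open Arithmetic T χ χ-spec T-ext T-con L
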